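{- Let $C$ be a maximal chord separated collection in $2^{[n]}$. The set $\mathbf S^\ast(C)$ of maximal by size strongly separated collections contained in $C$ is a distributive lattice with the minimal element $\mathcal I_n$ and the maximal element $\mathrm{co}\text{ - }\mathcal I_n$, in which $S\in\mathbf S^\ast(C)$ immediately precedes $S'\in\mathbf S^\ast(C)$ if and only if $S'$ is obtained from $S$ by one raising flip.
   Context: Notation: $[n]=\{1,\ldots,n\}$; $A-B=\{a\in A: a\notin B\}$; for $X\subseteq[n]$ and elements $a,\ldots,b\notin X$, $Xa\ldots b$ denotes $X\cup\{a,\ldots,b\}$. For $A,B\subseteq[n]$ write $A<B$ if $\max(A)<\min(B)$ (with $\max(\emptyset)=\min(\emptyset)=0$). $A,B$ are strongly separated if $A=B$ or $(A-B)<(B-A)$ or $(B-A)<(A-B)$. $A,B$ are chord separated if there are no elements $i<j<k<l$ of $[n]$ such that $i,k$ belong to one, and $j,l$ to the other, of the sets $A-B$ and $B-A$. A collection $\mathcal F\subseteq2^{[n]}$ is strongly (chord) separated if any two of its members are. "Maximal chord separated collection in $2^{[n]}$" means inclusion-wise maximal. $\mathbf S^\ast(C)$ is the set of strongly separated collections contained in $C$ having the maximal size, which equals $\frac12n(n+1)+1$ (the maximum size of a strongly separated collection in $2^{[n]}$). $\mathcal I_n$ is the set of all intervals $\{i,i+1,\ldots,j\}$, $1\le i\le j\le n$, together with $\emptyset$; $\mathrm{co}\text{ - }\mathcal I_n$ is the set of co-intervals, i.e. the complements $[n]-I$ of the members $I\in\mathcal I_n$. $S'$ is obtained from $S$ by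 one raising flip ("in the presence of six witnesses") if there exist $i<j<k$ and $X\subseteq[n]-\{i,j,k\}$ such that $X,Xi,Xj,Xk,Xij,Xjk,Xijk\in S$ and $S'=(S-\{Xj\})\cup\{Xik\}$. -}

module Defs where

open import Level using (0ℓ)
open import Data.Bool.Base using (Bool; T)
open import Data.Nat.Base as ℕ using (ℕ; zero; suc)
open import Data.Fin.Base using (Fin; toℕ; _<_; _≤_)
open import Data.Fin.Subset as Sub using (Subset; inside; outside; ⊥; ⁅_⁆; ∁; _∈_; _∉_; _─_)
open import Data.Fin.Subset.Properties using (_∈?_)
open import Data.List.Base using (List; []; _∷_; _++_; map; filter; filterᵇ; length; allFin)
open import Data.List.Extrema.Nat using (min; max)
import Data.Vec.Base as Vec
open import Data.Product.Base using (_×_; ∃; ∃₂)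
open import Data.Sum.Base using (_⊎_)
open import Function.Base using (_∘_)
open import Function.Bundles using (_⇔_)
open import Relation.Binary.Core using (Rel)
import Relation.Binary.Construct.NonStrictToStrict as NonStrictToStrict
open import Relation.Binary.PropositionalEquality.Core using (_≡_)
open import Relation.Nullary.Negation.Core using (¬_)
open import Relation.Unary using (Pred; _⊆_; _≐_; _∪_; _∖_; ｛_｝)

private
  variable
    n : ℕ

-- The ground set [n] is Fin n, where x : Fin n stands for the number
-- suc (toℕ x).  The shift matters below, because 0 is the value given to
-- the maximum and minimum of the empty set.

elements : Subset n → List ℕ
elements {n} A = map (suc ∘ toℕ) (filter (_∈? A) (allFin n))

maxElt : Subset n → ℕ
maxElt A = max 0 (elements A)

minElt : Subset n → ℕ
minElt A with elements A
... | []     = 0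
... | x ∷ xs = min x xs

infix 4 _≪_

_≪_ : Rel (Subset n) 0ℓ
A ≪ B = maxElt A ℕ.< minElt B

StronglySeparated : Rel (Subset n) 0ℓ
StronglySeparated A B = A ≡ B ⊎ (A ─ B) ≪ (B ─ A) ⊎ (B ─ A) ≪ (A ─ B)

Interlace : Rel (Subset n) 0ℓ
Interlace {n} P Q =
  ∃₂ λ (i j : Fin n) → ∃₂ λ (k l : Fin n) →
    i < j × j < k × k < l × i ∈ P × k ∈ P × j ∈ Q × l ∈ Q

ChordSeparated : Rel (Subset n) 0ℓ
ChordSeparated A B = ¬ (Interlace (A ─ B) (B ─ A) ⊎ Interlace (B ─ A) (A ─ B))

-- A collection is given by its characteristic function.  Collections are
-- compared through their members (⟦ F ⟧ ≐ ⟦ G ⟧), never by _≡_.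

Collection : ℕ → Set
Collection n = Subset n → Bool

⟦_⟧ : Collection n → Pred (Subset n) 0ℓ
⟦ F ⟧ A = T (F A)

-- Every subset of Fin n, listed exactly once.
subsets : ∀ n → List (Subset n)
subsets zero    = Vec.[] ∷ []
subsets (suc n) = map (outside Vec.∷_) (subsets n) ++ map (inside Vec.∷_) (subsets n)

size : Collection n → ℕ
size {n} F = length (filterᵇ F (subsets n))

Pairwise : Rel (Subset n) 0ℓ → Pred (Collection n) 0ℓ
Pairwise R F = ∀ A B → ⟦ F ⟧ A → ⟦ F ⟧ B → R A B

IsMaximalChordSeparated : Pred (Collection n) 0ℓ
IsMaximalChordSeparated {n} C =
  Pairwise ChordSeparated C ×
  (∀ (F : Collection n) → Pairwise ChordSeparated F → ⟦ C ⟧ ⊆ ⟦ F ⟧ → ⟦ F ⟧ ⊆ ⟦ C ⟧)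

-- The size is compared with all strongly separated collections in 2^[n],
-- not only with those contained in C.
record 𝐒* {n : ℕ} (C : Collection n) : Set where
  field
    collection        : Collection n
    contained         : ⟦ collection ⟧ ⊆ ⟦ C ⟧
    stronglySeparated : Pairwise StronglySeparated collection
    maximalSize       : ∀ (F : Collection n) → Pairwise StronglySeparated F →
                        size F ℕ.≤ size collection

  members : Pred (Subset n) 0ℓ
  members = ⟦ collection ⟧

open 𝐒* public using (members)

infix 4 _≈_

_≈_ : {C : Collection n} → Rel (𝐒* C) 0ℓ
S ≈ S′ = members S ≐ members S′

𝓘 : ∀ n → Pred (Subset n) 0ℓ
𝓘 n A = A ≡ ⊥ ⊎ (∃₂ λ (i j : Fin n) → i ≤ j × (∀ x → x ∈ A ⇔ (i ≤ x × x ≤ j)))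

co-𝓘 : ∀ n → Pred (Subset n) 0ℓ
co-𝓘 n A = ∃ λ I → 𝓘 n I × A ≡ ∁ I

infixl 6 _▷_

_▷_ : Subset n → Fin n → Subset n
X ▷ a = X Sub.∪ ⁅ a ⁆

RaisingFlip : {C : Collection n} → Rel (𝐒* C) 0ℓ
RaisingFlip {n} S S′ =
  ∃₂ λ (i j : Fin n) → ∃₂ λ (k : Fin n) (X : Subset n) →
    i < j × j < k × i ∉ X × j ∉ X × k ∉ X ×
    members S X × members S (X ▷ i) × members S (X ▷ j) × members S (X ▷ k) ×
    members S (X ▷ i ▷ j) × members S (X ▷ j ▷ k) × members S (X ▷ i ▷ j ▷ k) ×
    members S′ ≐ ((members S ∖ ｛ X ▷ j ｝) ∪ ｛ X ▷ i ▷ k ｝)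

ImmediatelyPrecedes : {A : Set} (_≈_ _≤_ : Rel A 0ℓ) → Rel A 0ℓ
ImmediatelyPrecedes _≈_ _≤_ x y = x ≺ y × (∀ z → ¬ (x ≺ z × z ≺ y))
  where open NonStrictToStrict _≈_ _≤_ renaming (_<_ to _≺_)

{-# OPTIONS --safe #-}
module Submission where

-- Say that a set has a dip on i < j < k if it contains i and k but not j, and
-- a peak if it contains j but not i and k.  A strongly separated collection
-- cannot have a dip and a peak on the same triple.  If it has maximal size,
-- counting provides a face {X, Xi, Xj, Xij} for every pair, hence a dip or a
-- peak on every triple, and the collection is determined by the set of triples
-- on which it has dips.
--
-- Maximality of C makes every triple span a cube in C, and chord separation
-- orders the faces of C at a given pair linearly.  Consequently the sets of
-- triples that occur are the closed ones: if σ ∈ J, then J contains the triple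
-- formed by a lower face of the cube of σ and any element that this face has
-- already crossed.  Such predecessors have smaller rank when cubes are read as
-- words over {0, *, 1}, so a closed set is reached from the empty one by flips
-- across its cubes in order of rank, each of which preserves the size.  The
-- lattice is that of closed sets under union and intersection, and a covering
-- pair differs by a single triple, that is, by one flip.

open import Defs
open import Level using (0ℓ)
open import Data.Nat.Base using (ℕ)
open import Data.Product.Base using (_×_; Σ-syntax; ∃-syntax)
open import Function.Bundles using (_⇔_)
open import Relation.Binary.Core using (Rel)
open import Relation.Binary.Definitions using (Minimum; Maximum)
open import Relation.Binary.Lattice.Structures using (IsDistributiveLattice)
open import Relation.Unary using (_≐_)

open import Data.Bool.Base using (Bool; true; false; not; _∧_; _∨_; _xor_; T)
open import Data.Bool.Properties using (T-∧; T-∨; T?; not-¬; ∨-zeroʳ; ∨-identityʳ; not-involutive)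
  renaming (_≟_ to _≟ᵇ_)
open import Data.Empty using (⊥; ⊥-elim)
open import Data.Fin.Base using (Fin; zero; suc; toℕ; _<_; _≤_; punchIn; punchOut)
open import Data.Fin.Properties using (<-cmp; <-trans; <-irrefl; <-asym; _≟_; _<?_; any?; all?; toℕ<n;
  toℕ-injective; ≤∧≢⇒<; punchIn-mono-≤; punchIn-injective; punchInᵢ≢i; punchIn-punchOut)
open import Data.Fin.Subset as Sub using (Subset; ∁; ⁅_⁆; _∈_; _∉_; _─_)
open import Data.Fin.Subset.Properties using (_∈?_; anySubset?; p─q⊆p; x∈p∧x∉q⇒x∈p─q; x∈⁅x⁆; x∈⁅y⁆⇒x≡y; ∉⊥)
open import Data.List.Base using (List; []; _∷_; map; filterᵇ; length; allFin)
open import Data.List.Extrema.Nat using (min≤⊤; min≤xs; xs≤max; max<v⁺; v<min⁺)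
import Data.List.Membership.Propositional as List
open import Data.List.Membership.Propositional.Properties
  using (∈-map⁺; ∈-map⁻; ∈-filter⁺; ∈-filter⁻; ∈-allFin)
open import Data.List.Properties using (filter-++; length-++)
import Data.List.Relation.Unary.All as All
import Data.List.Relation.Unary.Any as Any
open import Data.Nat.Base as ℕ using (zero; suc; z≤n; s≤s)
open import Data.Nat.Induction using (<-rec)
import Data.Nat.Properties as ℕ
open import Algebra.Properties.CommutativeSemigroup ℕ.+-commutativeSemigroup using (interchange)
open import Data.Product.Base as Product using (_,_; ∃; proj₁; proj₂)
open import Data.Sum.Base as Sum using (_⊎_; inj₁; inj₂)
open import Data.Unit.Base using (⊤; tt)
open import Data.Vec.Base using (lookup; tabulate; insertAt; _[_]≔_; []; _∷_; here; there)
open import Data.Vec.Properties using (lookup∘update; lookup∘update′; lookup∘tabulate; tabulate∘lookup; tabulate-cong;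
  insertAt-lookup; insertAt-punchIn; []=⇒lookup; lookup⇒[]=; lookup-zipWith; lookup-map; ≡-dec)
open import Function.Base using (_∘_; id)
open import Function.Bundles using (Equivalence; mk⇔)
open import Relation.Binary.Definitions using (tri<; tri≈; tri>)
open import Relation.Binary.PropositionalEquality using (_≡_; _≢_; refl; sym; trans; cong; cong₂; subst; subst₂)
open import Relation.Nullary using (¬_; Dec; yes; no)
open import Relation.Nullary.Decidable
  using (_×-dec_; _⊎-dec_; _→-dec_; ¬?; map′; ⌊_⌋; toWitness; fromWitness)

-- Maximality of `C` is available only in the form that a set alternating with no member is itself a
-- member, so cubes have to be built from single sets, and this is the hard step. For a < b < c, the
-- triples {p, a, c} with p outside [a, c] span wider intervals and come earlier in an induction;
-- their cubes bridge two faces at {a, c} whose bases differ at p. What remains are two faces whose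
-- bases X ⊂ Y differ strictly between a and c, and some y in Y - X is sought such that all corners
-- of the face at X ∪ {y} belong to `C`. A member that blocks y demands that another element be
-- added before y, and a priori such demands could form a cycle. The least element that escapes two
-- of the three kinds of demand is shown to escape the third as well, by a descent along overlapping
-- gaps. The rank replaces a geometric acyclicity argument: it orders the cubes by their words
-- alone, and every dip shown by a vertex of a cube belongs to a cube of smaller rank or to the cube
-- itself.

private
  variable
    n : ℕ

-- Faces and cubes

module _ where
  private
    variable
      A B V X : Subset n
      p q : Fin n

  infix 4 _∋_ _∌_

  record _∋_ (A : Subset n) (p : Fin n) : Set where
    constructor ∋!
    field on : lookup A p ≡ true

  record _∌_ (A : Subset n) (p : Fin n) : Set where
    constructor ∌!
    field off : lookup A p ≡ false

  open _∋_ public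
  open _∌_ public

  ∋? : (A : Subset n) (p : Fin n) → A ∋ p ⊎ A ∌ p
  ∋? A p with lookup A p in e
  ... | true  = inj₁ (∋! e)
  ... | false = inj₂ (∌! e)

  ∋∌-absurd : {P : Set} → A ∋ p → A ∌ p → P
  ∋∌-absurd (∋! a) (∌! b) with trans (sym a) b
  ... | ()

  ∋∌-≢ : A ∋ p → A ∌ q → p ≢ q
  ∋∌-≢ a b refl = ∋∌-absurd a b

  -- One orientation of `Interlace`, with the two differences unfolded into memberships. The other
  -- orientation is `Alternate B A`.
  data Alternate (A B : Subset n) : Set where
    alternate : ∀ {a b c d} → a < b → b < c → c < d →
      A ∋ a → B ∌ a → A ∌ b → B ∋ b → A ∋ c → B ∌ c → A ∌ d → B ∋ d → Alternate A B

  <⇒≢ : {p q : Fin n} → p < q → p ≢ q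
  <⇒≢ p<q refl = <-irrefl refl p<q

  >⇒≢ : {p q : Fin n} → q < p → p ≢ q
  >⇒≢ q<p e = <⇒≢ q<p (sym e)

  <-total : {p q : Fin n} → p ≢ q → p < q ⊎ q < p
  <-total {p = p} {q} p≢q with <-cmp p q
  ... | tri< l _ _ = inj₁ l
  ... | tri≈ _ e _ = ⊥-elim (p≢q e)
  ... | tri> _ _ g = inj₂ g

  -- A face is a rhombus {X, Xi, Xj, Xij} and a cube consists of the eight sets
  -- between X and Xijk; the base X is only relevant off the listed elements.
  Agree₂ : (x y : Fin n) → Subset n → Subset n → Set
  Agree₂ x y V X = ∀ p → p ≢ x → p ≢ y → lookup V p ≡ lookup X p

  Agree₃ : (x y z : Fin n) → Subset n → Subset n → Set
  Agree₃ x y z V X = ∀ p → p ≢ x → p ≢ y → p ≢ z → lookup V p ≡ lookup X p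

  Face : (Subset n → Set) → (x y : Fin n) → Subset n → Set
  Face F x y X = ∀ V → Agree₂ x y V X → F V

  Cube : (Subset n → Set) → (x y z : Fin n) → Subset n → Set
  Cube F x y z X = ∀ V → Agree₃ x y z V X → F V

  set₂ : (x y : Fin n) (b c : Bool) → Subset n → Subset n
  set₂ x y b c X = (X [ x ]≔ b) [ y ]≔ c

  set₂-off : ∀ {x y : Fin n} b c (X : Subset n) → Agree₂ x y (set₂ x y b c X) X
  set₂-off b c X p p≢x p≢y = trans (lookup∘update′ p≢y (X [ _ ]≔ b) c) (lookup∘update′ p≢x X b)

  set₂-fst : ∀ {x y : Fin n} b c (X : Subset n) → x ≢ y → lookup (set₂ x y b c X) x ≡ b
  set₂-fst {x = x} b c X x≢y = trans (lookup∘update′ x≢y (X [ x ]≔ b) c) (lookup∘update x X b)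

  set₂-snd : ∀ {x y : Fin n} b c (X : Subset n) → lookup (set₂ x y b c X) y ≡ c
  set₂-snd {x = x} {y} b c X = lookup∘update y (X [ x ]≔ b) c

  subset-ext : {A B : Subset n} → (∀ p → lookup A p ≡ lookup B p) → A ≡ B
  subset-ext {A = A} {B} h = trans (sym (tabulate∘lookup A)) (trans (tabulate-cong h) (tabulate∘lookup B))

  module _ {D : Fin n → Set} (D? : ∀ p → Dec (D p)) where

    greatest-below : ∀ (q s : Fin n) → s < q → D s →
      ∃ λ r → r < q × D r × (∀ x → r < x → x < q → ¬ D x) × (s < r ⊎ s ≡ r)
    greatest-below q s = search n s (ℕ.m≤n+m n (toℕ s))
      where
      search : ∀ k s → n ℕ.≤ toℕ s ℕ.+ k → s < q → D s →
        ∃ λ r → r < q × D r × (∀ x → r < x → x < q → ¬ D x) × (s < r ⊎ s ≡ r)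
      search zero s bound s<q Ds =
        ⊥-elim (ℕ.<⇒≱ (toℕ<n s) (subst (n ℕ.≤_) (ℕ.+-identityʳ (toℕ s)) bound))
      search (suc k) s bound s<q Ds with any? (λ x → (s <? x) ×-dec ((x <? q) ×-dec D? x))
      ... | no none = s , s<q , Ds , (λ x s<x x<q Dx → none (x , s<x , x<q , Dx)) , inj₂ refl
      ... | yes (x , s<x , x<q , Dx)
        with search k x (ℕ.≤-trans bound (ℕ.≤-trans (ℕ.≤-reflexive (ℕ.+-suc (toℕ s) k)) (ℕ.+-monoˡ-≤ k s<x))) x<q Dx
      ... | r , r<q , Dr , gap , inj₁ x<r = r , r<q , Dr , gap , inj₁ (<-trans s<x x<r)
      ... | r , r<q , Dr , gap , inj₂ refl = r , r<q , Dr , gap , inj₁ s<x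

    least-above : ∀ (q s : Fin n) → q < s → D s → ∃ λ r → q < r × D r × (∀ x → q < x → x < r → ¬ D x)
    least-above q s = search (suc (toℕ s)) s ℕ.≤-refl
      where
      search : ∀ k (s : Fin n) → toℕ s ℕ.< k → q < s → D s → ∃ λ r → q < r × D r × (∀ x → q < x → x < r → ¬ D x)
      search (suc k) s (s≤s bound) q<s Ds with any? (λ x → (q <? x) ×-dec ((x <? s) ×-dec D? x))
      ... | no none = s , q<s , Ds , λ x q<x x<s Dx → none (x , q<x , x<s , Dx)
      ... | yes (x , q<x , x<s , Dx) = search k x (ℕ.≤-trans x<s bound) q<x Dx

    greatest : ∀ s → D s → ∃ λ r → D r × (∀ x → r < x → ¬ D x)
    greatest s = search n s (ℕ.m≤n+m n (toℕ s))
      where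
      search : ∀ k s → n ℕ.≤ toℕ s ℕ.+ k → D s → ∃ λ r → D r × (∀ x → r < x → ¬ D x)
      search zero s bound Ds =
        ⊥-elim (ℕ.<⇒≱ (toℕ<n s) (subst (n ℕ.≤_) (ℕ.+-identityʳ (toℕ s)) bound))
      search (suc k) s bound Ds with any? (λ x → (s <? x) ×-dec D? x)
      ... | no none = s , Ds , λ x s<x Dx → none (x , s<x , Dx)
      ... | yes (x , s<x , Dx) =
        search k x (ℕ.≤-trans bound (ℕ.≤-trans (ℕ.≤-reflexive (ℕ.+-suc (toℕ s) k)) (ℕ.+-monoˡ-≤ k s<x))) Dx

  -- Minimal elements exist as far as refutations are concerned, without any
  -- decidability of the predicate.
  minimal-refutes : {D : Fin n → Set} → (∀ p → D p → (∀ q → q < p → ¬ D q) → ⊥) → ∀ p → ¬ D p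
  minimal-refutes {D = D} step p = go (suc (toℕ p)) p ℕ.≤-refl
    where
    go : ∀ k p → toℕ p ℕ.< k → ¬ D p
    go (suc k) p (s≤s bound) Dp = step p Dp λ q q<p → go k q (ℕ.≤-trans q<p bound)

  module _ {F : Subset n → Set} (F? : ∀ A → Dec (F A)) where

    Face? : ∀ {x y : Fin n} → x ≢ y → ∀ X → Dec (Face F x y X)
    Face? {x} {y} x≢y X = map′ to (λ f → corner f false false , corner f false true , corner f true false , corner f true true)
      (F? (set₂ x y false false X) ×-dec F? (set₂ x y false true X) ×-dec
       F? (set₂ x y true false X) ×-dec F? (set₂ x y true true X))
      where
      corner : Face F x y X → ∀ b c → F (set₂ x y b c X)
      corner f b c = f _ (set₂-off b c X)
      same : ∀ V → Agree₂ x y V X → ∀ {b c} → lookup V x ≡ b → lookup V y ≡ c → F (set₂ x y b c X) → F V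
      same V agree {b} {c} Vx Vy h = subst F (subset-ext (λ p → sym (eq p))) h
        where
        eq : ∀ p → lookup V p ≡ lookup (set₂ x y b c X) p
        eq p with p ≟ x
        ... | yes refl = trans Vx (sym (set₂-fst b c X x≢y))
        ... | no p≢x with p ≟ y
        ... | yes refl = trans Vy (sym (set₂-snd {x = x} b c X))
        ... | no p≢y = trans (agree p p≢x p≢y) (sym (set₂-off b c X p p≢x p≢y))
      to : _ → Face F x y X
      to (h₀₀ , h₀₁ , h₁₀ , h₁₁) V agree with lookup V x in Vx | lookup V y in Vy
      ... | false | false = same V agree Vx Vy h₀₀
      ... | false | true  = same V agree Vx Vy h₀₁
      ... | true  | false = same V agree Vx Vy h₁₀
      ... | true  | true  = same V agree Vx Vy h₁₁

-- Exchange between two faces at the same pair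

module Exchange {n : ℕ} (C : Subset n → Set)
  (sep : ∀ {A B} → C A → C B → ¬ Alternate A B)
  (i j : Fin n) (i<j : i < j) (X Y : Subset n)
  (X∌i : X ∌ i) (X∌j : X ∌ j) (Y∌i : Y ∌ i) (Y∌j : Y ∌ j)
  (X⊆Y : ∀ p → X ∋ p → Y ∋ p)
  (Δ-between : ∀ p → Y ∋ p → X ∌ p → i < p × p < j)
  (faceX : Face C i j X) (faceY : Face C i j Y)
  (maximal : ∀ V → (∀ A → C A → ¬ Alternate A V × ¬ Alternate V A) → C V)
  where

  private
    variable
      A α β γ : Subset n
      a b c d p q y : Fin n

  Δ : Fin n → Set
  Δ p = Y ∋ p × X ∌ p

  -- The signs of A relative to the face with base U: the corners in {i, j}
  -- can be chosen so that they always contribute a sign.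
  Plus Minus : Subset n → Subset n → Fin n → Set
  Plus  U A p = A ∋ p × U ∌ p
  Minus U A p = A ∌ p × (U ∋ p ⊎ p ≡ i ⊎ p ≡ j)

  -- Relative to `X` the pluses are `P` and `Q` and the minuses are `M`; relative to `Y` the pluses
  -- are `P` and the minuses are `M` and `Z`. Moving the base from `X` towards `Y` thus erases
  -- pluses `Q` and creates minuses `Z`.
  P Q Z M : Subset n → Fin n → Set
  P = Plus Y
  Q A p = A ∋ p × Δ p
  Z A p = A ∌ p × Δ p
  M = Minus X

  module _ {U : Subset n} where
    opposite : Subset n → Subset n
    opposite A = set₂ i j (not (lookup A i)) (not (lookup A j)) U

    opposite-Plus : U ∌ i → U ∌ j → Plus U A p → opposite A ∌ p
    opposite-Plus {A} {p} ui uj (h , u) with p ≟ i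
    ... | yes refl = ∌! (trans (set₂-fst _ _ U (<⇒≢ i<j)) (cong not (on h)))
    ... | no p≢i with p ≟ j
    ... | yes refl = ∌! (trans (set₂-snd {x = i} _ _ U) (cong not (on h)))
    ... | no p≢j = ∌! (trans (set₂-off _ _ U p p≢i p≢j) (off u))

    opposite-Minus : Minus U A p → opposite A ∋ p
    opposite-Minus {A} {p} (h , u) with p ≟ i
    ... | yes refl = ∋! (trans (set₂-fst _ _ U (<⇒≢ i<j)) (cong not (off h)))
    ... | no p≢i with p ≟ j
    ... | yes refl = ∋! (trans (set₂-snd {x = i} _ _ U) (cong not (off h)))
    ... | no p≢j with u
    ... | inj₁ u = ∋! (trans (set₂-off _ _ U p p≢i p≢j) (on u))
    ... | inj₂ (inj₁ e) = ⊥-elim (p≢i e)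
    ... | inj₂ (inj₂ e) = ⊥-elim (p≢j e)

  no-pmpm : {U : Subset n} → U ∌ i → U ∌ j → Face C i j U → C A → a < b → b < c → c < d →
    Plus U A a → Minus U A b → Plus U A c → Minus U A d → ⊥
  no-pmpm {A = A} {U = U} ui uj f cA ab bc cd pa mb pc md = sep cA (f (opposite A) (set₂-off (not (lookup A i)) (not (lookup A j)) U))
    (alternate ab bc cd (proj₁ pa) (opposite-Plus ui uj pa) (proj₁ mb) (opposite-Minus mb)
                        (proj₁ pc) (opposite-Plus ui uj pc) (proj₁ md) (opposite-Minus md))

  no-mpmp : {U : Subset n} → U ∌ i → U ∌ j → Face C i j U → C A → a < b → b < c → c < d →
    Minus U A a → Plus U A b → Minus U A c → Plus U A d → ⊥
  no-mpmp {A = A} {U = U} ui uj f cA ab bc cd ma pb mc pd = sep (f (opposite A) (set₂-off (not (lookup A i)) (not (lookup A j)) U)) cA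
    (alternate ab bc cd (opposite-Minus ma) (proj₁ ma) (opposite-Plus ui uj pb) (proj₁ pb)
                        (opposite-Minus mc) (proj₁ mc) (opposite-Plus ui uj pd) (proj₁ pd))

  X⁺⁻⁺⁻ : C A → a < b → b < c → c < d → Plus X A a → M A b → Plus X A c → M A d → ⊥
  X⁺⁻⁺⁻ = no-pmpm X∌i X∌j faceX
  X⁻⁺⁻⁺ : C A → a < b → b < c → c < d → M A a → Plus X A b → M A c → Plus X A d → ⊥
  X⁻⁺⁻⁺ = no-mpmp X∌i X∌j faceX
  Y⁺⁻⁺⁻ : C A → a < b → b < c → c < d → P A a → Minus Y A b → P A c → Minus Y A d → ⊥
  Y⁺⁻⁺⁻ = no-pmpm Y∌i Y∌j faceY
  Y⁻⁺⁻⁺ : C A → a < b → b < c → c < d → Minus Y A a → P A b → Minus Y A c → P A d → ⊥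
  Y⁻⁺⁻⁺ = no-mpmp Y∌i Y∌j faceY

  Y∌⇒X∌ : Y ∌ p → X ∌ p
  Y∌⇒X∌ {p} h with ∋? X p
  ... | inj₁ x = ∋∌-absurd (X⊆Y p x) h
  ... | inj₂ x = x

  P⇒Plus : P A p → Plus X A p
  P⇒Plus (h , u) = h , Y∌⇒X∌ u
  Q⇒Plus : Q A p → Plus X A p
  Q⇒Plus (h , u) = h , proj₂ u
  M⇒Minus : M A p → Minus Y A p
  M⇒Minus (h , inj₁ u) = h , inj₁ (X⊆Y _ u)
  M⇒Minus (h , inj₂ u) = h , inj₂ u
  Z⇒Minus : Z A p → Minus Y A p
  Z⇒Minus (h , u) = h , inj₁ (proj₁ u)

  i<Δ : Δ p → i < p
  i<Δ (y , x) = proj₁ (Δ-between _ y x)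
  Δ<j : Δ p → p < j
  Δ<j (y , x) = proj₂ (Δ-between _ y x)

  P-or-Q : Plus X A p → P A p ⊎ Q A p
  P-or-Q {p = p} (h , x) with ∋? Y p
  ... | inj₁ y = inj₂ (h , y , x)
  ... | inj₂ y = inj₁ (h , y)

  corner-i : (A : Subset n) → P A i ⊎ M A i
  corner-i A with ∋? A i
  ... | inj₁ h = inj₁ (h , Y∌i)
  ... | inj₂ h = inj₂ (h , inj₂ (inj₁ refl))

  corner-j : (A : Subset n) → P A j ⊎ M A j
  corner-j A with ∋? A j
  ... | inj₁ h = inj₁ (h , Y∌j)
  ... | inj₂ h = inj₂ (h , inj₂ (inj₂ refl))

  -- If y ∈ Δ cannot be added to the face at X, then some A ∈ C blocks it in one
  -- of three ways: A forces y to be added after a larger element (ForcedRight),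
  -- after a smaller one (ForcedLeft), or A lies below Y with y in a gap (Gapped).
  data ForcedRight (A : Subset n) (y : Fin n) : Set where
    forcedʳ : ∀ {u s t} → Z A y → u < y → y < s → s < t → P A u → Q A s → M A t → ForcedRight A y

  data ForcedLeft (A : Subset n) (y : Fin n) : Set where
    forcedˡ : ∀ {t s u} → Z A y → t < s → s < y → y < u → M A t → Q A s → P A u → ForcedLeft A y

  Flat : Subset n → Set
  Flat A = ∀ p → A ∋ p → Y ∋ p

  data Gapped (A : Subset n) (y : Fin n) : Set where
    gapped : ∀ {s t} → Z A y → s < y → y < t → Q A s → Q A t → Flat A → Gapped A y

  Obstructs : Subset n → Fin n → Set
  Obstructs A y = ForcedRight A y ⊎ ForcedLeft A y ⊎ Gapped A y

  P? : (A : Subset n) (p : Fin n) → Dec (P A p)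
  P? A p = map′ (λ (a , b) → ∋! a , ∌! b) (λ (a , b) → on a , off b)
    ((lookup A p ≟ᵇ true) ×-dec (lookup Y p ≟ᵇ false))

  flat-or : (A : Subset n) → ∃ (P A) ⊎ Flat A
  flat-or A with any? (P? A)
  ... | yes h = inj₁ h
  ... | no h  = inj₂ λ p Ap → flat p Ap (∋? Y p)
    where
    flat : ∀ p → A ∋ p → Y ∋ p ⊎ Y ∌ p → Y ∋ p
    flat p Ap (inj₁ y) = y
    flat p Ap (inj₂ y) = ⊥-elim (h (p , Ap , y))

  -- The kind of obstruction depends on which pluses are in `P`. Two of them would contradict the
  -- face at `Y`. Where a plus or minus is missing, the corners `i` and `j`, which are never
  -- neutral, supply it; a gap remains only if `A` has nothing outside `Y`.
  obstructs-inside : C A → a < y → y < b → b < c → Plus X A a → Z A y → Plus X A b → M A c →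
    Obstructs A y
  obstructs-inside {A = A} {y = y} cA ay yb bc pa zy pb mc with P-or-Q pa | P-or-Q pb
  ... | inj₁ u | inj₁ s = ⊥-elim (Y⁺⁻⁺⁻ cA ay yb bc u (Z⇒Minus zy) s (M⇒Minus mc))
  ... | inj₁ u | inj₂ s = inj₁ (forcedʳ zy ay yb bc u s mc)
  ... | inj₂ s | inj₁ u with corner-i A
  ... | inj₁ v = ⊥-elim (Y⁺⁻⁺⁻ cA (i<Δ (proj₂ zy)) yb bc v (Z⇒Minus zy) u (M⇒Minus mc))
  ... | inj₂ v = inj₂ (inj₁ (forcedˡ zy (i<Δ (proj₂ s)) ay yb v s u))
  obstructs-inside {A = A} {y = y} cA ay yb bc pa zy pb mc | inj₂ s | inj₂ s′
    with corner-i A | corner-j A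
  ... | inj₁ u | _ = inj₁ (forcedʳ zy (i<Δ (proj₂ zy)) yb bc u s′ mc)
  ... | inj₂ t | inj₁ u = inj₂ (inj₁ (forcedˡ zy (i<Δ (proj₂ s)) ay (Δ<j (proj₂ zy)) t s u))
  ... | inj₂ t | inj₂ t′ with flat-or A
  ... | inj₂ f = inj₂ (inj₂ (gapped zy ay yb s s′ f))
  ... | inj₁ (u , pu) with <-cmp u y
  ... | tri< l _ _ = inj₁ (forcedʳ zy l yb (Δ<j (proj₂ s′)) pu s′ t′)
  ... | tri≈ _ refl _ = ∋∌-absurd (proj₁ pu) (proj₁ zy)
  ... | tri> _ _ g = inj₂ (inj₁ (forcedˡ zy (i<Δ (proj₂ s)) ay g t s pu))

  obstructs-last : C A → a < b → b < c → c < y → Plus X A a → M A b → Plus X A c → Z A y →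
    Obstructs A y
  obstructs-last {A = A} cA ab bc cy pa mb pc zy with corner-j A
  ... | inj₂ t = ⊥-elim (X⁺⁻⁺⁻ cA ab bc (<-trans cy (Δ<j (proj₂ zy))) pa mb pc t)
  ... | inj₁ u with P-or-Q pc
  ... | inj₁ v = ⊥-elim (Y⁻⁺⁻⁺ cA bc cy (Δ<j (proj₂ zy)) (M⇒Minus mb) v (Z⇒Minus zy) u)
  ... | inj₂ s = inj₂ (inj₁ (forcedˡ zy bc cy (Δ<j (proj₂ zy)) mb s u))

  obstructs-first : C A → y < a → a < b → b < c → Z A y → Plus X A a → M A b → Plus X A c →
    Obstructs A y
  obstructs-first {A = A} cA ya ab bc zy pa mb pc with corner-i A
  ... | inj₂ t = ⊥-elim (X⁻⁺⁻⁺ cA (<-trans (i<Δ (proj₂ zy)) ya) ab bc t pa mb pc)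
  ... | inj₁ u with P-or-Q pa
  ... | inj₁ v = ⊥-elim (Y⁺⁻⁺⁻ cA (i<Δ (proj₂ zy)) ya ab u (Z⇒Minus zy) v (M⇒Minus mb))
  ... | inj₂ s = inj₁ (forcedʳ zy (i<Δ (proj₂ zy)) ya ab u s mb)

  obstructs-inside′ : C A → a < b → b < y → y < c → M A a → Plus X A b → Z A y → Plus X A c →
    Obstructs A y
  obstructs-inside′ {A = A} cA ab by yc ma pb zy pc with P-or-Q pb | P-or-Q pc
  ... | inj₁ u | inj₁ v = ⊥-elim (Y⁻⁺⁻⁺ cA ab by yc (M⇒Minus ma) u (Z⇒Minus zy) v)
  ... | inj₂ s | inj₁ u = inj₂ (inj₁ (forcedˡ zy ab by yc ma s u))
  ... | inj₂ s | inj₂ s′ with corner-j A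
  ... | inj₁ v = inj₂ (inj₁ (forcedˡ zy ab by (Δ<j (proj₂ zy)) ma s v))
  ... | inj₂ v = obstructs-inside cA by yc (Δ<j (proj₂ s′)) pb zy pc v
  obstructs-inside′ {A = A} cA ab by yc ma pb zy pc | inj₁ u | inj₂ s′ with corner-j A
  ... | inj₁ v = ⊥-elim (Y⁻⁺⁻⁺ cA ab by (Δ<j (proj₂ zy)) (M⇒Minus ma) u (Z⇒Minus zy) v)
  ... | inj₂ v = obstructs-inside cA by yc (Δ<j (proj₂ s′)) pb zy pc v

  module _ {y : Fin n} (Δy : Δ y) {V : Subset n} (agree : Agree₂ i j V (X [ y ]≔ true)) where
    private
      i≢y : y ≢ i
      i≢y refl = <-irrefl refl (i<Δ Δy)
      j≢y : y ≢ j
      j≢y refl = <-irrefl refl (Δ<j Δy)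

      V∋y : V ∋ y
      V∋y = ∋! (trans (agree y i≢y j≢y) (lookup∘update y X true))

      V′ : Subset n
      V′ = V [ y ]≔ false

      V′-agree : Agree₂ i j V′ X
      V′-agree p p≢i p≢j with p ≟ y
      ... | yes refl = trans (lookup∘update y V false) (sym (off (proj₂ Δy)))
      ... | no p≢y = trans (lookup∘update′ p≢y V false)
                       (trans (agree p p≢i p≢j) (lookup∘update′ p≢y X true))

      V′∋ : p ≢ y → V ∋ p → V′ ∋ p
      V′∋ p≢y h = ∋! (trans (lookup∘update′ p≢y V false) (on h))

      V′∌ : V ∌ p → V′ ∌ p
      V′∌ {p} h = ∌! (trans (lookup∘update′ (λ e → ∋∌-≢ V∋y h (sym e)) V false) (off h))

      plus : A ∋ p → V ∌ p → Plus X A p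
      plus {p = p} a v with p ≟ i
      ... | yes refl = a , X∌i
      ... | no p≢i with p ≟ j
      ... | yes refl = a , X∌j
      ... | no p≢j = a , ∌! (trans (sym (lookup∘update′ (λ e → ∋∌-≢ V∋y v (sym e)) X true))
                              (trans (sym (agree p p≢i p≢j)) (off v)))

      minus : A ∌ p → V ∋ p → p ≢ y → M A p
      minus {p = p} a v p≢y with p ≟ i
      ... | yes e = a , inj₂ (inj₁ e)
      ... | no p≢i with p ≟ j
      ... | yes e = a , inj₂ (inj₂ e)
      ... | no p≢j = a , inj₁ (∋! (trans (sym (lookup∘update′ p≢y X true))
                              (trans (sym (agree p p≢i p≢j)) (on v))))

    -- Without `y` the set `V` is a corner of the face at `X`, which alternates with no member. So
    -- the alternation uses `y`, and it does so at one of the two places where `V` has an element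
    -- that `A` lacks.
    obstruction : C A → Alternate A V → Obstructs A y
    obstruction cA (alternate {b = b} {d = d} ab bc cd Aa Va Ab Vb Ac Vc Ad Vd) with b ≟ y | d ≟ y
    ... | yes refl | _ = obstructs-inside cA ab bc cd (plus Aa Va) (Ab , Δy) (plus Ac Vc)
                           (minus Ad Vd λ e → <-irrefl (sym e) (<-trans bc cd))
    ... | no b≢y | yes refl = obstructs-last cA ab bc cd (plus Aa Va) (minus Ab Vb b≢y)
                           (plus Ac Vc) (Ad , Δy)
    ... | no b≢y | no d≢y = ⊥-elim (sep cA (faceX V′ V′-agree)
                           (alternate ab bc cd Aa (V′∌ Va) Ab (V′∋ b≢y Vb) Ac (V′∌ Vc) Ad (V′∋ d≢y Vd)))

    obstruction′ : C A → Alternate V A → Obstructs A y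
    obstruction′ cA (alternate {a = a} {c = c} ab bc cd Va Aa Vb Ab Vc Ac Vd Ad) with a ≟ y | c ≟ y
    ... | yes refl | _ = obstructs-first cA ab bc cd (Aa , Δy) (plus Ab Vb)
                           (minus Ac Vc λ e → <-irrefl (sym e) (<-trans ab bc)) (plus Ad Vd)
    ... | no a≢y | yes refl = obstructs-inside′ cA ab bc cd (minus Aa Va a≢y) (plus Ab Vb)
                           (Ac , Δy) (plus Ad Vd)
    ... | no a≢y | no c≢y = ⊥-elim (sep (faceX V′ V′-agree) cA
                           (alternate ab bc cd (V′∋ a≢y Va) Aa (V′∌ Vb) Ab (V′∋ c≢y Vc) Ac (V′∌ Vd) Ad))

  -- Supplies the first point of an alternation of γ with β. If neither `u` nor `t` serves, then β
  -- has `u` and γ lacks `t`. For t < u this gives β the signs - + - + relative to `Y`, and for u <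
  -- t it gives γ the signs + - + - relative to `X`.
  left-plus : ∀ {u t y w s t′} → C γ → C β →
    P γ u → Plus X γ s → M γ t′ → t < s → s < t′ →
    M β t → Minus Y β y → P β w → u < y → y < w →
    ∃ λ q → (q ≡ u ⊎ q ≡ t) × γ ∋ q × β ∌ q
  left-plus {γ = γ} {β} {u} {t} cγ cβ γu γs γt′ t<s s<t′ βt βy βw u<y y<w with ∋? β u
  ... | inj₂ h = u , inj₁ refl , proj₁ γu , h
  ... | inj₁ h with ∋? γ t
  ... | inj₁ k = t , inj₂ refl , k , proj₁ βt
  ... | inj₂ k with <-cmp t u
  ... | tri< t<u _ _ = ⊥-elim (Y⁻⁺⁻⁺ cβ t<u u<y y<w (M⇒Minus βt) (h , proj₂ γu) βy βw)
  ... | tri≈ _ refl _ = ∋∌-absurd h (proj₁ βt)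
  ... | tri> _ _ u<t = ⊥-elim (X⁺⁻⁺⁻ cγ u<t t<s s<t′ (P⇒Plus γu) (k , proj₂ βt) γs γt′)

  -- The left-right reflection of `left-plus` with γ and β exchanged; it supplies the last point of
  -- the alternation.
  right-minus : ∀ {u t y w s t′} → C γ → C β →
    P β u → Plus X β s → M β t′ → t′ < s → s < t →
    M γ t → Minus Y γ y → P γ w → w < y → y < u →
    ∃ λ q → (q ≡ u ⊎ q ≡ t) × γ ∌ q × β ∋ q
  right-minus {γ = γ} {β} {u} {t} cγ cβ βu βs βt′ t′<s s<t γt γy γw w<y y<u with ∋? γ u
  ... | inj₂ h = u , inj₁ refl , h , proj₁ βu
  ... | inj₁ h with ∋? β t
  ... | inj₁ k = t , inj₂ refl , proj₁ γt , k
  ... | inj₂ k with <-cmp t u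
  ... | tri< t<u _ _ = ⊥-elim (X⁻⁺⁻⁺ cβ t′<s s<t t<u βt′ βs (k , proj₂ γt) (P⇒Plus βu))
  ... | tri≈ _ refl _ = ∋∌-absurd h (proj₁ γt)
  ... | tri> _ _ u<t = ⊥-elim (Y⁺⁻⁺⁻ cγ w<y y<u u<t γw γy (h , proj₂ βu) (M⇒Minus γt))

  on-either : {D : Fin n → Set} → q ≡ a ⊎ q ≡ b → D a → D b → D q
  on-either (inj₁ refl) Da Db = Da
  on-either (inj₂ refl) Da Db = Db

  -- Among the elements of Δ that β demands before `y`, `w` is the one nearest to `y`; this is what
  -- `none` records.
  record LeftForcing (β : Subset n) (w y : Fin n) : Set where
    field
      β∈C : C β
      {t u} : Fin n
      t<w : t < w
      y<u : y < u
      w<y : w < y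
      Mt : M β t
      Qw : Q β w
      Zy : Z β y
      Pu : P β u
      none : ∀ {x} → Δ x → w < x → x < y → β ∌ x

  -- If γ contains `y`, or if the element `s′` that γ demands before `w` lies below `y`, then γ and
  -- β alternate, with `w` as the second point and `y` or `s′` as the third. Otherwise `s′` lies
  -- above `y`, and γ makes the same demand of `y`.
  ForcedRight-transfer : ∀ {w} → C γ → LeftForcing β w y → ForcedRight γ w → ¬ ForcedRight γ y → ⊥
  ForcedRight-transfer {γ = γ} {β} {y} {w} cγ L (forcedʳ {u′} {s′} {t′} Zw u′<w w<s′ s′<t′ Pu′ Qs′ Mt′) free
    with left-plus cγ β∈C Pu′ (Q⇒Plus Qs′) Mt′ (<-trans t<w w<s′) s′<t′ Mt (Z⇒Minus Zy) Pu (<-trans u′<w w<y) y<u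
       | right-minus cγ β∈C Pu (Q⇒Plus Qw) Mt t<w (<-trans w<s′ s′<t′) Mt′ (Z⇒Minus Zw) Pu′ u′<w (<-trans w<y y<u)
    where open LeftForcing L
  ... | q₁ , e₁ , γq₁ , βq₁ | q₂ , e₂ , γq₂ , βq₂ = conclude (∋? γ y)
    where
    open LeftForcing L
    q₁<w : q₁ < w
    q₁<w = on-either e₁ u′<w t<w
    finish : ∀ {m} → w < m → m < q₂ → γ ∋ m → β ∌ m → ⊥
    finish w<m m<q₂ γm βm = sep cγ β∈C
      (alternate q₁<w w<m m<q₂ γq₁ βq₁ (proj₁ Zw) (proj₁ Qw) γm βm γq₂ βq₂)
    before-y : s′ < y → ⊥
    before-y s′<y = finish w<s′ (on-either e₂ (<-trans s′<y y<u) s′<t′) (proj₁ Qs′) (none (proj₂ Qs′) w<s′ s′<y)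
    conclude : γ ∋ y ⊎ γ ∌ y → ⊥
    conclude (inj₁ γy) with <-cmp t′ y
    ... | tri< t′<y _ _ = before-y (<-trans s′<t′ t′<y)
    ... | tri≈ _ refl _ = ∋∌-absurd γy (proj₁ Mt′)
    ... | tri> _ _ y<t′ = finish w<y (on-either e₂ y<u y<t′) γy (proj₁ Zy)
    conclude (inj₂ γy) with <-cmp s′ y
    ... | tri< s′<y _ _ = before-y s′<y
    ... | tri≈ _ refl _ = ∋∌-absurd (proj₁ Qs′) γy
    ... | tri> _ _ y<s′ = free (forcedʳ (γy , proj₂ Zy) (<-trans u′<w w<y) y<s′ s′<t′ Pu′ Qs′ Mt′)

  flat∌ : Flat α → Y ∌ p → α ∌ p
  flat∌ {α} {p} f y with ∋? α p
  ... | inj₁ h = ∋∌-absurd (f p h) y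
  ... | inj₂ h = h

  flat-Mi : Flat α → M α i
  flat-Mi f = flat∌ f Y∌i , inj₂ (inj₁ refl)
  flat-Mj : Flat α → M α j
  flat-Mj f = flat∌ f Y∌j , inj₂ (inj₂ refl)

  -- A sequence of overlapping gaps: each left end lies in the previous gap, each right end in the
  -- next one. Chains grow by prepending, so the gap of index `len` is the oldest, the one around
  -- `w`.
  record Chain : Set where
    field
      len : ℕ
      set : ℕ → Subset n
      lo hi : ℕ → Fin n
      set∈C : ∀ {t} → t ℕ.≤ len → C (set t)
      flat : ∀ {t} → t ℕ.≤ len → Flat (set t)
      Q-lo : ∀ {t} → t ℕ.≤ len → Q (set t) (lo t)
      Q-hi : ∀ {t} → t ℕ.≤ len → Q (set t) (hi t)
      lo<hi : ∀ {t} → t ℕ.≤ len → lo t < hi t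
      free : ∀ {t x} → t ℕ.≤ len → Δ x → lo t < x → x < hi t → set t ∌ x
      lo<lo : ∀ {t} → t ℕ.< len → lo t < lo (suc t)
      lo<hi⁺ : ∀ {t} → t ℕ.< len → lo (suc t) < hi t
      hi<hi : ∀ {t} → t ℕ.< len → hi t < hi (suc t)

  module ChainProperties (chain : Chain) where
    open Chain chain

    lo-mono : ∀ {l r} → l ℕ.< r → r ℕ.≤ len → lo l < lo r
    lo-mono {l} {suc r} (s≤s l≤r) r≤ with ℕ.m≤n⇒m<n∨m≡n l≤r
    ... | inj₁ l<r = <-trans (lo-mono l<r (ℕ.<⇒≤ r≤)) (lo<lo r≤)
    ... | inj₂ refl = lo<lo r≤

    hi-mono : ∀ {l r} → l ℕ.< r → r ℕ.≤ len → hi l < hi r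
    hi-mono {l} {suc r} (s≤s l≤r) r≤ with ℕ.m≤n⇒m<n∨m≡n l≤r
    ... | inj₁ l<r = <-trans (hi-mono l<r (ℕ.<⇒≤ r≤)) (hi<hi r≤)
    ... | inj₂ refl = hi<hi r≤

    lo-before : ∀ {l r x} → l ℕ.≤ r → r ℕ.≤ len → lo r < x → lo l < x
    lo-before l≤r r≤ h with ℕ.m≤n⇒m<n∨m≡n l≤r
    ... | inj₁ l<r = <-trans (lo-mono l<r r≤) h
    ... | inj₂ refl = h

    hi-after : ∀ {l r x} → l ℕ.≤ r → r ℕ.≤ len → x < hi l → x < hi r
    hi-after l≤r r≤ h with ℕ.m≤n⇒m<n∨m≡n l≤r
    ... | inj₁ l<r = <-trans h (hi-mono l<r r≤)
    ... | inj₂ refl = h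

    Spans : ℕ → ℕ → Set
    Spans l r = ∃ λ m → l ℕ.≤ m × m ℕ.≤ r × set m ∋ lo l × set m ∋ hi r

    -- Chord separation fuses overlapping gaps: one member meets both ends of a whole run. A member
    -- `m` that spans `l` to `r` but lacks the next right end would, by `inherits`, have to contain
    -- `lo (suc m)`, which lies in its own gap, unless another member spans the longer run.
    spans : ∀ d l r → l ℕ.≤ r → r ℕ.≤ len → r ℕ.≤ l ℕ.+ d → Spans l r
    spans d l r l≤r r≤ bound with ℕ.m≤n⇒m<n∨m≡n l≤r
    ... | inj₂ refl = l , ℕ.≤-refl , ℕ.≤-refl , proj₁ (Q-lo r≤) , proj₁ (Q-hi r≤)
    spans zero l r l≤r r≤ bound | inj₁ l<r =
      ⊥-elim (ℕ.<⇒≱ l<r (subst (r ℕ.≤_) (ℕ.+-identityʳ l) bound))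
    spans (suc d) l (suc r) l≤r r≤ bound | inj₁ (s≤s l≤r′)
      with spans d l r l≤r′ (ℕ.<⇒≤ r≤) (ℕ.≤-pred (subst (suc r ℕ.≤_) (ℕ.+-suc l d) bound))
    ... | m , l≤m , m≤r , m∋l , m∋r with ∋? (set m) (hi (suc r))
    ... | inj₁ h = m , l≤m , ℕ.m≤n⇒m≤1+n m≤r , m∋l , h
    ... | inj₂ m∌hi with inherits len (suc m) ℕ.≤-refl (s≤s m≤r) (ℕ.≤-trans r≤ (ℕ.m≤n+m len (suc m)))
      where
      -- If `set m` lacks `lo j`, a member ρ spanning `j` to `suc r` either contains `lo l` and is
      -- the one wanted, or alternates with `set m` at `lo l`, `lo j`, a third point and
      -- `hi (suc r)`. The third point is `hi r` if ρ is the last gap, and else `lo (suc ρ)`, which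
      -- the recursion at `suc ρ` puts into `set m`.
      inherits : ∀ e j → m ℕ.< j → j ℕ.≤ suc r → suc r ℕ.≤ j ℕ.+ e → set m ∋ lo j ⊎ Spans l (suc r)
      inherits e j m<j j≤ bound′ with ∋? (set m) (lo j)
      ... | inj₁ h = inj₁ h
      ... | inj₂ m∌j
        with spans d j (suc r) j≤ r≤
               (ℕ.≤-trans bound (ℕ.≤-trans (ℕ.≤-reflexive (ℕ.+-suc l d)) (ℕ.+-monoˡ-≤ d (ℕ.≤-trans (s≤s l≤m) m<j))))
      ... | ρ , j≤ρ , ρ≤ , ρ∋j , ρ∋hi with ∋? (set ρ) (lo l)
      ... | inj₁ h = inj₂ (ρ , ℕ.≤-trans (ℕ.<⇒≤ (ℕ.≤-trans (s≤s l≤m) m<j)) j≤ρ , ρ≤ , h , ρ∋hi)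
      ... | inj₂ ρ∌l with ℕ.m≤n⇒m<n∨m≡n ρ≤
      ... | inj₂ refl = ⊥-elim (sep (set∈C (ℕ.≤-trans m≤r (ℕ.<⇒≤ r≤))) (set∈C r≤)
                (alternate (lo-mono (ℕ.≤-trans (s≤s l≤m) m<j) (ℕ.≤-trans j≤ r≤))
                  (lo-before j≤ r≤ (lo<hi⁺ r≤)) (hi<hi r≤)
                  m∋l ρ∌l m∌j ρ∋j m∋r (free r≤ (proj₂ (Q-hi (ℕ.<⇒≤ r≤))) (lo<hi⁺ r≤) (hi<hi r≤)) m∌hi ρ∋hi))
      inherits zero j m<j j≤ bound′ | inj₂ m∌j | ρ , j≤ρ , ρ≤ , ρ∋j , ρ∋hi | inj₂ ρ∌l | inj₁ ρ<r =
        ⊥-elim (ℕ.<⇒≱ ρ<r (ℕ.≤-trans (subst (suc r ℕ.≤_) (ℕ.+-identityʳ j) bound′) j≤ρ))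
      inherits (suc e) j m<j j≤ bound′ | inj₂ m∌j | ρ , j≤ρ , ρ≤ , ρ∋j , ρ∋hi | inj₂ ρ∌l | inj₁ ρ<r
        with inherits e (suc ρ) (ℕ.m≤n⇒m≤1+n (ℕ.≤-trans m<j j≤ρ)) ρ<r
               (ℕ.≤-trans bound′ (ℕ.≤-trans (ℕ.≤-reflexive (ℕ.+-suc j e)) (ℕ.+-monoˡ-≤ e (s≤s j≤ρ))))
      ... | inj₂ done = inj₂ done
      ... | inj₁ m∋ρ⁺ = ⊥-elim (sep (set∈C (ℕ.≤-trans m≤r (ℕ.<⇒≤ r≤))) (set∈C ρ≤len)
                (alternate (lo-mono (ℕ.≤-trans (s≤s l≤m) m<j) (ℕ.≤-trans j≤ r≤))
                  (lo-before j≤ρ ρ≤len (lo<lo ρ<len)) (hi-after ρ≤ r≤ (lo<hi⁺ ρ<len))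
                  m∋l ρ∌l m∌j ρ∋j m∋ρ⁺ (free ρ≤len (proj₂ (Q-lo ρ<len)) (lo<lo ρ<len) (lo<hi⁺ ρ<len)) m∌hi ρ∋hi))
        where
        ρ<len : ρ ℕ.< len
        ρ<len = ℕ.≤-trans ρ<r r≤
        ρ≤len : ρ ℕ.≤ len
        ρ≤len = ℕ.<⇒≤ ρ<len
    ... | inj₂ done = done
    ... | inj₁ m∋m⁺ = ∋∌-absurd m∋m⁺ (free (ℕ.<⇒≤ m<len) (proj₂ (Q-lo m<len)) (lo<lo m<len) (lo<hi⁺ m<len))
      where
      m<len : m ℕ.< len
      m<len = ℕ.≤-trans (s≤s m≤r) r≤

  -- At `u`, `a`, `g` three points of an alternation are present, so γ cannot lack `h`. If `t` were
  -- below `h`, it would be the fourth point in case α contains it, and otherwise α would have the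
  -- signs - + - + relative to `X` at `i`, `a`, `t`, `h`.
  propagate-right : ∀ {u t a h g} → C γ → C α → Flat α → P γ u → M γ t → u < a → a < g → g < h → g < t →
    γ ∌ a → Q α a → Q α h → γ ∋ g → α ∌ g → γ ∋ h × h < t
  propagate-right {γ = γ} {α} {t = t} {a} {h} {g} cγ cα f (γu , Yu) Mt u<a a<g g<h g<t γa αa αh γg αg = γh , h<t
    where
    no-alternation : ∀ {z} → g < z → γ ∌ z → α ∋ z → ⊥
    no-alternation g<z γz αz =
      sep cγ cα (alternate u<a a<g g<z γu (flat∌ f Yu) γa (proj₁ αa) γg αg γz αz)
    γh : γ ∋ h
    γh with ∋? γ h
    ... | inj₁ x = x
    ... | inj₂ x = ⊥-elim (no-alternation g<h x (proj₁ αh))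
    h<t : h < t
    h<t with <-cmp h t
    ... | tri< l _ _ = l
    ... | tri≈ _ refl _ = ∋∌-absurd γh (proj₁ Mt)
    ... | tri> _ _ t<h with ∋? α t
    ... | inj₁ αt = ⊥-elim (no-alternation g<t (proj₁ Mt) αt)
    ... | inj₂ αt = ⊥-elim (X⁻⁺⁻⁺ cα (i<Δ (proj₂ αa)) (<-trans a<g g<t) t<h (flat-Mi f) (Q⇒Plus αa)
                              (αt , proj₂ Mt) (Q⇒Plus αh))

  propagate-left : ∀ {u t h b g} → C β → C α → Flat α → P β u → M β t → h < g → g < b → b < u → t < g →
    β ∌ b → Q α h → Q α b → β ∋ g → α ∌ g → β ∋ h × t < h
  propagate-left {β = β} {α} {t = t} {h} {b} {g} cβ cα f (βu , Yu) Mt h<g g<b b<u t<g βb αh αb βg αg = βh , t<h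
    where
    no-alternation : ∀ {z} → z < g → β ∌ z → α ∋ z → ⊥
    no-alternation z<g βz αz =
      sep cα cβ (alternate z<g g<b b<u αz βz αg βg (proj₁ αb) βb (flat∌ f Yu) βu)
    βh : β ∋ h
    βh with ∋? β h
    ... | inj₁ x = x
    ... | inj₂ x = ⊥-elim (no-alternation h<g x (proj₁ αh))
    t<h : t < h
    t<h with <-cmp t h
    ... | tri< l _ _ = l
    ... | tri≈ _ refl _ = ∋∌-absurd βh (proj₁ Mt)
    ... | tri> _ _ h<t with ∋? α t
    ... | inj₁ αt = ⊥-elim (no-alternation t<g (proj₁ Mt) αt)
    ... | inj₂ αt = ⊥-elim (X⁺⁻⁺⁻ cα h<t (<-trans t<g g<b) (Δ<j (proj₂ αb)) (Q⇒Plus αh)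
                              (αt , proj₂ Mt) (Q⇒Plus αb) (flat-Mj f))

  module _ {w y : Fin n} {β : Subset n} (forcing : LeftForcing β w y)
           (chain : Chain) where
    open LeftForcing forcing
    open Chain chain
    open ChainProperties chain

    module _ (w-gap : lo len < w × w < hi len) (hi≤y : β ∌ hi len) (hi<u : hi len < u)
             {γ : Subset n} (cγ : C γ)
             (free-lo : ∀ {t} → t ℕ.< len → ¬ ForcedRight γ (lo (suc t))) (free-w : ¬ ForcedRight γ w) where

      -- A set γ that forces `lo 0` right must contain every right end of the chain. The member
      -- spanning gaps 0 to `t` plays α in `propagate-right`, and `g` is an element of γ inside that
      -- member's own gap; only if `s` is `hi 0` is there nothing to propagate.
      reach-right : ∀ {u′ s t′} → Z γ (lo 0) → u′ < lo 0 → lo 0 < s → s < t′ → P γ u′ → Q γ s → M γ t′ →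
        ∀ t → t ℕ.≤ len → γ ∋ hi t × hi t < t′
      reach-right {u′} {s} {t′} Zlo u′<lo lo<s s<t′ Pu′ Qs Mt′ = <-rec _ step
        where
        apply : ∀ {m g t} → m ℕ.≤ len → t ℕ.≤ len → set m ∋ lo 0 → set m ∋ hi t → lo 0 < g → g < hi t → g < t′ →
          γ ∋ g → set m ∌ g → γ ∋ hi t × hi t < t′
        apply m≤ t≤ mlo mhi lo<g g<hi g<t′ γg mg = propagate-right cγ (set∈C m≤) (flat m≤) Pu′ Mt′
          u′<lo lo<g g<hi g<t′ (proj₁ Zlo) (mlo , proj₂ (Q-lo ℕ.z≤n)) (mhi , proj₂ (Q-hi t≤)) γg mg

        -- Each gap holds an element already known not to be forced right: the left end of the next
        -- gap, or `w` in the last one. By `captured`, γ must contain it as soon as γ has a suitable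
        -- element of Δ further right.
        middle : ∀ {m} → m ℕ.≤ len → ∃ λ κ → Δ κ × lo m < κ × κ < hi m × ¬ ForcedRight γ κ
        middle m≤ with ℕ.m≤n⇒m<n∨m≡n m≤
        ... | inj₁ m< = _ , proj₂ (Q-lo m<) , lo<lo m< , lo<hi⁺ m< , free-lo m<
        ... | inj₂ refl = w , proj₂ Qw , proj₁ w-gap , proj₂ w-gap , free-w

        captured : ∀ {κ r} → Δ κ → ¬ ForcedRight γ κ → lo 0 < κ → κ < r → Q γ r → r < t′ → γ ∋ κ
        captured {κ} Δκ nf lo<κ κ<r Qr r<t′ with ∋? γ κ
        ... | inj₁ h = h
        ... | inj₂ h = ⊥-elim (nf (forcedʳ (h , Δκ) (<-trans u′<lo lo<κ) κ<r r<t′ Pu′ Qr Mt′))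

        step : ∀ t → (∀ {m} → m ℕ.< t → m ℕ.≤ len → γ ∋ hi m × hi m < t′) → t ℕ.≤ len → γ ∋ hi t × hi t < t′
        step t ih t≤ with spans len 0 t ℕ.z≤n t≤ t≤
        ... | m , _ , m≤t , mlo , mhi with ℕ.m≤n⇒m<n∨m≡n m≤t
        ... | inj₁ m<t with middle (ℕ.≤-trans m≤t t≤) | ih m<t (ℕ.≤-trans m≤t t≤)
        ... | κ , Δκ , lo<κ , κ<hi , nf | γhi , hi<t′ =
          apply m≤len t≤ mlo mhi lo₀<κ (<-trans κ<hi (hi-mono m<t t≤)) (<-trans κ<hi hi<t′)
            (captured Δκ nf lo₀<κ κ<hi (γhi , proj₂ (Q-hi m≤len)) hi<t′) (free m≤len Δκ lo<κ κ<hi)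
          where
          m≤len : m ℕ.≤ len
          m≤len = ℕ.≤-trans m≤t t≤
          lo₀<κ : lo 0 < κ
          lo₀<κ = lo-before ℕ.z≤n m≤len lo<κ
        step (suc t) ih t≤ | m , _ , m≤t , mlo , mhi | inj₂ refl with ih ℕ.≤-refl (ℕ.<⇒≤ t≤)
        ... | γhi , hi<t′ = apply t≤ t≤ mlo mhi (lo-before ℕ.z≤n (ℕ.<⇒≤ t≤) (lo<hi (ℕ.<⇒≤ t≤)))
          (hi<hi t≤) hi<t′ γhi (free t≤ (proj₂ (Q-hi (ℕ.<⇒≤ t≤))) (lo<hi⁺ t≤) (hi<hi t≤))
        step zero ih t≤ | m , _ , m≤t , mlo , mhi | inj₂ refl with <-cmp s (hi 0)
        ... | tri< s<hi _ _ = apply t≤ t≤ mlo mhi lo<s s<hi s<t′ (proj₁ Qs) (free t≤ (proj₂ Qs) lo<s s<hi)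
        ... | tri≈ _ refl _ = proj₁ Qs , s<t′
        ... | tri> _ _ hi<s with middle t≤
        ... | κ , Δκ , lo<κ , κ<hi , nf =
          apply t≤ t≤ mlo mhi lo<κ κ<hi (<-trans κ<hi (<-trans hi<s s<t′))
            (captured Δκ nf lo<κ (<-trans κ<hi hi<s) Qs s<t′) (free t≤ Δκ lo<κ κ<hi)

      -- The counterpart for β, which contains `w` and lacks `hi len`: membership spreads from `w`
      -- in the last gap to the left ends, one after the other.
      reach-left : ∀ d r → r ℕ.≤ len → len ℕ.≤ r ℕ.+ d → β ∋ lo r × t < lo r
      reach-left d r r≤ bound with spans len r len r≤ ℕ.≤-refl (ℕ.m≤n+m len r)
      ... | m , r≤m , m≤ , mlo , mhi = go d bound (ℕ.m≤n⇒m<n∨m≡n m≤)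
        where
        apply : ∀ {x} → lo m < x → x < hi m → Δ x → t < x → β ∋ x → β ∋ lo r × t < lo r
        apply lo<g g<hi Δg t<g βg = propagate-left β∈C (set∈C m≤) (flat m≤) Pu Mt
          (lo-before r≤m m≤ lo<g) (hi-after m≤ ℕ.≤-refl g<hi) hi<u t<g hi≤y
          (mlo , proj₂ (Q-lo r≤)) (mhi , proj₂ (Q-hi ℕ.≤-refl)) βg (free m≤ Δg lo<g g<hi)
        go : ∀ d → len ℕ.≤ r ℕ.+ d → m ℕ.< len ⊎ m ≡ len → β ∋ lo r × t < lo r
        go d bound (inj₂ refl) = apply (proj₁ w-gap) (proj₂ w-gap) (proj₂ Qw) t<w (proj₁ Qw)
        go zero bound (inj₁ m<) = ⊥-elim (ℕ.<⇒≱ m< (ℕ.≤-trans (subst (len ℕ.≤_) (ℕ.+-identityʳ r) bound) r≤m))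
        go (suc d) bound (inj₁ m<) with reach-left d (suc m) m<
                (ℕ.≤-trans bound (ℕ.≤-trans (ℕ.≤-reflexive (ℕ.+-suc r d)) (ℕ.+-monoˡ-≤ d (s≤s r≤m))))
        ... | βlo , t<lo = apply (lo<lo m<) (lo<hi⁺ m<) (proj₂ (Q-lo m<)) t<lo βlo

      -- Now β has `lo 0` but not `hi len`, and γ the reverse. One more point on either side, from
      -- `left-plus` and `right-minus`, completes an alternation.
      ¬ForcedRight-lo : ¬ ForcedRight γ (lo 0)
      ¬ForcedRight-lo (forcedʳ {u′} {s} {t′} Zlo u′<lo lo<s s<t′ Pu′ Qs Mt′)
        with reach-right Zlo u′<lo lo<s s<t′ Pu′ Qs Mt′ len ℕ.≤-refl | reach-left len 0 ℕ.z≤n ℕ.≤-refl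
      ... | γhi , hi<t′ | βlo , t<lo
        with left-plus cγ β∈C Pu′ (γhi , proj₂ (proj₂ (Q-hi ℕ.≤-refl))) Mt′ (<-trans t<lo lo<hi′) hi<t′
               Mt (Z⇒Minus (hi≤y , proj₂ (Q-hi ℕ.≤-refl))) Pu (<-trans u′<lo lo<hi′) hi<u
           | right-minus cγ β∈C Pu (βlo , proj₂ (proj₂ Zlo)) Mt t<lo (<-trans lo<hi′ hi<t′)
               Mt′ (Z⇒Minus Zlo) Pu′ u′<lo (<-trans lo<hi′ hi<u)
        where
        lo<hi′ : lo 0 < hi len
        lo<hi′ = hi-after ℕ.z≤n ℕ.≤-refl (lo<hi ℕ.z≤n)
      ... | q₁ , e₁ , γq₁ , βq₁ | q₂ , e₂ , γq₂ , βq₂ = sep cγ β∈C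
        (alternate (on-either e₁ u′<lo t<lo) (hi-after ℕ.z≤n ℕ.≤-refl (lo<hi ℕ.z≤n)) (on-either e₂ hi<u hi<t′)
          γq₁ βq₁ (proj₁ Zlo) βlo γhi hi≤y γq₂ βq₂)

  record GapAt (κ a : Fin n) : Set where
    field
      {gset} : Subset n
      {a⁺} : Fin n
      gset∈C : C gset
      gflat : Flat gset
      Qa : Q gset a
      Qb : Q gset a⁺
      a<κ : a < κ
      κ<b : κ < a⁺
      gfree : ∀ {x} → Δ x → a < x → x < a⁺ → gset ∌ x

  Q? : (A : Subset n) (p : Fin n) → Dec (Q A p)
  Q? A p = map′ (λ (a , b , c) → ∋! a , ∋! b , ∌! c) (λ (a , b , c) → on a , on b , off c)
    ((lookup A p ≟ᵇ true) ×-dec ((lookup Y p ≟ᵇ true) ×-dec (lookup X p ≟ᵇ false)))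

  Δ? : (p : Fin n) → Dec (Δ p)
  Δ? p = map′ (λ (b , c) → ∋! b , ∌! c) (λ (b , c) → on b , off c)
    ((lookup Y p ≟ᵇ true) ×-dec (lookup X p ≟ᵇ false))

  ¬Q⇒∌ : Δ p → ¬ Q A p → A ∌ p
  ¬Q⇒∌ {p} {A} Δp nq with ∋? A p
  ... | inj₁ h = ⊥-elim (nq (h , Δp))
  ... | inj₂ h = h

  gap-at : ∀ {κ} → C α → Gapped α κ → ∃ (GapAt κ)
  gap-at {α} {κ} cα (gapped {s} {t} Zκ s<κ κ<t Qs Qt f)
    with greatest-below (Q? α) κ s s<κ Qs | least-above (Q? α) κ t κ<t Qt
  ... | a , a<κ , Qa , noneˡ , _ | b , κ<b , Qb , noneʳ = a , record
    { gset∈C = cα ; gflat = f ; Qa = Qa ; Qb = Qb ; a<κ = a<κ ; κ<b = κ<b ; gfree = free }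
    where
    free : ∀ {x} → Δ x → a < x → x < b → α ∌ x
    free {x} Δx a<x x<b with <-cmp x κ
    ... | tri< x<κ _ _ = ¬Q⇒∌ Δx (noneˡ x a<x x<κ)
    ... | tri≈ _ refl _ = proj₁ Zκ
    ... | tri> _ _ κ<x = ¬Q⇒∌ Δx (noneʳ x κ<x x<b)

  -- Both conditions hold at the greatest element of Δ, since each violation needs a larger one.
  -- Being forced left is left out on purpose: it is refuted only for the least such element.
  Good : Fin n → Set
  Good z = (∀ γ → C γ → ¬ ForcedRight γ z) × (∀ γ → C γ → ¬ Gapped γ z)

  module _ {y w : Fin n} {β : Subset n} (forcing : LeftForcing β w y) (good-y : Good y)
           (minimal : ∀ z → Δ z → z < y → ¬ Good z) where
    open LeftForcing forcing

    free-w : ∀ γ → C γ → ¬ ForcedRight γ w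
    free-w γ cγ f = ForcedRight-transfer cγ forcing f (proj₁ good-y γ cγ)

    -- If the least element y not blocked on the right or by a gap is blocked on the
    -- left, then so is by a gap an element w below y.  The left end of such a gap is
    -- again blocked by a gap, so gaps could be chained to the left forever.
    record Extensible : Set where
      field
        chain : Chain
        {κ} : Fin n
      open Chain chain public
      field
        lo<κ : lo 0 < κ
        κ<hi : κ < hi 0
        leftmost : ∀ a → a < lo 0 → ¬ GapAt κ a
        lo<w : lo len < w
        w<hi : w < hi len
        β∌hi : β ∌ hi len
        hi<u : hi len < u
        free-lo : ∀ {t} → t ℕ.< len → ∀ γ → C γ → ¬ ForcedRight γ (lo (suc t))

    module _ (E : Extensible) where
      open Extensible E
      open ChainProperties chain

      free-lo₀ : ∀ γ → C γ → ¬ ForcedRight γ (lo 0)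
      free-lo₀ γ cγ = ¬ForcedRight-lo forcing chain (lo<w , w<hi) β∌hi hi<u cγ
        (λ t< → free-lo t< γ cγ) (free-w γ cγ)

      module _ {a : Fin n} (gap : GapAt (lo 0) a) (leftmost′ : ∀ a′ → a′ < a → ¬ GapAt (lo 0) a′) where
        open GapAt gap

        -- Otherwise the new gap would reach beyond `κ` and be a gap around `κ` starting left of the
        -- leftmost one.
        b<hi : a⁺ < hi 0
        b<hi with <-cmp a⁺ κ
        ... | tri< b<κ _ _ = <-trans b<κ κ<hi
        ... | tri≈ _ refl _ = κ<hi
        ... | tri> _ _ κ<b′ = ⊥-elim (leftmost a a<κ record
          { gset∈C = gset∈C ; gflat = gflat ; Qa = Qa ; Qb = Qb ; a<κ = <-trans a<κ lo<κ ; κ<b = κ<b′ ; gfree = gfree })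

        cons : {S : Set} → S → (ℕ → S) → ℕ → S
        cons s f zero = s
        cons s f (suc t) = f t

        extended : Chain
        extended = record
          { len = suc len
          ; set = cons gset set
          ; lo = cons a lo
          ; hi = cons a⁺ hi
          ; set∈C = λ { {zero} _ → gset∈C ; {suc t} (s≤s h) → set∈C h }
          ; flat = λ { {zero} _ → gflat ; {suc t} (s≤s h) → flat h }
          ; Q-lo = λ { {zero} _ → Qa ; {suc t} (s≤s h) → Q-lo h }
          ; Q-hi = λ { {zero} _ → Qb ; {suc t} (s≤s h) → Q-hi h }
          ; lo<hi = λ { {zero} _ → <-trans a<κ κ<b ; {suc t} (s≤s h) → lo<hi h }
          ; free = λ { {zero} _ → gfree ; {suc t} (s≤s h) → free h }
          ; lo<lo = λ { {zero} _ → a<κ ; {suc t} (s≤s h) → lo<lo h }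
          ; lo<hi⁺ = λ { {zero} _ → κ<b ; {suc t} (s≤s h) → lo<hi⁺ h }
          ; hi<hi = λ { {zero} _ → b<hi ; {suc t} (s≤s h) → hi<hi h }
          }

        extend : Extensible
        extend = record
          { chain = extended ; lo<κ = a<κ ; κ<hi = κ<b ; leftmost = leftmost′
          ; lo<w = lo<w ; w<hi = w<hi ; β∌hi = β∌hi ; hi<u = hi<u
          ; free-lo = λ { {zero} _ → free-lo₀ ; {suc t} (s≤s h) → free-lo h } }

    unending : ∀ k (E : Extensible) → toℕ (Extensible.lo E 0) ℕ.< k → ⊥
    unending (suc k) E (s≤s bound) = minimal (lo 0) (proj₂ (Q-lo ℕ.z≤n)) lo₀<y
      (free-lo₀ E , λ γ cγ g → let (a , gap) = gap-at cγ g in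
        minimal-refutes {D = GapAt (lo 0)}
          (λ a gap leftmost′ → unending k (extend E gap leftmost′) (ℕ.≤-trans (GapAt.a<κ gap) bound)) a gap)
      where
      open Extensible E
      lo₀<y : lo 0 < y
      lo₀<y = <-trans (ChainProperties.lo-before chain ℕ.z≤n ℕ.≤-refl lo<w) w<y

    no-left-forcing : ⊥
    no-left-forcing = minimal w (proj₂ Qw) w<y (free-w , λ γ cγ g → let (a , gap) = gap-at cγ g in
        minimal-refutes {D = GapAt w} start a gap)
      where
      start : ∀ a → GapAt w a → (∀ a′ → a′ < a → ¬ GapAt w a′) → ⊥
      start a gap leftmost = unending (suc (toℕ a)) record
          { chain = record
            { len = 0 ; set = λ _ → gset ; lo = λ _ → a ; hi = λ _ → a⁺
            ; set∈C = λ _ → gset∈C ; flat = λ _ → gflat ; Q-lo = λ _ → Qa ; Q-hi = λ _ → Qb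
            ; lo<hi = λ _ → <-trans a<κ κ<b ; free = λ _ → gfree
            ; lo<lo = λ () ; lo<hi⁺ = λ () ; hi<hi = λ () }
          ; lo<κ = a<κ ; κ<hi = κ<b ; leftmost = leftmost ; lo<w = a<κ ; w<hi = κ<b
          ; β∌hi = proj₁ b-props ; hi<u = proj₂ b-props ; free-lo = λ () } ℕ.≤-refl
        where
        open GapAt gap
        b-props : β ∌ a⁺ × a⁺ < u
        b-props with <-cmp a⁺ y
        ... | tri< b<y _ _ = none (proj₂ Qb) κ<b b<y , <-trans b<y y<u
        ... | tri≈ _ refl _ = proj₁ Zy , y<u
        ... | tri> _ _ y<b = ⊥-elim (proj₂ good-y gset gset∈C
          (gapped (gfree (proj₂ Zy) (<-trans a<κ w<y) y<b , proj₂ Zy) (<-trans a<κ w<y) y<b Qa Qb gflat))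

  not-forced-left : ∀ {y} → Good y → (∀ z → Δ z → z < y → ¬ Good z) → C β → ¬ ForcedLeft β y
  not-forced-left {β} {y} good minimal cβ (forcedˡ {t} {s} {u} Zy t<s s<y y<u Mt Qs Pu)
    with greatest-below (Q? β) y s s<y Qs
  ... | w , w<y , Qw , none , s≤w = no-left-forcing record
    { β∈C = cβ ; t<w = on-either-< s≤w ; y<u = y<u ; w<y = w<y ; Mt = Mt ; Qw = Qw ; Zy = Zy ; Pu = Pu
    ; none = λ Δx w<x x<y → ¬Q⇒∌ Δx (none _ w<x x<y) } good minimal
    where
    on-either-< : s < w ⊎ s ≡ w → t < w
    on-either-< (inj₁ s<w) = <-trans t<s s<w
    on-either-< (inj₂ refl) = t<s

  -- Deciding whether a suitable `y` exists permits an argument by contradiction, in which a least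
  -- good element may be assumed. No member obstructs it, so maximality puts all four corners into
  -- `C`.
  exchange : (∀ A → Dec (C A)) → ∃ Δ → ∃ λ y → Δ y × Face C i j (X [ y ]≔ true)
  exchange C? (t₀ , Δt₀) with any? (λ y → Δ? y ×-dec Face? C? (<⇒≢ i<j) (X [ y ]≔ true))
  ... | yes found = found
  ... | no none with greatest Δ? t₀ Δt₀
  ... | m , Δm , last = ⊥-elim (minimal-refutes {D = λ z → Δ z × Good z} step m (Δm , good-m))
    where
    good-m : Good m
    good-m = (λ { γ cγ (forcedʳ _ _ m<s _ _ Qs _) → last _ m<s (proj₂ Qs) })
           , (λ { γ cγ (gapped _ _ m<t _ Qt _) → last _ m<t (proj₂ Qt) })
    step : ∀ y → Δ y × Good y → (∀ z → z < y → ¬ (Δ z × Good z)) → ⊥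
    step y (Δy , good) minimal = none (y , Δy , λ V agree → maximal V λ A cA →
        (λ alt → blocked cA (obstruction Δy agree cA alt)) , (λ alt → blocked cA (obstruction′ Δy agree cA alt)))
      where
      blocked : C A → ¬ Obstructs A y
      blocked cA (inj₁ f) = proj₁ good _ cA f
      blocked cA (inj₂ (inj₁ f)) = not-forced-left good (λ z Δz z<y gz → minimal z z<y (Δz , gz)) cA f
      blocked cA (inj₂ (inj₂ g)) = proj₂ good _ cA g

-- Every triple spans a cube

module _ where
  private
    variable
      A B X Y : Subset n
      p q : Fin n

  -- Moving up along the line of faces at {x, y}, the elements outside the
  -- interval are added to the base and those inside are removed from it.
  data Crossed (x y : Fin n) (X : Subset n) (p : Fin n) : Set where
    left   : p < x → X ∋ p → Crossed x y X p
    inside : x < p → p < y → X ∌ p → Crossed x y X p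
    right  : y < p → X ∋ p → Crossed x y X p

  data Uncrossed (x y : Fin n) (X : Subset n) (p : Fin n) : Set where
    left   : p < x → X ∌ p → Uncrossed x y X p
    inside : x < p → p < y → X ∋ p → Uncrossed x y X p
    right  : y < p → X ∌ p → Uncrossed x y X p

  crossed? : ∀ {x y : Fin n} → ∀ X p → p ≢ x → p ≢ y → Crossed x y X p ⊎ Uncrossed x y X p
  crossed? {x = x} {y} X p p≢x p≢y with <-cmp p x | <-cmp p y | ∋? X p
  ... | tri< l _ _ | _ | inj₁ h = inj₁ (left l h)
  ... | tri< l _ _ | _ | inj₂ h = inj₂ (left l h)
  ... | tri≈ _ e _ | _ | _ = ⊥-elim (p≢x e)
  ... | tri> _ _ g | tri< l _ _ | inj₁ h = inj₂ (inside g l h)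
  ... | tri> _ _ g | tri< l _ _ | inj₂ h = inj₁ (inside g l h)
  ... | tri> _ _ g | tri≈ _ e _ | _ = ⊥-elim (p≢y e)
  ... | tri> _ _ _ | tri> _ _ g | inj₁ h = inj₁ (right g h)
  ... | tri> _ _ _ | tri> _ _ g | inj₂ h = inj₂ (right g h)

  crossed-uncrossed : ∀ {x y : Fin n} → x < y → Crossed x y X p → Uncrossed x y X p → ⊥
  crossed-uncrossed x<y (left _ h) (left _ k) = ∋∌-absurd h k
  crossed-uncrossed x<y (left h _) (inside k _ _) = <-asym h k
  crossed-uncrossed x<y (left h _) (right k _) = <-asym (<-trans h x<y) k
  crossed-uncrossed x<y (inside h _ _) (left k _) = <-asym h k
  crossed-uncrossed x<y (inside _ _ h) (inside _ _ k) = ∋∌-absurd k h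
  crossed-uncrossed x<y (inside _ h _) (right k _) = <-asym h k
  crossed-uncrossed x<y (right h _) (left k _) = <-asym (<-trans k x<y) h
  crossed-uncrossed x<y (right h _) (inside _ k _) = <-asym h k
  crossed-uncrossed x<y (right _ h) (right _ k) = ∋∌-absurd h k

  ∋-resp : lookup A p ≡ lookup X p → X ∋ p → A ∋ p
  ∋-resp e (∋! h) = ∋! (trans e h)

  ∌-resp : lookup A p ≡ lookup X p → X ∌ p → A ∌ p
  ∌-resp e (∌! h) = ∌! (trans e h)

  Crossed-resp : ∀ {x y : Fin n} → lookup A p ≡ lookup X p → Crossed x y X p → Crossed x y A p
  Crossed-resp e (left l h) = left l (∋-resp e h)
  Crossed-resp e (inside g l h) = inside g l (∌-resp e h)
  Crossed-resp e (right g h) = right g (∋-resp e h)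

  Uncrossed-resp : ∀ {x y : Fin n} → lookup A p ≡ lookup X p → Uncrossed x y X p → Uncrossed x y A p
  Uncrossed-resp e (left l h) = left l (∌-resp e h)
  Uncrossed-resp e (inside g l h) = inside g l (∋-resp e h)
  Uncrossed-resp e (right g h) = right g (∌-resp e h)

  -- All faces at {x, y} in a chord separated collection lie on a chain.
  module _ {C : Subset n → Set} (sep : ∀ {A B} → C A → C B → ¬ Alternate A B)
    {x y : Fin n} (x<y : x < y) where

    private
      module Corners {X Y : Subset n} (fX : Face C x y X) (fY : Face C x y Y) where
        x≢y : x ≢ y
        x≢y = <⇒≢ x<y

        module _ (b c : Bool) where
          V W : Subset n
          V = set₂ x y b c X
          W = set₂ x y (not b) (not c) Y
          V∈C : C V
          V∈C = fX V (set₂-off b c X)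
          W∈C : C W
          W∈C = fY W (set₂-off (not b) (not c) Y)

          module _ {p : Fin n} (p≢x : p ≢ x) (p≢y : p ≢ y) where
            V∋ : X ∋ p → V ∋ p
            V∋ = ∋-resp (set₂-off b c X p p≢x p≢y)
            V∌ : X ∌ p → V ∌ p
            V∌ = ∌-resp (set₂-off b c X p p≢x p≢y)
            W∋ : Y ∋ p → W ∋ p
            W∋ = ∋-resp (set₂-off (not b) (not c) Y p p≢x p≢y)
            W∌ : Y ∌ p → W ∌ p
            W∌ = ∌-resp (set₂-off (not b) (not c) Y p p≢x p≢y)

          Vx : lookup V x ≡ b
          Vx = set₂-fst b c X x≢y
          Vy : lookup V y ≡ c
          Vy = set₂-snd {x = x} b c X
          Wx : lookup W x ≡ not b
          Wx = set₂-fst (not b) (not c) Y x≢y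
          Wy : lookup W y ≡ not c
          Wy = set₂-snd {x = x} (not b) (not c) Y

      -- The bases differ at `p` and `q`, and the corners at `x` and `y` can be chosen
      -- complementary, so that these two elements are the other points of an alternation. The
      -- reversed convention inside the interval makes the signs fit for every position of `p` and
      -- `q`.
      ordered : {X Y : Subset n} → Face C x y X → Face C x y Y → p < q →
        Crossed x y X p → Uncrossed x y Y p → Crossed x y Y q → Uncrossed x y X q → ⊥
      ordered {p = p} {q} {X} {Y} fX fY p<q = cases
        where
        open Corners {X} {Y} fX fY
        cases : Crossed x y X p → Uncrossed x y Y p → Crossed x y Y q → Uncrossed x y X q → ⊥
        cases (left p<x Xp) (left _ Yp) (left q<x Yq) (left _ Xq) = sep (V∈C true false) (W∈C true false)
          (alternate p<q q<x x<y (V∋ _ _ p≢x p≢y Xp) (W∌ _ _ p≢x p≢y Yp) (V∌ _ _ q≢x q≢y Xq) (W∋ _ _ q≢x q≢y Yq)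
            (∋! (Vx _ _)) (∌! (Wx _ _)) (∌! (Vy _ _)) (∋! (Wy _ _)))
          where
          p≢x = <⇒≢ p<x
          p≢y = <⇒≢ (<-trans p<x x<y)
          q≢x = <⇒≢ q<x
          q≢y = <⇒≢ (<-trans q<x x<y)
        cases (left p<x Xp) (left _ Yp) (inside x<q q<y Yq) (inside _ _ Xq) = sep (V∈C false false) (W∈C false false)
          (alternate p<x x<q q<y (V∋ _ _ p≢x p≢y Xp) (W∌ _ _ p≢x p≢y Yp) (∌! (Vx _ _)) (∋! (Wx _ _))
            (V∋ _ _ q≢x q≢y Xq) (W∌ _ _ q≢x q≢y Yq) (∌! (Vy _ _)) (∋! (Wy _ _)))
          where
          p≢x = <⇒≢ p<x
          p≢y = <⇒≢ (<-trans p<x x<y)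
          q≢x = >⇒≢ x<q
          q≢y = <⇒≢ q<y
        cases (left p<x Xp) (left _ Yp) (right y<q Yq) (right _ Xq) = sep (V∈C false true) (W∈C false true)
          (alternate p<x x<y y<q (V∋ _ _ p≢x p≢y Xp) (W∌ _ _ p≢x p≢y Yp) (∌! (Vx _ _)) (∋! (Wx _ _))
            (∋! (Vy _ _)) (∌! (Wy _ _)) (V∌ _ _ q≢x q≢y Xq) (W∋ _ _ q≢x q≢y Yq))
          where
          p≢x = <⇒≢ p<x
          p≢y = <⇒≢ (<-trans p<x x<y)
          q≢x = >⇒≢ (<-trans x<y y<q)
          q≢y = >⇒≢ y<q
        cases (inside x<p p<y Xp) (inside _ _ Yp) (inside x<q q<y Yq) (inside _ _ Xq) = sep (V∈C true false) (W∈C true false)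
          (alternate x<p p<q q<y (∋! (Vx _ _)) (∌! (Wx _ _)) (V∌ _ _ p≢x p≢y Xp) (W∋ _ _ p≢x p≢y Yp)
            (V∋ _ _ q≢x q≢y Xq) (W∌ _ _ q≢x q≢y Yq) (∌! (Vy _ _)) (∋! (Wy _ _)))
          where
          p≢x = >⇒≢ x<p
          p≢y = <⇒≢ p<y
          q≢x = >⇒≢ x<q
          q≢y = <⇒≢ q<y
        cases (inside x<p p<y Xp) (inside _ _ Yp) (right y<q Yq) (right _ Xq) = sep (V∈C true true) (W∈C true true)
          (alternate x<p p<y y<q (∋! (Vx _ _)) (∌! (Wx _ _)) (V∌ _ _ p≢x p≢y Xp) (W∋ _ _ p≢x p≢y Yp)
            (∋! (Vy _ _)) (∌! (Wy _ _)) (V∌ _ _ q≢x q≢y Xq) (W∋ _ _ q≢x q≢y Yq))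
          where
          p≢x = >⇒≢ x<p
          p≢y = <⇒≢ p<y
          q≢x = >⇒≢ (<-trans x<y y<q)
          q≢y = >⇒≢ y<q
        cases (right y<p Xp) (right _ Yp) (right y<q Yq) (right _ Xq) = sep (V∈C true false) (W∈C true false)
          (alternate x<y y<p p<q (∋! (Vx _ _)) (∌! (Wx _ _)) (∌! (Vy _ _)) (∋! (Wy _ _))
            (V∋ _ _ p≢x p≢y Xp) (W∌ _ _ p≢x p≢y Yp) (V∌ _ _ q≢x q≢y Xq) (W∋ _ _ q≢x q≢y Yq))
          where
          p≢x = >⇒≢ (<-trans x<y y<p)
          p≢y = >⇒≢ y<p
          q≢x = >⇒≢ (<-trans x<y y<q)
          q≢y = >⇒≢ y<q
        cases (inside x<p _ _) _ (left q<x _) _ = <-asym (<-trans x<p p<q) q<x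
        cases (right y<p _) _ (left q<x _) _ = <-asym (<-trans y<p p<q) (<-trans q<x x<y)
        cases (right y<p _) _ (inside _ q<y _) _ = <-asym (<-trans y<p p<q) q<y
        cases (left p<x _) (inside x<p _ _) _ _ = <-asym p<x x<p
        cases (left p<x _) (right y<p _) _ _ = <-asym (<-trans p<x x<y) y<p
        cases (inside x<p _ _) (left p<x _) _ _ = <-asym p<x x<p
        cases (inside _ p<y _) (right y<p _) _ _ = <-asym p<y y<p
        cases (right y<p _) (left p<x _) _ _ = <-asym (<-trans p<x x<y) y<p
        cases (right y<p _) (inside _ p<y _) _ _ = <-asym p<y y<p
        cases _ _ (left q<x _) (inside x<q _ _) = <-asym q<x x<q
        cases _ _ (left q<x _) (right y<q _) = <-asym (<-trans q<x x<y) y<q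
        cases _ _ (inside x<q _ _) (left q<x _) = <-asym q<x x<q
        cases _ _ (inside _ q<y _) (right y<q _) = <-asym q<y y<q
        cases _ _ (right y<q _) (left q<x _) = <-asym (<-trans q<x x<y) y<q
        cases _ _ (right y<q _) (inside _ q<y _) = <-asym q<y y<q

    faces-comparable : {X Y : Subset n} → Face C x y X → Face C x y Y →
      Crossed x y X p → Uncrossed x y Y p → Crossed x y Y q → Uncrossed x y X q → ⊥
    faces-comparable {p = p} {q} fX fY Xp Yp Yq Xq with <-cmp p q
    ... | tri< p<q _ _ = ordered fX fY p<q Xp Yp Yq Xq
    ... | tri≈ _ refl _ = crossed-uncrossed x<y Xp Xq
    ... | tri> _ _ q<p = ordered fY fX q<p Yq Xq Xp Yp

  distance : Subset n → Subset n → ℕ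
  distance [] [] = 0
  distance (a ∷ A) (b ∷ B) with a ≟ᵇ b
  ... | yes _ = distance A B
  ... | no _  = suc (distance A B)

  distance-≤ : (A B A′ B′ : Subset n) →
    (∀ p → lookup A p ≡ lookup B p → lookup A′ p ≡ lookup B′ p) → distance A′ B′ ℕ.≤ distance A B
  distance-≤ [] [] [] [] h = z≤n
  distance-≤ (a ∷ A) (b ∷ B) (a′ ∷ A′) (b′ ∷ B′) h
    with distance-≤ A B A′ B′ (λ p → h (suc p)) | a ≟ᵇ b | a′ ≟ᵇ b′
  ... | ih | yes _ | yes _ = ih
  ... | ih | yes e | no ne = ⊥-elim (ne (h zero e))
  ... | ih | no _ | yes _ = ℕ.m≤n⇒m≤1+n ih
  ... | ih | no _ | no _ = s≤s ih

  distance-< : (A B A′ B′ : Subset n) →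
    (∀ p → lookup A p ≡ lookup B p → lookup A′ p ≡ lookup B′ p) →
    ∀ q → lookup A q ≢ lookup B q → lookup A′ q ≡ lookup B′ q → distance A′ B′ ℕ.< distance A B
  distance-< (a ∷ A) (b ∷ B) (a′ ∷ A′) (b′ ∷ B′) h zero ne e
    with distance-≤ A B A′ B′ (λ p → h (suc p)) | a ≟ᵇ b | a′ ≟ᵇ b′
  ... | ih | yes e′ | _ = ⊥-elim (ne e′)
  ... | ih | no _ | yes _ = s≤s ih
  ... | ih | no _ | no ne′ = ⊥-elim (ne′ e)
  distance-< (a ∷ A) (b ∷ B) (a′ ∷ A′) (b′ ∷ B′) h (suc q) ne e
    with distance-< A B A′ B′ (λ p → h (suc p)) q ne e | a ≟ᵇ b | a′ ≟ᵇ b′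
  ... | ih | yes _ | yes _ = ih
  ... | ih | yes e′ | no ne′ = ⊥-elim (ne′ (h zero e′))
  ... | ih | no _ | yes _ = ℕ.m≤n⇒m≤1+n ih
  ... | ih | no _ | no _ = s≤s ih

  module _ (C : Subset n → Set) (C? : ∀ A → Dec (C A))
    (sep : ∀ {A B} → C A → C B → ¬ Alternate A B)
    (maximal : ∀ V → (∀ A → C A → ¬ Alternate A V × ¬ Alternate V A) → C V)
    where

    -- In either orientation, an alternation makes `V` show both in-out-in and out-in-out on three
    -- consecutive points. Hence convex and coconvex sets belong to every maximal `C`.
    convex∈C : ∀ V → (∀ {a b c} → a < b → b < c → V ∋ a → V ∌ b → V ∋ c → ⊥) → C V
    convex∈C V convex = maximal V λ A _ →
        (λ { (alternate ab bc cd _ _ _ Vb _ Vc _ Vd) → convex bc cd Vb Vc Vd })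
      , (λ { (alternate ab bc cd Va _ Vb _ Vc _ _ _) → convex ab bc Va Vb Vc })

    coconvex∈C : ∀ V → (∀ {a b c} → a < b → b < c → V ∌ a → V ∋ b → V ∌ c → ⊥) → C V
    coconvex∈C V coconvex = maximal V λ A _ →
        (λ { (alternate ab bc cd _ Va _ Vb _ Vc _ _) → coconvex ab bc Va Vb Vc })
      , (λ { (alternate ab bc cd _ _ Vb _ Vc _ Vd _) → coconvex bc cd Vb Vc Vd })

    module _ {a c : Fin n} (a<c : a < c) where
      -- The bases at the two ends of the line of faces at {a, c}: `between` has crossed no element
      -- and `outside` has crossed all of them.
      between outside : Subset n
      between = tabulate λ p → ⌊ (a <? p) ×-dec (p <? c) ⌋
      outside = tabulate λ p → ⌊ (p <? a) ⊎-dec (c <? p) ⌋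

      between∋ : a < p → p < c → between ∋ p
      between∋ {p} a<p p<c = ∋! (trans (lookup∘tabulate _ p) eq)
        where
        eq : ⌊ (a <? p) ×-dec (p <? c) ⌋ ≡ true
        eq with a <? p | p <? c
        ... | yes _ | yes _ = refl
        ... | no h | _ = ⊥-elim (h a<p)
        ... | yes _ | no h = ⊥-elim (h p<c)

      between∌ : ¬ (a < p × p < c) → between ∌ p
      between∌ {p} h = ∌! (trans (lookup∘tabulate _ p) eq)
        where
        eq : ⌊ (a <? p) ×-dec (p <? c) ⌋ ≡ false
        eq with a <? p | p <? c
        ... | yes l | yes r = ⊥-elim (h (l , r))
        ... | no _ | _ = refl
        ... | yes _ | no _ = refl

      outside∋ : p < a ⊎ c < p → outside ∋ p
      outside∋ {p} h = ∋! (trans (lookup∘tabulate _ p) (eq h))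
        where
        eq : p < a ⊎ c < p → ⌊ (p <? a) ⊎-dec (c <? p) ⌋ ≡ true
        eq h with p <? a | c <? p | h
        ... | yes _ | _ | _ = refl
        ... | no _ | yes _ | _ = refl
        ... | no l | no _ | inj₁ l′ = ⊥-elim (l l′)
        ... | no _ | no r | inj₂ r′ = ⊥-elim (r r′)

      outside∌ : ¬ (p < a) → ¬ (c < p) → outside ∌ p
      outside∌ {p} l r = ∌! (trans (lookup∘tabulate _ p) eq)
        where
        eq : ⌊ (p <? a) ⊎-dec (c <? p) ⌋ ≡ false
        eq with p <? a | c <? p
        ... | yes l′ | _ = ⊥-elim (l l′)
        ... | no _ | yes r′ = ⊥-elim (r r′)
        ... | no _ | no _ = refl

      a≤-c≤ : ∀ {V x} → V ∋ x → Agree₂ a c V between → ¬ (x < a) × ¬ (c < x)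
      a≤-c≤ Vx agree = (λ x<a → ∋∌-absurd Vx (∌-resp (agree _ (<⇒≢ x<a) (<⇒≢ (<-trans x<a a<c)))
                                       (between∌ λ (a<x , _) → <-asym x<a a<x)))
                     , (λ c<x → ∋∌-absurd Vx (∌-resp (agree _ (>⇒≢ (<-trans a<c c<x)) (>⇒≢ c<x))
                                       (between∌ λ (_ , x<c) → <-asym x<c c<x)))

      ≤a-≤c : ∀ {V x} → V ∌ x → Agree₂ a c V outside → ¬ (x < a) × ¬ (c < x)
      ≤a-≤c Vx agree = (λ x<a → ∋∌-absurd (∋-resp (agree _ (<⇒≢ x<a) (<⇒≢ (<-trans x<a a<c))) (outside∋ (inj₁ x<a))) Vx)
                     , (λ c<x → ∋∌-absurd (∋-resp (agree _ (>⇒≢ (<-trans a<c c<x)) (>⇒≢ c<x))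
                                       (outside∋ (inj₂ c<x))) Vx)

      strictly : ∀ {x y z : Fin n} → ¬ (x < a) → x < y → y < z → ¬ (c < z) → a < y × y < c
      strictly {x} {y} {z} ax xy yz zc = ℕ.≤-<-trans (ℕ.≮⇒≥ ax) xy , ℕ.<-≤-trans yz (ℕ.≮⇒≥ zc)

      face-between : Face C a c between
      face-between V agree = convex∈C V λ xy yz Vx Vy Vz →
        let (a<y , y<c) = strictly (proj₁ (a≤-c≤ Vx agree)) xy yz (proj₂ (a≤-c≤ Vz agree)) in
        ∋∌-absurd (∋-resp (agree _ (>⇒≢ a<y) (<⇒≢ y<c)) (between∋ a<y y<c)) Vy

      face-outside : Face C a c outside
      face-outside V agree = coconvex∈C V λ xy yz Vx Vy Vz →
        let (a<y , y<c) = strictly (proj₁ (≤a-≤c Vx agree)) xy yz (proj₂ (≤a-≤c Vz agree)) in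
        ∋∌-absurd Vy (∌-resp (agree _ (>⇒≢ a<y) (<⇒≢ y<c)) (outside∌ (<-asym a<y) (<-asym y<c)))

      -- The induction hypothesis for {p, a, c}: its cube appears as two faces at {a, c} that differ
      -- in the value at `p`, which treats both sides of the interval alike.
      Wide : Set
      Wide = ∀ p → p < a ⊎ c < p → ∃ λ Z → ∀ v → Face C a c (Z [ p ]≔ v)

      module Descent (wide : Wide) {b : Fin n} (a<b : a < b) (b<c : b < c) where
        private
          b≢a : b ≢ a
          b≢a e = <⇒≢ a<b (sym e)
          b≢c : b ≢ c
          b≢c = <⇒≢ b<c

        record Bounds (X Y : Subset n) : Set where
          field
            X∌a : X ∌ a
            X∌c : X ∌ c
            Y∌a : Y ∌ a
            Y∌c : Y ∌ c
            X∌b : X ∌ b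
            Y∋b : Y ∋ b
            faceX : Face C a c X
            faceY : Face C a c Y

        normalise : Subset n → Subset n
        normalise = set₂ a c false false

        Face-resp : ∀ {X X′} → (∀ p → p ≢ a → p ≢ c → lookup X′ p ≡ lookup X p) → Face C a c X → Face C a c X′
        Face-resp e f V agree = f V λ p p≢a p≢c → trans (agree p p≢a p≢c) (e p p≢a p≢c)

        b-crossed : X ∌ b → Crossed a c X b
        b-crossed = inside a<b b<c

        b-uncrossed : X ∋ b → Uncrossed a c X b
        b-uncrossed = inside a<b b<c

        differ : X ∋ p → Y ∌ p → lookup X p ≢ lookup Y p
        differ (∋! h) (∌! k) e with () ← trans (sym h) (trans e k)

        differ′ : X ∌ p → Y ∋ p → lookup X p ≢ lookup Y p
        differ′ (∌! h) (∋! k) e with () ← trans (sym h) (trans e k)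

        ≡-from-∌ : X ∌ p → Y ∌ p → lookup X p ≡ lookup Y p
        ≡-from-∌ (∌! h) (∌! k) = trans h (sym k)

        ≡-from-crossed : ∀ {U V} q → q ≢ a → q ≢ c → (Crossed a c U q → Uncrossed a c V q → ⊥) →
          (Crossed a c V q → Uncrossed a c U q → ⊥) → lookup U q ≡ lookup V q
        ≡-from-crossed {U} {V} q q≢a q≢c h k with crossed? U q q≢a q≢c | crossed? V q q≢a q≢c
        ... | inj₁ u | inj₂ v = ⊥-elim (h u v)
        ... | inj₂ u | inj₁ v = ⊥-elim (k v u)
        ... | inj₁ (left _ u) | inj₁ (left _ v) = trans (on u) (sym (on v))
        ... | inj₁ (inside _ _ u) | inj₁ (inside _ _ v) = trans (off u) (sym (off v))
        ... | inj₁ (right _ u) | inj₁ (right _ v) = trans (on u) (sym (on v))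
        ... | inj₂ (left _ u) | inj₂ (left _ v) = trans (off u) (sym (off v))
        ... | inj₂ (inside _ _ u) | inj₂ (inside _ _ v) = trans (on u) (sym (on v))
        ... | inj₂ (right _ u) | inj₂ (right _ v) = trans (off u) (sym (off v))
        ... | inj₁ (left l _) | inj₁ (inside g _ _) = ⊥-elim (<-asym l g)
        ... | inj₁ (left l _) | inj₁ (right g _) = ⊥-elim (<-asym (<-trans l a<c) g)
        ... | inj₁ (inside g _ _) | inj₁ (left l _) = ⊥-elim (<-asym l g)
        ... | inj₁ (inside _ l _) | inj₁ (right g _) = ⊥-elim (<-asym l g)
        ... | inj₁ (right g _) | inj₁ (left l _) = ⊥-elim (<-asym (<-trans l a<c) g)
        ... | inj₁ (right g _) | inj₁ (inside _ l _) = ⊥-elim (<-asym l g)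
        ... | inj₂ (left l _) | inj₂ (inside g _ _) = ⊥-elim (<-asym l g)
        ... | inj₂ (left l _) | inj₂ (right g _) = ⊥-elim (<-asym (<-trans l a<c) g)
        ... | inj₂ (inside g _ _) | inj₂ (left l _) = ⊥-elim (<-asym l g)
        ... | inj₂ (inside _ l _) | inj₂ (right g _) = ⊥-elim (<-asym l g)
        ... | inj₂ (right g _) | inj₂ (left l _) = ⊥-elim (<-asym (<-trans l a<c) g)
        ... | inj₂ (right g _) | inj₂ (inside _ l _) = ⊥-elim (<-asym l g)

        comparable = faces-comparable {C = C} sep a<c

        -- Two faces on the line at {a, c}, with `b` crossed between them, are moved towards each
        -- other until they differ in `b` alone. Differences outside [a, c] are removed by wider
        -- cubes, those inside by `exchange`.
        descend : ∀ d X Y → distance X Y ℕ.< d → Bounds X Y → ∃ (Cube C a b c)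
        descend (suc d) X Y (s≤s bound) bounds
          with any? (λ p → ((p <? a) ⊎-dec (c <? p)) ×-dec ¬? (lookup X p ≟ᵇ lookup Y p))
        ... | yes (p , out , X≢Y) = through (wide p out)
          where
          open Bounds bounds
          p≢a : p ≢ a
          p≢a refl = X≢Y (≡-from-∌ X∌a Y∌a)
          p≢c : p ≢ c
          p≢c refl = X≢Y (≡-from-∌ X∌c Y∌c)
          p-data-from : p < a ⊎ c < p → X ∋ p × Y ∌ p × (∀ Z → Z ∋ p → Crossed a c Z p) × (∀ Z → Z ∌ p → Uncrossed a c Z p)
          p-data-from (inj₁ p<a) with ∋? X p | ∋? Y p
          ... | inj₁ h | inj₂ k = h , k , (λ _ → left p<a) , (λ _ → left p<a)
          ... | inj₁ h | inj₁ k = ⊥-elim (X≢Y (trans (on h) (sym (on k))))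
          ... | inj₂ h | inj₂ k = ⊥-elim (X≢Y (trans (off h) (sym (off k))))
          ... | inj₂ h | inj₁ k = ⊥-elim (comparable faceX faceY (b-crossed X∌b) (b-uncrossed Y∋b) (left p<a k) (left p<a h))
          p-data-from (inj₂ c<p) with ∋? X p | ∋? Y p
          ... | inj₁ h | inj₂ k = h , k , (λ _ → right c<p) , (λ _ → right c<p)
          ... | inj₁ h | inj₁ k = ⊥-elim (X≢Y (trans (on h) (sym (on k))))
          ... | inj₂ h | inj₂ k = ⊥-elim (X≢Y (trans (off h) (sym (off k))))
          ... | inj₂ h | inj₁ k = ⊥-elim (comparable faceX faceY (b-crossed X∌b) (b-uncrossed Y∋b) (right c<p k) (right c<p h))

          p-data = p-data-from out

          X∋p = proj₁ p-data
          Y∌p = proj₁ (proj₂ p-data)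
          crossed = proj₁ (proj₂ (proj₂ p-data))
          uncrossed = proj₂ (proj₂ (proj₂ p-data))

          through : (∃ λ Z → ∀ v → Face C a c (Z [ p ]≔ v)) → ∃ (Cube C a b c)
          -- `W false` and `W true` differ only at `p`. If they have not crossed `b`, the one with
          -- `p` replaces `Y`; if they have, the one without `p` replaces `X`. Comparability of
          -- faces preserves all agreements, and `p` becomes a new one.
          through (Z , faceZ) = split (∋? Z b)
            where
            W : Bool → Subset n
            W v = normalise (Z [ p ]≔ v)
            faceW : ∀ v → Face C a c (W v)
            faceW v = Face-resp {Z [ p ]≔ v} {W v} (set₂-off false false (Z [ p ]≔ v)) (faceZ v)
            W∌a : ∀ v → W v ∌ a
            W∌a v = ∌! (set₂-fst false false (Z [ p ]≔ v) (<⇒≢ a<c))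
            W∌c : ∀ v → W v ∌ c
            W∌c v = ∌! (set₂-snd {x = a} false false (Z [ p ]≔ v))
            W-p : ∀ v → lookup (W v) p ≡ v
            W-p v = trans (set₂-off false false (Z [ p ]≔ v) p p≢a p≢c) (lookup∘update p Z v)
            b≢p : b ≢ p
            b≢p refl = on-side out
              where
              on-side : b < a ⊎ c < b → ⊥
              on-side (inj₁ b<a) = <-asym a<b b<a
              on-side (inj₂ c<b) = <-asym c<b b<c
            W-b : ∀ v → lookup (W v) b ≡ lookup Z b
            W-b v = trans (set₂-off false false (Z [ p ]≔ v) b b≢a b≢c) (lookup∘update′ b≢p Z v)

            split : Z ∋ b ⊎ Z ∌ b → ∃ (Cube C a b c)
            split (inj₁ Zb) = descend d X (W true)
              (ℕ.<-≤-trans (distance-< X Y X (W true) agree p (differ X∋p Y∌p) (trans (on X∋p) (sym (W-p true)))) bound)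
              record { X∌a = X∌a ; X∌c = X∌c ; Y∌a = W∌a true ; Y∌c = W∌c true ; X∌b = X∌b ; Y∋b = Wb
                     ; faceX = faceX ; faceY = faceW true }
              where
              Wb : W true ∋ b
              Wb = ∋-resp (W-b true) Zb
              agree : ∀ q → lookup X q ≡ lookup Y q → lookup X q ≡ lookup (W true) q
              agree q e with q ≟ a | q ≟ c
              ... | yes refl | _ = ≡-from-∌ X∌a (W∌a true)
              ... | no _ | yes refl = ≡-from-∌ X∌c (W∌c true)
              ... | no q≢a | no q≢c = ≡-from-crossed q q≢a q≢c
                (λ Xq Wq → comparable (faceW true) faceY (crossed _ (∋! (W-p true))) (uncrossed _ Y∌p)
                             (Crossed-resp (sym e) Xq) Wq)
                (λ Wq Xq → comparable faceX (faceW true) (b-crossed X∌b) (b-uncrossed Wb) Wq Xq)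
            split (inj₂ Zb) = descend d (W false) Y
              (ℕ.<-≤-trans (distance-< X Y (W false) Y agree p (differ X∋p Y∌p) (trans (W-p false) (sym (off Y∌p)))) bound)
              record { X∌a = W∌a false ; X∌c = W∌c false ; Y∌a = Y∌a ; Y∌c = Y∌c ; X∌b = Wb ; Y∋b = Y∋b
                     ; faceX = faceW false ; faceY = faceY }
              where
              Wb : W false ∌ b
              Wb = ∌-resp (W-b false) Zb
              agree : ∀ q → lookup X q ≡ lookup Y q → lookup (W false) q ≡ lookup Y q
              agree q e with q ≟ a | q ≟ c
              ... | yes refl | _ = ≡-from-∌ (W∌a false) Y∌a
              ... | no _ | yes refl = ≡-from-∌ (W∌c false) Y∌c
              ... | no q≢a | no q≢c = ≡-from-crossed q q≢a q≢c
                (λ Wq Yq → comparable faceX (faceW false) (crossed _ X∋p) (uncrossed _ (∌! (W-p false)))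
                             Wq (Uncrossed-resp e Yq))
                (λ Yq Wq → comparable (faceW false) faceY (b-crossed Wb) (b-uncrossed Y∋b) Yq Wq)
        ... | no same = finish (exchange C? (b , Y∋b , X∌b))
          where
          open Bounds bounds
          same′ : ∀ p → p < a ⊎ c < p → lookup X p ≡ lookup Y p
          same′ p out with lookup X p ≟ᵇ lookup Y p
          ... | yes e = e
          ... | no ne = ⊥-elim (same (p , out , ne))

          in-between : ∀ p → p ≢ a → p ≢ c → ¬ (p < a ⊎ c < p) → a < p × p < c
          in-between p p≢a p≢c h with <-cmp a p | <-cmp p c
          ... | tri< l _ _ | tri< r _ _ = l , r
          ... | tri≈ _ e _ | _ = ⊥-elim (p≢a (sym e))
          ... | tri> _ _ g | _ = ⊥-elim (h (inj₁ g))
          ... | tri< _ _ _ | tri≈ _ e _ = ⊥-elim (p≢c e)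
          ... | tri< _ _ _ | tri> _ _ g = ⊥-elim (h (inj₂ g))

          X⊆Y : ∀ p → X ∋ p → Y ∋ p
          X⊆Y p Xp with ∋? Y p
          ... | inj₁ h = h
          ... | inj₂ k with in-between p (λ { refl → ∋∌-absurd Xp X∌a }) (λ { refl → ∋∌-absurd Xp X∌c })
                                       (λ out → differ Xp k (same′ p out))
          ... | a<p , p<c = ⊥-elim (comparable faceX faceY (b-crossed X∌b) (b-uncrossed Y∋b)
                                       (inside a<p p<c k) (inside a<p p<c Xp))

          Δ-between : ∀ p → Y ∋ p → X ∌ p → a < p × p < c
          Δ-between p Yp Xp = in-between p (λ { refl → ∋∌-absurd Yp Y∌a }) (λ { refl → ∋∌-absurd Yp Y∌c })
                                       (λ out → differ′ Xp Yp (same′ p out))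

          open Exchange C sep a c a<c X Y X∌a X∌c Y∌a Y∌c X⊆Y Δ-between faceX faceY maximal using (exchange; Δ)

          finish : (∃ λ y → Δ y × Face C a c (X [ y ]≔ true)) → ∃ (Cube C a b c)
          finish (y , (Yy , Xy) , face) with y ≟ b
          ... | yes refl = X , cube
            where
            cube : Cube C a b c X
            cube V agree with lookup V b in Vb
            ... | true = face V λ p p≢a p≢c → pointwise p p≢a p≢c
              where
              pointwise : Agree₂ a c V (X [ b ]≔ true)
              pointwise p p≢a p≢c with p ≟ b
              ... | yes refl = trans Vb (sym (lookup∘update b X true))
              ... | no p≢b = trans (agree p p≢a p≢b p≢c) (sym (lookup∘update′ p≢b X true))
            ... | false = faceX V pointwise
              where
              pointwise : Agree₂ a c V X
              pointwise p p≢a p≢c with p ≟ b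
              ... | yes refl = trans Vb (sym (off X∌b))
              ... | no p≢b = agree p p≢a p≢b p≢c
          ... | no y≢b = descend d (X [ y ]≔ true) Y
              (ℕ.<-≤-trans (distance-< X Y (X [ y ]≔ true) Y agree y (differ′ Xy Yy)
                (trans (lookup∘update y X true) (sym (on Yy)))) bound)
              record { X∌a = ∌-resp (lookup∘update′ (λ { refl → ∋∌-absurd Yy Y∌a }) X true) X∌a
                     ; X∌c = ∌-resp (lookup∘update′ (λ { refl → ∋∌-absurd Yy Y∌c }) X true) X∌c
                     ; Y∌a = Y∌a ; Y∌c = Y∌c
                     ; X∌b = ∌-resp (lookup∘update′ (λ e → y≢b (sym e)) X true) X∌b ; Y∋b = Y∋b
                     ; faceX = face ; faceY = faceY }
            where
            agree : ∀ q → lookup X q ≡ lookup Y q → lookup (X [ y ]≔ true) q ≡ lookup Y q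
            agree q e with q ≟ y
            ... | yes refl = trans (lookup∘update y X true) (sym (on Yy))
            ... | no q≢y = trans (lookup∘update′ q≢y X true) e

        cube : ∃ (Cube C a b c)
        cube = descend (suc (distance outside between)) outside between ℕ.≤-refl record
          { X∌a = outside∌ (<-irrefl refl) (<-asym a<c) ; X∌c = outside∌ (<-asym a<c) (<-irrefl refl)
          ; Y∌a = between∌ (λ (l , _) → <-irrefl refl l) ; Y∌c = between∌ (λ (_ , r) → <-irrefl refl r)
          ; X∌b = outside∌ (<-asym a<b) (<-asym b<c) ; Y∋b = between∋ a<b b<c
          ; faceX = face-outside ; faceY = face-between }

    -- Induction from wide to narrow intervals [a, c]. The fuel `k` bounds how much the width can
    -- still grow; at 0 the width would have to reach `n`.
    cubes : ∀ {a b c} → a < b → b < c → ∃ (Cube C a b c)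
    cubes {a} {b} {c} = go n a b c (ℕ.m≤n+m n _)
      where
      go : ∀ k a b c → n ℕ.≤ toℕ c ℕ.∸ toℕ a ℕ.+ k → a < b → b < c → ∃ (Cube C a b c)
      go zero a b c bound a<b b<c = ⊥-elim (ℕ.<⇒≱ (ℕ.≤-<-trans (ℕ.m∸n≤m (toℕ c) (toℕ a)) (toℕ<n c))
        (subst (n ℕ.≤_) (ℕ.+-identityʳ _) bound))
      go (suc k) a b c bound a<b b<c = Descent.cube (<-trans a<b b<c) wide a<b b<c
        where
        wider : ∀ {w} → toℕ c ℕ.∸ toℕ a ℕ.< w → n ℕ.≤ w ℕ.+ k
        wider h = ℕ.≤-trans bound (ℕ.≤-trans (ℕ.≤-reflexive (ℕ.+-suc _ k)) (ℕ.+-monoˡ-≤ k h))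
        a<c = <-trans a<b b<c
        wide : Wide a<c
        wide p (inj₁ p<a) with go k p a c (wider (ℕ.∸-monoʳ-< p<a (ℕ.<⇒≤ a<c))) p<a a<c
        ... | Z , cube = Z , λ v V agree → cube V λ q q≢p q≢a q≢c → trans (agree q q≢a q≢c) (lookup∘update′ q≢p Z v)
        wide p (inj₂ c<p) with go k a c p (wider (ℕ.∸-monoˡ-< c<p (ℕ.<⇒≤ a<c))) a<c c<p
        ... | Z , cube = Z , λ v V agree → cube V λ q q≢a q≢c q≢p → trans (agree q q≢a q≢c) (lookup∘update′ q≢p Z v)

-- Ranking of cubes

data Letter : Set where
  0# *# 1# : Letter

starred : Letter → Bool
starred *# = true
starred _  = false

digit : Bool → Letter → ℕ
digit _ *# = 1
digit false 0# = 0
digit false 1# = 2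
digit true 0# = 2
digit true 1# = 0

digit≤2 : ∀ b l → digit b l ℕ.≤ 2
digit≤2 true  0# = ℕ.≤-refl
digit≤2 false 0# = z≤n
digit≤2 true  *# = s≤s z≤n
digit≤2 false *# = s≤s z≤n
digit≤2 true  1# = z≤n
digit≤2 false 1# = ℕ.≤-refl

digit-injective : ∀ b l m → digit b l ≡ digit b m → l ≡ m
digit-injective true  0# 0# _ = refl
digit-injective false 0# 0# _ = refl
digit-injective true  0# *# ()
digit-injective false 0# *# ()
digit-injective true  0# 1# ()
digit-injective false 0# 1# ()
digit-injective true  *# 0# ()
digit-injective false *# 0# ()
digit-injective _     *# *# _ = refl
digit-injective true  *# 1# ()
digit-injective false *# 1# ()
digit-injective true  1# 0# ()
digit-injective false 1# 0# ()
digit-injective true  1# *# ()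
digit-injective false 1# *# ()
digit-injective true  1# 1# _ = refl
digit-injective false 1# 1# _ = refl

parity : (Fin n → Letter) → Bool
parity {zero} f = false
parity {suc n} f = starred (f zero) xor parity (f ∘ suc)

-- Words are compared at the largest position where they differ.  There
-- 0 < * < 1 if an even number of stars lies above, and 1 < * < 0 otherwise.
rank : (Fin n → Letter) → ℕ
rank {zero} f = 0
rank {suc n} f = digit (parity (f ∘ suc)) (f zero) ℕ.+ 3 ℕ.* rank (f ∘ suc)

parityAbove : (Fin n → Letter) → Fin n → Bool
parityAbove f zero = parity (f ∘ suc)
parityAbove f (suc t) = parityAbove (f ∘ suc) t

parity-cong : (f g : Fin n → Letter) → (∀ p → f p ≡ g p) → parity f ≡ parity g
parity-cong {zero} f g h = refl
parity-cong {suc n} f g h = cong₂ _xor_ (cong starred (h zero)) (parity-cong (f ∘ suc) (g ∘ suc) (h ∘ suc))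

rank-cong : (f g : Fin n → Letter) → (∀ p → f p ≡ g p) → rank f ≡ rank g
rank-cong {zero} f g h = refl
rank-cong {suc n} f g h = cong₂ ℕ._+_
  (cong₂ digit (parity-cong (f ∘ suc) (g ∘ suc) (h ∘ suc)) (h zero))
  (cong (3 ℕ.*_) (rank-cong (f ∘ suc) (g ∘ suc) (h ∘ suc)))

parityAbove-cong : (f g : Fin n → Letter) (t : Fin n) → (∀ p → t < p → f p ≡ g p) → parityAbove f t ≡ parityAbove g t
parityAbove-cong f g zero h = parity-cong (f ∘ suc) (g ∘ suc) λ p → h (suc p) (s≤s z≤n)
parityAbove-cong f g (suc t) h = parityAbove-cong (f ∘ suc) (g ∘ suc) t λ p t<p → h (suc p) (s≤s t<p)

rank≤⇒ : (f g : Fin n → Letter) → rank f ℕ.≤ rank g →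
  (∀ p → f p ≡ g p) ⊎
  ∃ λ t → (∀ p → t < p → f p ≡ g p) × digit (parityAbove f t) (f t) ℕ.< digit (parityAbove f t) (g t)
rank≤⇒ {zero} f g _ = inj₁ λ ()
rank≤⇒ {suc n} f g le with rank≤⇒ (f ∘ suc) (g ∘ suc) tails
  where
  R = rank (f ∘ suc)
  R′ = rank (g ∘ suc)
  tails : R ℕ.≤ R′
  tails with R ℕ.≤? R′
  ... | yes h = h
  ... | no h = ⊥-elim (ℕ.<⇒≱ (ℕ.<-≤-trans smaller (ℕ.m≤n+m (3 ℕ.* R) (digit (parity (f ∘ suc)) (f zero)))) le)
    where
    open ℕ.≤-Reasoning
    -- A digit is at most 2 and so cannot make up for a deficit in the tail, whose weight is 3.
    smaller : digit (parity (g ∘ suc)) (g zero) ℕ.+ 3 ℕ.* R′ ℕ.< 3 ℕ.* R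
    smaller = begin-strict
      digit (parity (g ∘ suc)) (g zero) ℕ.+ 3 ℕ.* R′ <⟨ ℕ.+-monoˡ-< (3 ℕ.* R′) (s≤s (digit≤2 (parity (g ∘ suc)) (g zero))) ⟩
      3 ℕ.+ 3 ℕ.* R′                                 ≡⟨ ℕ.*-suc 3 R′ ⟨
      3 ℕ.* suc R′                                   ≤⟨ ℕ.*-monoʳ-≤ 3 (ℕ.≰⇒> h) ⟩
      3 ℕ.* R                                        ∎
... | inj₂ (t , above , less) = inj₂ (suc t , (λ { (suc p) (s≤s t<p) → above p t<p }) , less)
... | inj₁ same with ℕ.m≤n⇒m<n∨m≡n heads
  where
  heads : digit (parity (f ∘ suc)) (f zero) ℕ.≤ digit (parity (f ∘ suc)) (g zero)
  heads = ℕ.+-cancelʳ-≤ (3 ℕ.* rank (f ∘ suc)) _ _ (subst (rank f ℕ.≤_)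
    (cong₂ ℕ._+_ (cong (λ b → digit b (g zero)) (sym (parity-cong (f ∘ suc) (g ∘ suc) same)))
                 (cong (3 ℕ.*_) (sym (rank-cong (f ∘ suc) (g ∘ suc) same)))) le)
... | inj₁ less = inj₂ (zero , (λ { (suc p) _ → same p }) , less)
... | inj₂ eq = inj₁ λ { zero → digit-injective (parity (f ∘ suc)) _ _ eq ; (suc p) → same p }

not-starred-parity : (f : Fin n → Letter) → (∀ p → starred (f p) ≡ false) → parity f ≡ false
not-starred-parity {zero} f h = refl
not-starred-parity {suc n} f h = cong₂ _xor_ (h zero) (not-starred-parity (f ∘ suc) (h ∘ suc))

parityAbove-none : (f : Fin n → Letter) (t : Fin n) → (∀ p → t < p → starred (f p) ≡ false) →
  parityAbove f t ≡ false
parityAbove-none f zero h = not-starred-parity (f ∘ suc) λ p → h (suc p) (s≤s z≤n)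
parityAbove-none f (suc t) h = parityAbove-none (f ∘ suc) t λ p t<p → h (suc p) (s≤s t<p)

parity-first : (f : Fin n → Letter) (c : Fin n) → starred (f c) ≡ true →
  (∀ p → p < c → starred (f p) ≡ false) → parity f ≡ not (parityAbove f c)
parity-first f zero s h = cong (_xor parity (f ∘ suc)) s
parity-first f (suc c) s h = trans (cong (_xor parity (f ∘ suc)) (h zero (s≤s z≤n)))
  (parity-first (f ∘ suc) c s λ p p<c → h (suc p) (s≤s p<c))

parityAbove-next : (f : Fin n → Letter) (t c : Fin n) → t < c → starred (f c) ≡ true →
  (∀ p → t < p → p < c → starred (f p) ≡ false) → parityAbove f t ≡ not (parityAbove f c)
parityAbove-next f zero (suc c) _ s h = parity-first (f ∘ suc) c s λ p p<c → h (suc p) (s≤s z≤n) (s≤s p<c)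
parityAbove-next f (suc t) (suc c) (s≤s t<c) s h =
  parityAbove-next (f ∘ suc) t c t<c s λ p t<p p<c → h (suc p) (s≤s t<p) (s≤s p<c)

One₃ : (i j k p : Fin n) → Set
One₃ i j k p = p ≡ i ⊎ p ≡ j ⊎ p ≡ k

one₃? : ∀ (i j k p : Fin n) → Dec (One₃ i j k p)
one₃? i j k p = (p ≟ i) ⊎-dec ((p ≟ j) ⊎-dec (p ≟ k))

letter : Bool → Letter
letter true  = 1#
letter false = 0#

word : (i j k : Fin n) → Subset n → Fin n → Letter
word i j k X p with one₃? i j k p
... | yes _ = *#
... | no _  = letter (lookup X p)

module _ {i j k : Fin n} {X : Subset n} where

  data WordView (p : Fin n) : Letter → Set where
    star : One₃ i j k p → WordView p *#
    one  : ¬ One₃ i j k p → X ∋ p → WordView p 1#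
    zero : ¬ One₃ i j k p → X ∌ p → WordView p 0#

  wordView : ∀ p → WordView p (word i j k X p)
  wordView p with one₃? i j k p
  ... | yes h = star h
  ... | no h with lookup X p in e
  ... | true  = one h (∋! e)
  ... | false = zero h (∌! e)

  word-star : ∀ {p} → One₃ i j k p → word i j k X p ≡ *#
  word-star {p} h with one₃? i j k p
  ... | yes _ = refl
  ... | no h′ = ⊥-elim (h′ h)

  word-plain : ∀ {p} → ¬ One₃ i j k p → starred (word i j k X p) ≡ false
  word-plain {p} h with one₃? i j k p
  ... | yes h′ = ⊥-elim (h h′)
  ... | no _ with lookup X p
  ... | true  = refl
  ... | false = refl

  agree-update : ∀ w t b → Agree₃ i j k w X → (¬ One₃ i j k t → lookup X t ≡ b) → Agree₃ i j k (w [ t ]≔ b) X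
  agree-update w t b agree h p p≢i p≢j p≢k with p ≟ t
  ... | yes refl = trans (lookup∘update t w b) (sym (h λ { (inj₁ e) → p≢i e ; (inj₂ (inj₁ e)) → p≢j e ; (inj₂ (inj₂ e)) → p≢k e }))
  ... | no p≢t = trans (lookup∘update′ p≢t w b) (agree p p≢i p≢j p≢k)

set₃ : (i j k : Fin n) (a b c : Bool) → Subset n → Subset n
set₃ i j k a b c X = set₂ i j a b X [ k ]≔ c

module _ {i j k : Fin n} (i≢j : i ≢ j) (i≢k : i ≢ k) (j≢k : j ≢ k) (a b c : Bool) (X : Subset n) where
  set₃-off : Agree₃ i j k (set₃ i j k a b c X) X
  set₃-off p p≢i p≢j p≢k = trans (lookup∘update′ p≢k (set₂ i j a b X) c) (set₂-off a b X p p≢i p≢j)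
  set₃-fst : lookup (set₃ i j k a b c X) i ≡ a
  set₃-fst = trans (lookup∘update′ i≢k (set₂ i j a b X) c) (set₂-fst a b X i≢j)
  set₃-snd : lookup (set₃ i j k a b c X) j ≡ b
  set₃-snd = trans (lookup∘update′ j≢k (set₂ i j a b X) c) (set₂-snd {x = i} a b X)
  set₃-trd : lookup (set₃ i j k a b c X) k ≡ c
  set₃-trd = lookup∘update k (set₂ i j a b X) c

one₃-increasing : ∀ {i j k a b c : Fin n} → i < j → j < k → a < b → b < c →
  One₃ i j k a → One₃ i j k b → One₃ i j k c → a ≡ i × b ≡ j × c ≡ k
one₃-increasing ij jk ab bc (inj₁ refl) (inj₂ (inj₁ refl)) (inj₂ (inj₂ refl)) = refl , refl , refl
one₃-increasing ij jk ab bc (inj₁ refl) (inj₁ refl) _ = ⊥-elim (<-irrefl refl ab)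
one₃-increasing ij jk ab bc (inj₁ refl) (inj₂ (inj₁ refl)) (inj₁ refl) = ⊥-elim (<-asym ij bc)
one₃-increasing ij jk ab bc (inj₁ refl) (inj₂ (inj₁ refl)) (inj₂ (inj₁ refl)) = ⊥-elim (<-irrefl refl bc)
one₃-increasing ij jk ab bc (inj₁ refl) (inj₂ (inj₂ refl)) (inj₁ refl) = ⊥-elim (<-asym ab bc)
one₃-increasing ij jk ab bc (inj₁ refl) (inj₂ (inj₂ refl)) (inj₂ (inj₁ refl)) = ⊥-elim (<-asym jk bc)
one₃-increasing ij jk ab bc (inj₁ refl) (inj₂ (inj₂ refl)) (inj₂ (inj₂ refl)) = ⊥-elim (<-irrefl refl bc)
one₃-increasing ij jk ab bc (inj₂ (inj₁ refl)) (inj₁ refl) _ = ⊥-elim (<-asym ij ab)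
one₃-increasing ij jk ab bc (inj₂ (inj₁ refl)) (inj₂ (inj₁ refl)) _ = ⊥-elim (<-irrefl refl ab)
one₃-increasing ij jk ab bc (inj₂ (inj₁ refl)) (inj₂ (inj₂ refl)) (inj₁ refl) = ⊥-elim (<-asym (<-trans ij jk) bc)
one₃-increasing ij jk ab bc (inj₂ (inj₁ refl)) (inj₂ (inj₂ refl)) (inj₂ (inj₁ refl)) = ⊥-elim (<-asym jk bc)
one₃-increasing ij jk ab bc (inj₂ (inj₁ refl)) (inj₂ (inj₂ refl)) (inj₂ (inj₂ refl)) = ⊥-elim (<-irrefl refl bc)
one₃-increasing ij jk ab bc (inj₂ (inj₂ refl)) (inj₁ refl) _ = ⊥-elim (<-asym (<-trans ij jk) ab)
one₃-increasing ij jk ab bc (inj₂ (inj₂ refl)) (inj₂ (inj₁ refl)) _ = ⊥-elim (<-asym jk ab)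
one₃-increasing ij jk ab bc (inj₂ (inj₂ refl)) (inj₂ (inj₂ refl)) _ = ⊥-elim (<-irrefl refl ab)

module _ {C : Subset n → Set} (sep : ∀ {A B} → C A → C B → ¬ Alternate A B)
  {i j k : Fin n} (i<j : i < j) (j<k : j < k) {X : Subset n} (cubeX : Cube C i j k X)
  {a b c : Fin n} (a<b : a < b) (b<c : b < c) {Y : Subset n} (cubeY : Cube C a b c Y) where

  private
    f g : Fin n → Letter
    f = word i j k X
    g = word a b c Y

    a<c : a < c
    a<c = <-trans a<b b<c

    plain : ∀ {p} → p ≢ a → p ≢ b → p ≢ c → ¬ One₃ a b c p
    plain p≢a p≢b p≢c (inj₁ e) = p≢a e
    plain p≢a p≢b p≢c (inj₂ (inj₁ e)) = p≢b e
    plain p≢a p≢b p≢c (inj₂ (inj₂ e)) = p≢c e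

    above-c : ∀ p → c < p → starred (g p) ≡ false
    above-c p c<p = word-plain {X = Y} (plain (>⇒≢ (<-trans a<c c<p)) (>⇒≢ (<-trans b<c c<p)) (>⇒≢ c<p))

    parity-above-c : ∀ t → (∀ p → t < p → c < p) → parityAbove g t ≡ false
    parity-above-c t h = parityAbove-none g t λ p t<p → above-c p (h p t<p)

    parity-c : parityAbove g c ≡ false
    parity-c = parity-above-c c λ p c<p → c<p

    starred-at : ∀ {p} → One₃ a b c p → starred (g p) ≡ true
    starred-at h = cong starred (word-star {X = Y} h)

    parity-b-c : ∀ t → (∀ p → t < p → b < p) → t < c → parityAbove g t ≡ true
    parity-b-c t h t<c = trans (parityAbove-next g t c t<c (starred-at (inj₂ (inj₂ refl)))
        λ p t<p p<c → word-plain {X = Y} (plain (>⇒≢ (<-trans a<b (h p t<p))) (>⇒≢ (h p t<p)) (<⇒≢ p<c)))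
      (cong not parity-c)

    parity-b : parityAbove g b ≡ true
    parity-b = parity-b-c b (λ p b<p → b<p) b<c

    parity-a-b : ∀ t → (∀ p → t < p → a < p) → t < b → parityAbove g t ≡ false
    parity-a-b t h t<b = trans (parityAbove-next g t b t<b (starred-at (inj₂ (inj₁ refl)))
        λ p t<p p<b → word-plain {X = Y} (plain (>⇒≢ (h p t<p)) (<⇒≢ p<b) (<⇒≢ (<-trans p<b b<c))))
      (cong not parity-b)

    is-star : ∀ {p} → f p ≡ g p → One₃ a b c p → One₃ i j k p
    is-star {p} e h with f p | wordView {i = i} {j} {k} {X} p | trans e (word-star {X = Y} h)
    ... | *# | star s | _ = s

    module _ {w : Subset n} (agree : Agree₃ i j k w X) (wa : w ∋ a) (wb : w ∌ b) (wc : w ∋ c) where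

      agree-∋ : ∀ {p} → ¬ One₃ i j k p → X ∋ p → w ∋ p
      agree-∋ h (∋! Xp) = ∋! (trans (agree _ (h ∘ inj₁) (h ∘ inj₂ ∘ inj₁) (h ∘ inj₂ ∘ inj₂)) Xp)

      agree-∌ : ∀ {p} → ¬ One₃ i j k p → X ∌ p → w ∌ p
      agree-∌ h (∌! Xp) = ∌! (trans (agree _ (h ∘ inj₁) (h ∘ inj₂ ∘ inj₁) (h ∘ inj₂ ∘ inj₂)) Xp)

      low : ∀ t → ¬ One₃ a b c t → digit false (f t) ℕ.< digit false (g t) → Y ∋ t × (¬ One₃ i j k t → X ∌ t)
      low t h less with f t | wordView {i = i} {j} {k} {X} t | g t | wordView {i = a} {b} {c} {Y} t
      ... | _ | _ | *# | star s = ⊥-elim (h s)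
      ... | 0# | zero _ x | 1# | one _ y = y , λ _ → x
      ... | *# | star s | 1# | one _ y = y , λ ns → ⊥-elim (ns s)
      low t h (s≤s (s≤s ())) | 1# | one _ _ | 1# | one _ _
      low t h () | _ | _ | 0# | zero _ _

      high : ∀ t → ¬ One₃ a b c t → digit true (f t) ℕ.< digit true (g t) → Y ∌ t × (¬ One₃ i j k t → X ∋ t)
      high t h less with f t | wordView {i = i} {j} {k} {X} t | g t | wordView {i = a} {b} {c} {Y} t
      ... | _ | _ | *# | star s = ⊥-elim (h s)
      ... | 1# | one _ x | 0# | zero _ y = y , λ _ → x
      ... | *# | star s | 0# | zero _ y = y , λ ns → ⊥-elim (ns s)
      high t h (s≤s (s≤s ())) | 0# | zero _ _ | 0# | zero _ _
      high t h () | _ | _ | 1# | one _ _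

      low-star : ∀ t → One₃ a b c t → digit false (f t) ℕ.< digit false (g t) → w ∋ t → ⊥
      low-star t h less wt with f t | wordView {i = i} {j} {k} {X} t | g t | word-star {X = Y} h
      ... | 0# | zero ns x | *# | refl = ∋∌-absurd wt (agree-∌ ns x)
      low-star t h (s≤s ()) wt | *# | star _ | *# | refl
      low-star t h (s≤s ()) wt | 1# | one _ _ | *# | refl

      high-star : ∀ t → One₃ a b c t → digit true (f t) ℕ.< digit true (g t) → w ∌ t → ⊥
      high-star t h less wt with f t | wordView {i = i} {j} {k} {X} t | g t | word-star {X = Y} h
      ... | 1# | one ns x | *# | refl = ∋∌-absurd (agree-∋ ns x) wt
      high-star t h (s≤s ()) wt | *# | star _ | *# | refl
      high-star t h (s≤s ()) wt | 0# | zero _ _ | *# | refl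

      y : (β₁ β₂ β₃ : Bool) → Subset n
      y β₁ β₂ β₃ = set₃ a b c β₁ β₂ β₃ Y

      module _ (β₁ β₂ β₃ : Bool) where
        private
          a≢b = <⇒≢ a<b
          a≢c = <⇒≢ a<c
          b≢c = <⇒≢ b<c
        y∈C : C (y β₁ β₂ β₃)
        y∈C = cubeY _ (set₃-off a≢b a≢c b≢c β₁ β₂ β₃ Y)
        ya : lookup (y β₁ β₂ β₃) a ≡ β₁
        ya = set₃-fst a≢b a≢c b≢c β₁ β₂ β₃ Y
        yb : lookup (y β₁ β₂ β₃) b ≡ β₂
        yb = set₃-snd a≢b a≢c b≢c β₁ β₂ β₃ Y
        yc : lookup (y β₁ β₂ β₃) c ≡ β₃
        yc = set₃-trd a≢b a≢c b≢c β₁ β₂ β₃ Y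
        yt : ∀ {t} → t ≢ a → t ≢ b → t ≢ c → lookup (y β₁ β₂ β₃) t ≡ lookup Y t
        yt {t} = set₃-off a≢b a≢c b≢c β₁ β₂ β₃ Y t

      upd∋ : ∀ {A : Subset n} {p t v} → p ≢ t → A ∋ p → (A [ t ]≔ v) ∋ p
      upd∋ {A} {v = v} p≢t (∋! h) = ∋! (trans (lookup∘update′ p≢t A v) h)

      upd∌ : ∀ {A : Subset n} {p t v} → p ≢ t → A ∌ p → (A [ t ]≔ v) ∌ p
      upd∌ {A} {v = v} p≢t (∌! h) = ∌! (trans (lookup∘update′ p≢t A v) h)

      upd-on : ∀ {A : Subset n} {t} → (A [ t ]≔ true) ∋ t
      upd-on {A} {t} = ∋! (lookup∘update t A true)

      upd-off : ∀ {A : Subset n} {t} → (A [ t ]≔ false) ∌ t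
      upd-off {A} {t} = ∌! (lookup∘update t A false)

      star-agree : ∀ (A : Subset n) t v → Agree₃ i j k A X → One₃ i j k t → Agree₃ i j k (A [ t ]≔ v) X
      star-agree A t v ag s = agree-update {X = X} A t v ag λ ns → ⊥-elim (ns s)

      -- Directions of the cube of `X` can be set at will. Here and in the next two lemmas `w` is
      -- changed at `t`, and at those of `b` and `c` known to be such directions, until it
      -- alternates with a vertex of the cube of `Y` at `t` and the three elements `a`, `b`, `c`.
      beyond-c : ∀ t → c < t → Y ∋ t → (¬ One₃ i j k t → X ∌ t) → ⊥
      beyond-c t c<t Yt h = sep (cubeX (w [ t ]≔ false) (agree-update {X = X} w t false agree λ ns → off (h ns))) (y∈C false true false)
        (alternate a<b b<c c<t (upd∋ (<⇒≢ a<t) wa) (∌! (ya _ _ _)) (upd∌ (<⇒≢ b<t) wb) (∋! (yb _ _ _))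
          (upd∋ (<⇒≢ c<t) wc) (∌! (yc _ _ _)) (upd-off {A = w})
          (∋! (trans (yt _ _ _ (>⇒≢ a<t) (>⇒≢ b<t) (>⇒≢ c<t)) (on Yt))))
        where
        a<t = <-trans a<c c<t
        b<t = <-trans b<c c<t

      in-b-c : ∀ t → b < t → t < c → Y ∌ t → (¬ One₃ i j k t → X ∋ t) → One₃ i j k c → ⊥
      in-b-c t b<t t<c Yt h sc = sep
        (cubeX ((w [ t ]≔ true) [ c ]≔ false) (star-agree (w [ t ]≔ true) c false (agree-update {X = X} w t true agree λ ns → on (h ns)) sc)) (y∈C false true true)
        (alternate a<b b<t t<c (upd∋ (<⇒≢ a<c) (upd∋ (<⇒≢ a<t) wa)) (∌! (ya _ _ _))
          (upd∌ (<⇒≢ b<c) (upd∌ (<⇒≢ b<t) wb)) (∋! (yb _ _ _))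
          (upd∋ (<⇒≢ t<c) (upd-on {A = w})) (∌! (trans (yt _ _ _ (>⇒≢ a<t) (>⇒≢ b<t) (<⇒≢ t<c)) (off Yt)))
          (upd-off {A = w [ t ]≔ true}) (∋! (yc _ _ _)))
        where a<t = <-trans a<b b<t

      in-a-b : ∀ t → a < t → t < b → Y ∋ t → (¬ One₃ i j k t → X ∌ t) → One₃ i j k b → One₃ i j k c → ⊥
      in-a-b t a<t t<b Yt h sb sc = sep
        (cubeX (((w [ t ]≔ false) [ b ]≔ true) [ c ]≔ false)
          (star-agree ((w [ t ]≔ false) [ b ]≔ true) c false
            (star-agree (w [ t ]≔ false) b true (agree-update {X = X} w t false agree λ ns → off (h ns)) sb) sc)) (y∈C false false true)
        (alternate a<t t<b b<c (upd∋ (<⇒≢ a<c) (upd∋ (<⇒≢ a<b) (upd∋ (<⇒≢ a<t) wa))) (∌! (ya _ _ _))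
          (upd∌ (<⇒≢ (<-trans t<b b<c)) (upd∌ (<⇒≢ t<b) (upd-off {A = w})))
          (∋! (trans (yt _ _ _ (>⇒≢ a<t) (<⇒≢ t<b) (<⇒≢ (<-trans t<b b<c))) (on Yt)))
          (upd∋ (<⇒≢ b<c) (upd-on {A = w [ t ]≔ false})) (∌! (yb _ _ _))
          (upd-off {A = (w [ t ]≔ false) [ b ]≔ true}) (∋! (yc _ _ _)))

      -- The parity of the stars above `t` reverses the letters just so that a wrong comparison at
      -- `t` yields the fourth point of an alternation, wherever `t` lies relative to `a`, `b`, `c`.
      -- At one of these three it contradicts the dip of `w`; below `a` the two words share all
      -- three stars.
      contradiction-at : ∀ t → (∀ p → t < p → f p ≡ g p) →
        digit (parityAbove g t) (f t) ℕ.< digit (parityAbove g t) (g t) →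
        ¬ (a ≡ i × b ≡ j × c ≡ k) → ⊥
      contradiction-at t above less differ with <-cmp t c | <-cmp t b | <-cmp t a
      ... | tri> _ _ c<t | _ | _ rewrite parity-above-c t (λ p t<p → <-trans c<t t<p) =
        let (Yt , h) = low t (plain (>⇒≢ (<-trans a<c c<t)) (>⇒≢ (<-trans b<c c<t)) (>⇒≢ c<t)) less in beyond-c t c<t Yt h
      ... | tri≈ _ refl _ | _ | _ rewrite parity-c = low-star t (inj₂ (inj₂ refl)) less wc
      ... | tri< t<c _ _ | tri> _ _ b<t | _ rewrite parity-b-c t (λ p t<p → <-trans b<t t<p) t<c =
        let (Yt , h) = high t (plain (>⇒≢ (<-trans a<b b<t)) (>⇒≢ b<t) (<⇒≢ t<c)) less in
        in-b-c t b<t t<c Yt h (is-star (above c t<c) (inj₂ (inj₂ refl)))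
      ... | tri< _ _ _ | tri≈ _ refl _ | _ rewrite parity-b = high-star t (inj₂ (inj₁ refl)) less wb
      ... | tri< t<c _ _ | tri< t<b _ _ | tri> _ _ a<t rewrite parity-a-b t (λ p t<p → <-trans a<t t<p) t<b =
        let (Yt , h) = low t (plain (>⇒≢ a<t) (<⇒≢ t<b) (<⇒≢ t<c)) less in
        in-a-b t a<t t<b Yt h (is-star (above b t<b) (inj₂ (inj₁ refl))) (is-star (above c t<c) (inj₂ (inj₂ refl)))
      ... | tri< _ _ _ | tri< t<b _ _ | tri≈ _ refl _ rewrite parity-a-b t (λ p a<p → a<p) t<b =
        low-star t (inj₁ refl) less wa
      ... | tri< t<c _ _ | tri< t<b _ _ | tri< t<a _ _ = differ (one₃-increasing i<j j<k a<b b<c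
        (is-star (above a t<a) (inj₁ refl)) (is-star (above b t<b) (inj₂ (inj₁ refl))) (is-star (above c t<c) (inj₂ (inj₂ refl))))

  word-injective : (∀ p → f p ≡ g p) → a ≡ i × b ≡ j × c ≡ k
  word-injective same = one₃-increasing i<j j<k a<b b<c (is-star (same a) (inj₁ refl))
    (is-star (same b) (inj₂ (inj₁ refl))) (is-star (same c) (inj₂ (inj₂ refl)))

  -- This is the acyclicity of the cubes: a dip visible at a vertex of one cube belongs to a cube
  -- that precedes it.
  cubes-rank : ∀ {w} → Agree₃ i j k w X → w ∋ a → w ∌ b → w ∋ c → ¬ (a ≡ i × b ≡ j × c ≡ k) →
    rank g ℕ.< rank f
  cubes-rank {w} agree wa wb wc differ with rank f ℕ.≤? rank g
  ... | no h = ℕ.≰⇒> h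
  ... | yes h with rank≤⇒ f g h
  ... | inj₁ same = ⊥-elim (differ (word-injective same))
  ... | inj₂ (t , above , less) = ⊥-elim (contradiction-at agree wa wb wc t above
    (subst (λ β → digit β (f t) ℕ.< digit β (g t)) (parityAbove-cong f g t above) less) differ)

  -- Ensures that raising a bound on the rank by one admits at most one more triple, hence a single
  -- flip.
  rank-injective : rank f ≡ rank g → a ≡ i × b ≡ j × c ≡ k
  rank-injective e with rank≤⇒ f g (ℕ.≤-reflexive e) | rank≤⇒ g f (ℕ.≤-reflexive (sym e))
  ... | inj₁ same | _ = word-injective same
  ... | inj₂ _ | inj₁ same = word-injective λ p → sym (same p)
  ... | inj₂ (t , above , less) | inj₂ (t′ , above′ , less′) with <-cmp t t′
  ... | tri< l _ _ = ⊥-elim (ℕ.<⇒≢ less′ (cong (digit (parityAbove g t′)) (sym (above t′ l))))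
  ... | tri> _ _ l = ⊥-elim (ℕ.<⇒≢ less (cong (digit (parityAbove f t)) (sym (above′ t l))))
  ... | tri≈ _ refl _ = ⊥-elim (ℕ.<-asym less (subst (λ β → digit β (g t) ℕ.< digit β (f t)) (sym (parityAbove-cong f g t above)) less′))

rank-bound : (f : Fin n → Letter) → rank f ℕ.< 3 ℕ.^ n
rank-bound {zero} f = s≤s z≤n
rank-bound {suc n} f = begin-strict
  digit (parity (f ∘ suc)) (f zero) ℕ.+ 3 ℕ.* rank (f ∘ suc) <⟨ ℕ.+-monoˡ-< _ (s≤s (digit≤2 (parity (f ∘ suc)) (f zero))) ⟩
  3 ℕ.+ 3 ℕ.* rank (f ∘ suc)                                 ≡⟨ ℕ.*-suc 3 (rank (f ∘ suc)) ⟨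
  3 ℕ.* suc (rank (f ∘ suc))                                 ≤⟨ ℕ.*-monoʳ-≤ 3 (rank-bound (f ∘ suc)) ⟩
  3 ℕ.* 3 ℕ.^ n                                              ∎
  where open ℕ.≤-Reasoning

-- Counting triad-free collections

module _ where
  private
    variable
      A B : Subset n

  data Triad (A B : Subset n) : Set where
    triad : ∀ {a b c} → a < b → b < c → A ∋ a → B ∌ a → A ∌ b → B ∋ b → A ∋ c → B ∌ c → Triad A B

  TriadFree : Collection n → Set
  TriadFree F = ∀ {A B} → T (F A) → T (F B) → ¬ Triad A B

  bit : Bool → ℕ
  bit true  = 1
  bit false = 0

  total : (Subset n → ℕ) → ℕ
  total {zero} f = f []
  total {suc n} f = total (f ∘ (false ∷_)) ℕ.+ total (f ∘ (true ∷_))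

  count : Collection n → ℕ
  count F = total (bit ∘ F)

  length-filterᵇ-map : {S T : Set} (p : T → Bool) (g : S → T) (xs : List S) →
    length (filterᵇ p (map g xs)) ≡ length (filterᵇ (p ∘ g) xs)
  length-filterᵇ-map p g [] = refl
  length-filterᵇ-map p g (x ∷ xs) with p (g x)
  ... | true  = cong suc (length-filterᵇ-map p g xs)
  ... | false = length-filterᵇ-map p g xs

  size≡count : (F : Collection n) → size F ≡ count F
  size≡count {zero} F with F []
  ... | true  = refl
  ... | false = refl
  size≡count {suc n} F = trans (cong length (filter-++ (T? ∘ F) (map (false ∷_) (subsets n)) (map (true ∷_) (subsets n))))
    (trans (length-++ (filterᵇ F (map (false ∷_) (subsets n))))
      (cong₂ ℕ._+_ (trans (length-filterᵇ-map F (false ∷_) (subsets n)) (size≡count (F ∘ (false ∷_))))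
                   (trans (length-filterᵇ-map F (true ∷_) (subsets n)) (size≡count (F ∘ (true ∷_))))))

  total-mono : {f g : Subset n → ℕ} → (∀ A → f A ℕ.≤ g A) → total f ℕ.≤ total g
  total-mono {zero} h = h []
  total-mono {suc n} h = ℕ.+-mono-≤ (total-mono λ A → h (false ∷ A)) (total-mono λ A → h (true ∷ A))

  total-+ : (f g : Subset n → ℕ) → total (λ A → f A ℕ.+ g A) ≡ total f ℕ.+ total g
  total-+ {zero} f g = refl
  total-+ {suc n} f g = trans
    (cong₂ ℕ._+_ (total-+ (f ∘ (false ∷_)) (g ∘ (false ∷_))) (total-+ (f ∘ (true ∷_)) (g ∘ (true ∷_))))
    (interchange (total (f ∘ (false ∷_))) (total (g ∘ (false ∷_))) (total (f ∘ (true ∷_))) (total (g ∘ (true ∷_))))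

  total-cong : {f g : Subset n → ℕ} → (∀ A → f A ≡ g A) → total f ≡ total g
  total-cong {zero} h = h []
  total-cong {suc n} h = cong₂ ℕ._+_ (total-cong λ A → h (false ∷ A)) (total-cong λ A → h (true ∷ A))

  total-insertAt : (p : Fin (suc n)) (f : Subset (suc n) → ℕ) →
    total f ≡ total (λ A → f (insertAt A p false) ℕ.+ f (insertAt A p true))
  total-insertAt zero f = sym (total-+ (f ∘ (false ∷_)) (f ∘ (true ∷_)))
  total-insertAt {suc n} (suc p) f = cong₂ ℕ._+_ (total-insertAt p (f ∘ (false ∷_))) (total-insertAt p (f ∘ (true ∷_)))

  _∪[_] _∩[_] : Collection (suc n) → Fin (suc n) → Collection n
  (F ∪[ p ]) A = F (insertAt A p false) ∨ F (insertAt A p true)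
  (F ∩[ p ]) A = F (insertAt A p false) ∧ F (insertAt A p true)

  bit-∨-∧ : ∀ a b → bit a ℕ.+ bit b ≡ bit (a ∨ b) ℕ.+ bit (a ∧ b)
  bit-∨-∧ true true = refl
  bit-∨-∧ true false = refl
  bit-∨-∧ false true = refl
  bit-∨-∧ false false = refl

  count-∪-∩ : (F : Collection (suc n)) (p : Fin (suc n)) → count F ≡ count (F ∪[ p ]) ℕ.+ count (F ∩[ p ])
  count-∪-∩ F p = trans (total-insertAt p (bit ∘ F))
    (trans (total-cong λ A → bit-∨-∧ (F (insertAt A p false)) (F (insertAt A p true)))
           (total-+ (bit ∘ (F ∪[ p ])) (bit ∘ (F ∩[ p ]))))

  ∪-elim : {F : Collection (suc n)} {p : Fin (suc n)} → T ((F ∪[ p ]) A) → ∃ λ b → T (F (insertAt A p b))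
  ∪-elim {A = A} {F} {p} h with Equivalence.to (T-∨ {F (insertAt A p false)}) h
  ... | inj₁ h = false , h
  ... | inj₂ h = true , h

  ∩-elim : {F : Collection (suc n)} {p : Fin (suc n)} → T ((F ∩[ p ]) A) → ∀ b → T (F (insertAt A p b))
  ∩-elim {A = A} {F} {p} h with Equivalence.to (T-∧ {F (insertAt A p false)}) h
  ... | h₀ , h₁ = λ { false → h₀ ; true → h₁ }

  count-positive : (F : Collection n) → 1 ℕ.≤ count F → ∃ λ A → T (F A)
  count-positive {zero} F h with F [] in e
  ... | true = [] , subst T (sym e) tt
  count-positive {suc n} F h with count (F ∘ (false ∷_)) in e
  ... | suc k with count-positive (F ∘ (false ∷_)) (subst (1 ℕ.≤_) (sym e) (s≤s z≤n))
  ...   | A , FA = false ∷ A , FA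
  count-positive {suc n} F h | zero with count-positive (F ∘ (true ∷_)) h
  ...   | A , FA = true ∷ A , FA

  count-unique : (F : Collection n) → (∀ A B → T (F A) → T (F B) → A ≡ B) → count F ℕ.≤ 1
  count-unique {zero} F h with F []
  ... | true  = ℕ.≤-refl
  ... | false = z≤n
  count-unique {suc n} F h with count (F ∘ (true ∷_)) in e
  ... | zero = subst (ℕ._≤ 1) (sym (ℕ.+-identityʳ _))
    (count-unique (F ∘ (false ∷_)) λ A B a b → ∷-inj (h _ _ a b))
    where
    ∷-inj : {a : Bool} {A B : Subset n} → a ∷ A ≡ a ∷ B → A ≡ B
    ∷-inj refl = refl
  ... | suc k with count (F ∘ (false ∷_)) in e′
  ...   | zero = subst (ℕ._≤ 1) e (count-unique (F ∘ (true ∷_)) λ A B a b → ∷-inj (h _ _ a b))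
    where
    ∷-inj : {a : Bool} {A B : Subset n} → a ∷ A ≡ a ∷ B → A ≡ B
    ∷-inj refl = refl
  ...   | suc k′ with count-positive (F ∘ (true ∷_)) (subst (1 ℕ.≤_) (sym e) (s≤s z≤n))
                    | count-positive (F ∘ (false ∷_)) (subst (1 ℕ.≤_) (sym e′) (s≤s z≤n))
  ...     | A , FA | B , FB with () ← h _ _ FA FB

  -- Sets that become a chain after complementing on D.
  Above : (Fin n → Bool) → Subset n → Subset n → Fin n → Set
  Above D X Y x with D x
  ... | false = X ∋ x × Y ∌ x
  ... | true  = X ∌ x × Y ∋ x

  Chain′ : (Fin n → Bool) → Collection n → Set
  Chain′ D G = ∀ {X Y} → T (G X) → T (G Y) → ∀ x y → Above D X Y x → Above D Y X y → ⊥

  Above-false : ∀ {D : Fin n → Bool} {X Y : Subset n} {x} → D x ≡ false → X ∋ x → Y ∌ x → Above D X Y x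
  Above-false {D = D} {x = x} e h k with D x
  Above-false refl h k | false = h , k

  Above-true : ∀ {D : Fin n → Bool} {X Y : Subset n} {x} → D x ≡ true → X ∌ x → Y ∋ x → Above D X Y x
  Above-true {D = D} {x = x} e h k with D x
  Above-true refl h k | true = h , k

  -- Deleting one element keeps a chain a chain and merges at most one pair of members: of two
  -- merged pairs, suitable members would be incomparable.
  chain-count : (D : Fin n → Bool) (G : Collection n) → Chain′ D G → count G ℕ.≤ suc n
  chain-count {zero} D G chain = count-unique G λ { [] [] _ _ → refl }
  chain-count {suc n} D G chain = subst (ℕ._≤ suc (suc n)) (sym (count-∪-∩ G zero))
    (ℕ.≤-trans (ℕ.+-mono-≤ (chain-count (D ∘ suc) (G ∪[ zero ]) union) (count-unique (G ∩[ zero ]) unique))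
               (ℕ.≤-reflexive (ℕ.+-comm (suc n) 1)))
    where
    lift : ∀ {a b X Y x} → Above (D ∘ suc) X Y x → Above D (a ∷ X) (b ∷ Y) (suc x)
    lift {x = x} h with D (suc x)
    ... | false = ∋! (on (proj₁ h)) , ∌! (off (proj₂ h))
    ... | true  = ∌! (off (proj₁ h)) , ∋! (on (proj₂ h))
    union : Chain′ (D ∘ suc) (G ∪[ zero ])
    union {X} {Y} GX GY x y h k with ∪-elim {A = X} {G} {zero} GX | ∪-elim {A = Y} {G} {zero} GY
    ... | a , GaX | b , GbY = chain GaX GbY (suc x) (suc y) (lift h) (lift k)
    head : ∀ X Y → Above D (not (D zero) ∷ X) (D zero ∷ Y) zero
    head X Y with D zero
    ... | false = ∋! refl , ∌! refl
    ... | true  = ∌! refl , ∋! refl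
    none : ∀ X Y → T ((G ∩[ zero ]) X) → T ((G ∩[ zero ]) Y) → ∀ y → ¬ Above (D ∘ suc) Y X y
    none X Y GX GY y k = chain (∩-elim {A = X} {G} {zero} GX (not (D zero))) (∩-elim {A = Y} {G} {zero} GY (D zero))
      zero (suc y) (head X Y) (lift k)
    unique : ∀ X Y → T ((G ∩[ zero ]) X) → T ((G ∩[ zero ]) Y) → X ≡ Y
    unique X Y GX GY = subset-ext λ p → same p (D (suc p)) refl (∋? X p) (∋? Y p)
      where
      same : ∀ p b → D (suc p) ≡ b → X ∋ p ⊎ X ∌ p → Y ∋ p ⊎ Y ∌ p → lookup X p ≡ lookup Y p
      same p b e (inj₁ h) (inj₁ k) = trans (on h) (sym (on k))
      same p b e (inj₂ h) (inj₂ k) = trans (off h) (sym (off k))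
      same p false e (inj₁ h) (inj₂ k) = ⊥-elim (none Y X GY GX p (Above-false {D = D ∘ suc} e h k))
      same p false e (inj₂ h) (inj₁ k) = ⊥-elim (none X Y GX GY p (Above-false {D = D ∘ suc} e k h))
      same p true e (inj₁ h) (inj₂ k) = ⊥-elim (none X Y GX GY p (Above-true {D = D ∘ suc} e k h))
      same p true e (inj₂ h) (inj₁ k) = ⊥-elim (none Y X GY GX p (Above-true {D = D ∘ suc} e h k))

  -- If every member of G extends, with either value at p, to a member of a
  -- triad-free collection, then G is a chain up to complementing beyond p.
  link-count : ∀ {m} {F : Collection m} → TriadFree F → (p : Fin m) (ι : Fin n → Fin m) →
    (∀ {x y} → x < y → ι x < ι y) → (∀ x → ι x ≢ p) → (G : Collection n) →
    (∀ {X} → T (G X) → ∀ b → ∃ λ X̂ → T (F X̂) × lookup X̂ p ≡ b × ∀ x → lookup X̂ (ι x) ≡ lookup X x) →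
    count G ℕ.≤ suc n
  link-count {n = n} {m} {F} free p ι mono avoid G extend = chain-count D G chain
    where
    D : Fin n → Bool
    D x = ⌊ p <? ι x ⌋

    side : ∀ x → (D x ≡ false × ι x < p) ⊎ (D x ≡ true × p < ι x)
    side x with p <? ι x
    ... | yes l = inj₂ (refl , l)
    ... | no ¬l with <-total (avoid x)
    ... | inj₁ g = inj₁ (refl , g)
    ... | inj₂ l = ⊥-elim (¬l l)

    above-elim : ∀ {X Y x} b → D x ≡ b → Above D X Y x → (b ≡ false × X ∋ x × Y ∌ x) ⊎ (b ≡ true × X ∌ x × Y ∋ x)
    above-elim {x = x} b e h with D x
    above-elim false refl (h , k) | false = inj₁ (refl , h , k)
    above-elim true refl (h , k) | true = inj₂ (refl , h , k)

    chain : Chain′ D G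
    chain {X} {Y} GX GY x y h k = cases (side x) (side y) h k
      where
      X̂ Ŷ : Bool → Subset m
      X̂ b = proj₁ (extend GX b)
      Ŷ b = proj₁ (extend GY b)
      X̂∈ = λ b → proj₁ (proj₂ (extend GX b))
      Ŷ∈ = λ b → proj₁ (proj₂ (extend GY b))
      X̂p = λ b → proj₁ (proj₂ (proj₂ (extend GX b)))
      Ŷp = λ b → proj₁ (proj₂ (proj₂ (extend GY b)))
      X̂∋ : ∀ b {z} → X ∋ z → X̂ b ∋ ι z
      X̂∋ b {z} (∋! e) = ∋! (trans (proj₂ (proj₂ (proj₂ (extend GX b))) z) e)
      X̂∌ : ∀ b {z} → X ∌ z → X̂ b ∌ ι z
      X̂∌ b {z} (∌! e) = ∌! (trans (proj₂ (proj₂ (proj₂ (extend GX b))) z) e)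
      Ŷ∋ : ∀ b {z} → Y ∋ z → Ŷ b ∋ ι z
      Ŷ∋ b {z} (∋! e) = ∋! (trans (proj₂ (proj₂ (proj₂ (extend GY b))) z) e)
      Ŷ∌ : ∀ b {z} → Y ∌ z → Ŷ b ∌ ι z
      Ŷ∌ b {z} (∌! e) = ∌! (trans (proj₂ (proj₂ (proj₂ (extend GY b))) z) e)

      cases : (D x ≡ false × ι x < p) ⊎ (D x ≡ true × p < ι x) → (D y ≡ false × ι y < p) ⊎ (D y ≡ true × p < ι y) →
        Above D X Y x → Above D Y X y → ⊥
      cases (inj₁ (Dx , x<p)) (inj₁ (Dy , y<p)) h k with above-elim false Dx h | above-elim false Dy k
      ... | inj₁ (_ , Xx , Yx) | inj₁ (_ , Yy , Xy) with <-cmp x y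
      ... | tri< x<y _ _ = free (X̂∈ true) (Ŷ∈ false) (triad (mono x<y) y<p (X̂∋ true Xx) (Ŷ∌ false Yx)
              (X̂∌ true Xy) (Ŷ∋ false Yy) (∋! (X̂p true)) (∌! (Ŷp false)))
      ... | tri≈ _ refl _ = ∋∌-absurd Xx Xy
      ... | tri> _ _ y<x = free (Ŷ∈ true) (X̂∈ false) (triad (mono y<x) x<p (Ŷ∋ true Yy) (X̂∌ false Xy)
              (Ŷ∌ true Yx) (X̂∋ false Xx) (∋! (Ŷp true)) (∌! (X̂p false)))
      cases (inj₁ (Dx , x<p)) (inj₂ (Dy , p<y)) h k with above-elim false Dx h | above-elim true Dy k
      ... | inj₁ (_ , Xx , Yx) | inj₂ (_ , Yy , Xy) = free (X̂∈ false) (Ŷ∈ true) (triad x<p p<y (X̂∋ false Xx) (Ŷ∌ true Yx)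
              (∌! (X̂p false)) (∋! (Ŷp true)) (X̂∋ false Xy) (Ŷ∌ true Yy))
      cases (inj₂ (Dx , p<x)) (inj₁ (Dy , y<p)) h k with above-elim true Dx h | above-elim false Dy k
      ... | inj₂ (_ , Xx , Yx) | inj₁ (_ , Yy , Xy) = free (Ŷ∈ false) (X̂∈ true) (triad y<p p<x (Ŷ∋ false Yy) (X̂∌ true Xy)
              (∌! (Ŷp false)) (∋! (X̂p true)) (Ŷ∋ false Yx) (X̂∌ true Xx))
      cases (inj₂ (Dx , p<x)) (inj₂ (Dy , p<y)) h k with above-elim true Dx h | above-elim true Dy k
      ... | inj₂ (_ , Xx , Yx) | inj₂ (_ , Yy , Xy) with <-cmp x y
      ... | tri< x<y _ _ = free (X̂∈ true) (Ŷ∈ false) (triad p<x (mono x<y) (∋! (X̂p true)) (∌! (Ŷp false))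
              (X̂∌ true Xx) (Ŷ∋ false Yx) (X̂∋ true Xy) (Ŷ∌ false Yy))
      ... | tri≈ _ refl _ = ∋∌-absurd Xy Xx
      ... | tri> _ _ y<x = free (Ŷ∈ true) (X̂∈ false) (triad p<y (mono y<x) (∋! (Ŷp true)) (∌! (X̂p false))
              (Ŷ∌ true Yy) (X̂∋ false Xy) (Ŷ∋ true Yx) (X̂∌ false Xx))

  punchIn-mono-< : ∀ (p : Fin (suc n)) {x y} → x < y → punchIn p x < punchIn p y
  punchIn-mono-< p {x} {y} x<y = ≤∧≢⇒< (punchIn-mono-≤ p x y (ℕ.<⇒≤ x<y)) λ e → <⇒≢ x<y (punchIn-injective p x y e)

  insertAt∋ : ∀ (p : Fin (suc n)) b {x} → A ∋ x → insertAt A p b ∋ punchIn p x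
  insertAt∋ {A = A} p b {x} (∋! e) = ∋! (trans (insertAt-punchIn A p b x) e)

  insertAt∌ : ∀ (p : Fin (suc n)) b {x} → A ∌ x → insertAt A p b ∌ punchIn p x
  insertAt∌ {A = A} p b {x} (∌! e) = ∌! (trans (insertAt-punchIn A p b x) e)

  ∪-triadFree : {F : Collection (suc n)} → TriadFree F → ∀ p → TriadFree (F ∪[ p ])
  ∪-triadFree {F = F} free p {A} {B} FA FB (triad ab bc Aa Ba Ab Bb Ac Bc)
    with ∪-elim {A = A} {F} {p} FA | ∪-elim {A = B} {F} {p} FB
  ... | a , FA′ | b , FB′ = free FA′ FB′ (triad (punchIn-mono-< p ab) (punchIn-mono-< p bc)
    (insertAt∋ p a Aa) (insertAt∌ p b Ba) (insertAt∌ p a Ab) (insertAt∋ p b Bb) (insertAt∋ p a Ac) (insertAt∌ p b Bc))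

  ∩-count : {F : Collection (suc n)} → TriadFree F → ∀ p → count (F ∩[ p ]) ℕ.≤ suc n
  ∩-count {F = F} free p = link-count free p (punchIn p) (punchIn-mono-< p) (punchInᵢ≢i p) (F ∩[ p ])
    λ {X} h b → insertAt X p b , ∩-elim {A = X} {F} {p} h b , insertAt-lookup X p b , insertAt-punchIn X p b

  -- In closed form n(n+1)/2 + 1. The summand `suc n` is the bound on the pairs merged by deleting
  -- an element, given by `∩-count`.
  maxCount : ℕ → ℕ
  maxCount zero = 1
  maxCount (suc n) = maxCount n ℕ.+ suc n

  triadFree-count : (F : Collection n) → TriadFree F → count F ℕ.≤ maxCount n
  triadFree-count {zero} F free = count-unique F λ { [] [] _ _ → refl }
  triadFree-count {suc n} F free = subst (ℕ._≤ maxCount (suc n)) (sym (count-∪-∩ F zero))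
    (ℕ.+-mono-≤ (triadFree-count (F ∪[ zero ]) (∪-triadFree free zero)) (∩-count free zero))

  -- F ∩[ p ] exceeds the size bound of its own union along q, so its
  -- intersection along q is nonempty.
  face-exists : (F : Collection n) → TriadFree F → maxCount n ℕ.≤ count F → ∀ {p q} → p ≢ q →
    ∃ (Face (T ∘ F) p q)
  face-exists {suc zero} F free large {zero} {zero} p≢q = ⊥-elim (p≢q refl)
  face-exists {suc (suc n)} F free large {p} {q} p≢q with count-positive ((F ∩[ p ]) ∩[ q′ ]) positive
    where
    q′ = punchOut p≢q
    E = F ∩[ p ]
    open ℕ.≤-Reasoning
    E-large : suc (suc n) ℕ.≤ count E
    E-large = ℕ.+-cancelˡ-≤ (maxCount (suc n)) _ _ (begin
      maxCount (suc n) ℕ.+ suc (suc n)   ≤⟨ large ⟩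
      count F                            ≡⟨ count-∪-∩ F p ⟩
      count (F ∪[ p ]) ℕ.+ count E       ≤⟨ ℕ.+-monoˡ-≤ (count E) (triadFree-count (F ∪[ p ]) (∪-triadFree free p)) ⟩
      maxCount (suc n) ℕ.+ count E       ∎)
    E-union : count (E ∪[ q′ ]) ℕ.≤ suc n
    E-union = link-count free p (punchIn p ∘ punchIn q′) (punchIn-mono-< p ∘ punchIn-mono-< q′)
      (λ x → punchInᵢ≢i p (punchIn q′ x)) (E ∪[ q′ ]) λ {X} h b →
        let (c , Ec) = ∪-elim {A = X} {E} {q′} h in
        insertAt (insertAt X q′ c) p b , ∩-elim {A = insertAt X q′ c} {F} {p} Ec b , insertAt-lookup _ p b ,
        λ x → trans (insertAt-punchIn _ p b (punchIn q′ x)) (insertAt-punchIn X q′ c x)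
    positive : 1 ℕ.≤ count (E ∩[ q′ ])
    positive = ℕ.+-cancelˡ-≤ (suc n) _ _ (begin
      suc n ℕ.+ 1                              ≡⟨ ℕ.+-comm (suc n) 1 ⟩
      suc (suc n)                              ≤⟨ E-large ⟩
      count E                                  ≡⟨ count-∪-∩ E q′ ⟩
      count (E ∪[ q′ ]) ℕ.+ count (E ∩[ q′ ])  ≤⟨ ℕ.+-monoˡ-≤ _ E-union ⟩
      suc n ℕ.+ count (E ∩[ q′ ])              ∎)
  ... | X , h = corner false false , λ V agree → subst (T ∘ F) (sym (subset-ext (same V agree)))
          (∩-elim {A = insertAt X q′ (lookup V q)} {F} {p} (∩-elim {A = X} {F ∩[ p ]} {q′} h (lookup V q)) (lookup V p))
    where
    q′ = punchOut p≢q
    corner : Bool → Bool → Subset (suc (suc n))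
    corner b c = insertAt (insertAt X q′ b) p c
    q≡ : punchIn p q′ ≡ q
    q≡ = punchIn-punchOut p≢q
    corner-q : ∀ b c → lookup (corner b c) q ≡ b
    corner-q b c = subst (λ r → lookup (corner b c) r ≡ b) q≡
      (trans (insertAt-punchIn (insertAt X q′ b) p c q′) (insertAt-lookup X q′ b))
    corner-off : ∀ b c {r} (p≢r : p ≢ r) (q′≢ : q′ ≢ punchOut p≢r) → lookup (corner b c) r ≡ lookup X (punchOut q′≢)
    corner-off b c {r} p≢r q′≢ = subst (λ s → lookup (corner b c) s ≡ lookup X (punchOut q′≢)) (punchIn-punchOut p≢r)
      (trans (insertAt-punchIn (insertAt X q′ b) p c (punchOut p≢r))
        (subst (λ s → lookup (insertAt X q′ b) s ≡ lookup X (punchOut q′≢)) (punchIn-punchOut q′≢)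
          (insertAt-punchIn X q′ b (punchOut q′≢))))
    same : ∀ V → Agree₂ p q V (corner false false) → ∀ r → lookup V r ≡ lookup (corner (lookup V q) (lookup V p)) r
    same V agree r with p ≟ r
    ... | yes refl = sym (insertAt-lookup (insertAt X q′ (lookup V q)) p (lookup V p))
    ... | no p≢r with q′ ≟ punchOut p≢r
    ... | yes e = subst (λ s → lookup V s ≡ lookup (corner (lookup V q) (lookup V p)) s)
                    (trans (sym q≡) (trans (cong (punchIn p) e) (punchIn-punchOut p≢r)))
                    (sym (corner-q (lookup V q) (lookup V p)))
    ... | no ne = trans (agree r (λ e → p≢r (sym e)) (λ { refl → ne (punchOut-same p≢q p≢r) }))
                    (trans (corner-off false false p≢r ne) (sym (corner-off (lookup V q) (lookup V p) p≢r ne)))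
      where
      punchOut-same : (h k : p ≢ q) → punchOut h ≡ punchOut k
      punchOut-same h k = punchIn-injective p _ _ (trans (punchIn-punchOut h) (sym (punchIn-punchOut k)))

  module Convex where
    -- An automaton reading from the smallest element: `convex` before, `prefix` during and `empty`
    -- after a single run. What `convex` accepts are the empty set and the intervals; they witness
    -- that `maxCount` is attained.
    empty prefix convex : ∀ {n} → Collection n
    empty [] = true
    empty (true ∷ A) = false
    empty (false ∷ A) = empty A
    prefix [] = true
    prefix (true ∷ A) = prefix A
    prefix (false ∷ A) = empty A
    convex [] = true
    convex (true ∷ A) = prefix A
    convex (false ∷ A) = convex A

    count-none : ∀ n → count {n} (λ _ → false) ≡ 0
    count-none zero = refl
    count-none (suc n) = cong₂ ℕ._+_ (count-none n) (count-none n)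

    count-empty : ∀ n → count (empty {n}) ≡ 1
    count-empty zero = refl
    count-empty (suc n) = cong₂ ℕ._+_ (count-empty n) (count-none n)

    count-prefix : ∀ n → count (prefix {n}) ≡ suc n
    count-prefix zero = refl
    count-prefix (suc n) = cong₂ ℕ._+_ (count-empty n) (count-prefix n)

    count-convex : ∀ n → count (convex {n}) ≡ maxCount n
    count-convex zero = refl
    count-convex (suc n) = cong₂ ℕ._+_ (count-convex n) (count-prefix n)

    tail∋ : ∀ {b} {A : Subset n} {p} → (b ∷ A) ∋ suc p → A ∋ p
    tail∋ (∋! e) = ∋! e

    tail∌ : ∀ {b} {A : Subset n} {p} → (b ∷ A) ∌ suc p → A ∌ p
    tail∌ (∌! e) = ∌! e

    empty-none : (A : Subset n) → T (empty A) → ∀ {a} → A ∋ a → ⊥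
    empty-none (false ∷ A) h {suc a} Aa = empty-none A h (tail∋ Aa)

    prefix-initial : (A : Subset n) → T (prefix A) → ∀ {a b} → a < b → A ∌ a → A ∋ b → ⊥
    prefix-initial (true ∷ A) h {suc a} {suc b} (s≤s ab) Aa Ab = prefix-initial A h ab (tail∌ Aa) (tail∋ Ab)
    prefix-initial (false ∷ A) h {zero} {suc b} ab Aa Ab = empty-none A h (tail∋ Ab)
    prefix-initial (false ∷ A) h {suc a} {suc b} ab Aa Ab = empty-none A h (tail∋ Ab)

    convex-sound : (A : Subset n) → T (convex A) → ∀ {a b c} → a < b → b < c → A ∋ a → A ∌ b → A ∋ c → ⊥
    convex-sound (true ∷ A) h {_} {suc b} {suc c} ab (s≤s bc) Aa Ab Ac = prefix-initial A h bc (tail∌ Ab) (tail∋ Ac)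
    convex-sound (false ∷ A) h {suc a} {suc b} {suc c} (s≤s ab) (s≤s bc) Aa Ab Ac =
      convex-sound A h ab bc (tail∋ Aa) (tail∌ Ab) (tail∋ Ac)

-- Separation, intervals and co-intervals

module _ where
  private
    variable
      A B P Q : Subset n
      p q : Fin n

  ∈⇒∋ : p ∈ A → A ∋ p
  ∈⇒∋ h = ∋! ([]=⇒lookup h)

  ∋⇒∈ : A ∋ p → p ∈ A
  ∋⇒∈ {A = A} {p} h = lookup⇒[]= p A (on h)

  ∉⇒∌ : p ∉ A → A ∌ p
  ∉⇒∌ {p = p} {A} h with ∋? A p
  ... | inj₁ k = ⊥-elim (h (∋⇒∈ k))
  ... | inj₂ k = k

  ∌⇒∉ : A ∌ p → p ∉ A
  ∌⇒∉ h k = ∋∌-absurd (∈⇒∋ k) h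

  Diff : Subset n → Subset n → Fin n → Set
  Diff A B p = A ∋ p × B ∌ p

  Diff? : (A B : Subset n) (p : Fin n) → Dec (Diff A B p)
  Diff? A B p = map′ (λ (a , b) → ∋! a , ∌! b) (λ (a , b) → on a , off b)
    ((lookup A p ≟ᵇ true) ×-dec (lookup B p ≟ᵇ false))

  ─⁺ : Diff A B p → p ∈ A ─ B
  ─⁺ (a , b) = x∈p∧x∉q⇒x∈p─q (∋⇒∈ a) (∌⇒∉ b)

  ∈─⇒∉ : ∀ (A B : Subset n) → p ∈ A ─ B → p ∉ B
  ∈─⇒∉ {p = zero} (_ ∷ A) (true ∷ B) () _
  ∈─⇒∉ {p = zero} (_ ∷ A) (false ∷ B) _ ()
  ∈─⇒∉ {p = suc p} (_ ∷ A) (true ∷ B) (there h) (there k) = ∈─⇒∉ A B h k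
  ∈─⇒∉ {p = suc p} (_ ∷ A) (false ∷ B) (there h) (there k) = ∈─⇒∉ A B h k

  ─⁻ : p ∈ A ─ B → Diff A B p
  ─⁻ {A = A} {B} h = ∈⇒∋ (p─q⊆p A B h) , ∉⇒∌ (∈─⇒∉ A B h)

  Interlace⇒Alternate : Interlace (A ─ B) (B ─ A) → Alternate A B
  Interlace⇒Alternate (i , j , k , l , ij , jk , kl , hi , hk , hj , hl) =
    let (Ai , Bi) = ─⁻ hi ; (Ak , Bk) = ─⁻ hk ; (Bj , Aj) = ─⁻ hj ; (Bl , Al) = ─⁻ hl in
    alternate ij jk kl Ai Bi Aj Bj Ak Bk Al Bl

  Alternate⇒Interlace : Alternate A B → Interlace (A ─ B) (B ─ A)
  Alternate⇒Interlace (alternate ij jk kl Ai Bi Aj Bj Ak Bk Al Bl) =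
    _ , _ , _ , _ , ij , jk , kl , ─⁺ (Ai , Bi) , ─⁺ (Ak , Bk) , ─⁺ (Bj , Aj) , ─⁺ (Bl , Al)

  _≟ˢ_ : (A B : Subset n) → Dec (A ≡ B)
  _≟ˢ_ = ≡-dec _≟ᵇ_

  chordSeparated-¬alternate : {C : Collection n} → Pairwise ChordSeparated C →
    ∀ {A B} → T (C A) → T (C B) → ¬ Alternate A B
  chordSeparated-¬alternate sep CA CB alt = sep _ _ CA CB (inj₁ (Alternate⇒Interlace alt))

  maximal-absorbs : {C : Collection n} → IsMaximalChordSeparated C →
    ∀ V → (∀ A → T (C A) → ¬ Alternate A V × ¬ Alternate V A) → T (C V)
  maximal-absorbs {C = C} (sep , maximal) V compatible =
    maximal C⁺ separated (λ CA → Equivalence.from T-∨ (inj₁ CA)) (Equivalence.from (T-∨ {C V}) (inj₂ (fromWitness refl)))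
    where
    C⁺ : Collection _
    C⁺ A = C A ∨ ⌊ A ≟ˢ V ⌋
    separated : Pairwise ChordSeparated C⁺
    separated A B hA hB alt with Equivalence.to (T-∨ {C A}) hA | Equivalence.to (T-∨ {C B}) hB
    ... | inj₁ CA | inj₁ CB = sep A B CA CB alt
    ... | inj₁ CA | inj₂ e with refl ← toWitness e = Sum.[ proj₁ (compatible A CA) ∘ Interlace⇒Alternate
                                                       , proj₂ (compatible A CA) ∘ Interlace⇒Alternate ] alt
    ... | inj₂ e | inj₁ CB with refl ← toWitness e = Sum.[ proj₂ (compatible B CB) ∘ Interlace⇒Alternate
                                                       , proj₁ (compatible B CB) ∘ Interlace⇒Alternate ] alt
    ... | inj₂ e | inj₂ e′ with refl ← toWitness e | refl ← toWitness e′ =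
      Sum.[ irreflexive ∘ Interlace⇒Alternate , irreflexive ∘ Interlace⇒Alternate ] alt
      where
      irreflexive : ¬ Alternate A A
      irreflexive (alternate _ _ _ a a′ _ _ _ _ _ _) = ∋∌-absurd a a′

  private
    ∈-elements : A ∋ p → suc (toℕ p) List.∈ elements A
    ∈-elements {A = A} h = ∈-map⁺ _ (∈-filter⁺ (_∈? A) (∈-allFin _) (∋⇒∈ h))

    elements-∈ : ∀ {x} → x List.∈ elements A → ∃ λ p → A ∋ p × x ≡ suc (toℕ p)
    elements-∈ {A = A} h with ∈-map⁻ _ h
    ... | p , k , e = p , ∈⇒∋ (proj₂ (∈-filter⁻ (_∈? A) {xs = allFin _} k)) , e

    minElt-≤ : A ∋ p → minElt A ℕ.≤ suc (toℕ p)
    minElt-≤ {A = A} h with elements A | ∈-elements h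
    ... | x ∷ xs | Any.here refl = min≤⊤ x xs
    ... | x ∷ xs | Any.there k = All.lookup (min≤xs x xs) k

    maxElt-≥ : A ∋ p → suc (toℕ p) ℕ.≤ maxElt A
    maxElt-≥ {A = A} h = All.lookup (xs≤max 0 (elements A)) (∈-elements h)

    minElt-> : ∀ {v} → A ∋ p → (∀ q → A ∋ q → v ℕ.< suc (toℕ q)) → v ℕ.< minElt A
    minElt-> {A = A} {v = v} h k with elements A | ∈-elements h | (λ {x} → elements-∈ {A = A} {x})
    ... | x ∷ xs | _ | f = v<min⁺ (above (f (Any.here refl))) (All.tabulate λ y∈ → above (f (Any.there y∈)))
      where
      above : ∀ {x} → (∃ λ p → A ∋ p × x ≡ suc (toℕ p)) → v ℕ.< x
      above (p , Ap , refl) = k p Ap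

  ≪-elim : P ≪ Q → P ∋ p → Q ∋ q → p < q
  ≪-elim P≪Q Pp Qq = ℕ.≤-pred (ℕ.≤-<-trans (maxElt-≥ Pp) (ℕ.<-≤-trans P≪Q (minElt-≤ Qq)))

  -- `P` may be empty, because its maximum is then 0 and listed elements start at 1. `Q` may not,
  -- because its minimum would be 0 as well.
  ≪-intro : Q ∋ q → (∀ p q → P ∋ p → Q ∋ q → p < q) → P ≪ Q
  ≪-intro {P = P} Qq h = minElt-> Qq λ q′ Qq′ → max<v⁺ (s≤s z≤n)
    (All.tabulate λ x∈ → let (p , Pp , e) = elements-∈ x∈ in subst (ℕ._< _) (sym e) (s≤s (h p q′ Pp Qq′)))

  stronglySeparated-¬triad : StronglySeparated A B → ¬ Triad A B
  stronglySeparated-¬triad (inj₁ refl) (triad _ _ Aa Ba _ _ _ _) = ∋∌-absurd Aa Ba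
  stronglySeparated-¬triad (inj₂ (inj₁ h)) (triad ab bc Aa Ba Ab Bb Ac Bc) =
    <-asym bc (≪-elim h (∈⇒∋ (─⁺ (Ac , Bc))) (∈⇒∋ (─⁺ (Bb , Ab))))
  stronglySeparated-¬triad (inj₂ (inj₂ h)) (triad ab bc Aa Ba Ab Bb Ac Bc) =
    <-asym ab (≪-elim h (∈⇒∋ (─⁺ (Bb , Ab))) (∈⇒∋ (─⁺ (Aa , Ba))))

  diff-empty : (∀ p → ¬ Diff A B p) → (∀ p → ¬ Diff B A p) → A ≡ B
  diff-empty {A = A} {B} none none′ = subset-ext same
    where
    same : ∀ p → lookup A p ≡ lookup B p
    same p with ∋? A p | ∋? B p
    ... | inj₁ a | inj₁ b = trans (on a) (sym (on b))
    ... | inj₁ a | inj₂ b = ⊥-elim (none p (a , b))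
    ... | inj₂ a | inj₁ b = ⊥-elim (none′ p (b , a))
    ... | inj₂ a | inj₂ b = trans (off a) (sym (off b))

  -- One correctly ordered pair fixes the order of all: a pair q < p in the wrong order forms a
  -- triad a, q, p or q, a, b, depending on whether `a` lies before `q`.
  ¬triad-diff-< : ∀ {a b : Fin n} → ¬ Triad A B → ¬ Triad B A → a < b → Diff A B a → Diff B A b →
    ∀ p q → Diff A B p → Diff B A q → p < q
  ¬triad-diff-< {A = A} {B} {a = a} {b} free free′ a<b (Aa , Ba) (Bb , Ab) p q (Ap , Bp) (Bq , Aq)
    with <-total (∋∌-≢ Ap Aq)
  ... | inj₁ p<q = p<q
  ... | inj₂ q<p with <-total (∋∌-≢ Aa Aq)
  ... | inj₁ a<q = ⊥-elim (free (triad a<q q<p Aa Ba Aq Bq Ap Bp))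
  ... | inj₂ q<a = ⊥-elim (free′ (triad q<a a<b Bq Aq Ba Aa Bb Ab))

  ¬triad-stronglySeparated : ¬ Triad A B → ¬ Triad B A → StronglySeparated A B
  ¬triad-stronglySeparated {A = A} {B} free free′ with any? (Diff? A B) | any? (Diff? B A)
  ... | no none | no none′ = inj₁ (diff-empty (λ p d → none (p , d)) (λ p d → none′ (p , d)))
  ... | no none | yes (q , d) = inj₂ (inj₁ (≪-intro (∈⇒∋ (─⁺ d)) λ p _ h _ → ⊥-elim (none (p , ─⁻ (∋⇒∈ h)))))
  ... | yes (p , d) | no none = inj₂ (inj₂ (≪-intro (∈⇒∋ (─⁺ d)) λ q _ h _ → ⊥-elim (none (q , ─⁻ (∋⇒∈ h)))))
  ... | yes (a , Da) | yes (b , Db) with <-total (∋∌-≢ (proj₁ Da) (proj₂ Db))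
  ... | inj₁ a<b = inj₂ (inj₁ (≪-intro (∈⇒∋ (─⁺ Db)) λ p q hp hq →
          ¬triad-diff-< free free′ a<b Da Db p q (─⁻ (∋⇒∈ hp)) (─⁻ (∋⇒∈ hq))))
  ... | inj₂ b<a = inj₂ (inj₂ (≪-intro (∈⇒∋ (─⁺ Da)) λ p q hp hq →
          ¬triad-diff-< free′ free b<a Db Da p q (─⁻ (∋⇒∈ hp)) (─⁻ (∋⇒∈ hq))))

  stronglySeparated⇒triadFree : {F : Collection n} → Pairwise StronglySeparated F → TriadFree F
  stronglySeparated⇒triadFree sep FA FB = stronglySeparated-¬triad (sep _ _ FA FB)

  triadFree⇒stronglySeparated : {F : Collection n} → TriadFree F → Pairwise StronglySeparated F
  triadFree⇒stronglySeparated free A B FA FB = ¬triad-stronglySeparated (free FA FB) (free FB FA)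

  module _ {A : Subset n} where

    𝓘-convex : 𝓘 n A → ∀ {a b c} → a < b → b < c → A ∋ a → A ∌ b → A ∋ c → ⊥
    𝓘-convex (inj₁ refl) _ _ Aa _ _ = ∉⊥ (∋⇒∈ Aa)
    𝓘-convex (inj₂ (i , j , _ , h)) {a} {b} {c} ab bc Aa Ab Ac = ∌⇒∉ Ab (Equivalence.from (h b)
      ( ℕ.<⇒≤ (ℕ.≤-<-trans (proj₁ (Equivalence.to (h a) (∋⇒∈ Aa))) ab)
      , ℕ.<⇒≤ (ℕ.<-≤-trans bc (proj₂ (Equivalence.to (h c) (∋⇒∈ Ac))))))

    private
      least-∋ : ∀ s → A ∋ s → ∃ λ r → A ∋ r × (∀ x → A ∋ x → r ≤ x)
      least-∋ s = search (suc (toℕ s)) s ℕ.≤-refl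
        where
        search : ∀ k (s : Fin n) → toℕ s ℕ.< k → A ∋ s → ∃ λ r → A ∋ r × (∀ x → A ∋ x → r ≤ x)
        search (suc k) s (s≤s bound) As with any? (λ x → (x <? s) ×-dec (x ∈? A))
        ... | no none = s , As , λ x Ax → ℕ.≮⇒≥ λ x<s → none (x , x<s , ∋⇒∈ Ax)
        ... | yes (x , x<s , Ax) = search k x (ℕ.≤-trans x<s bound) (∈⇒∋ Ax)

    convex-𝓘 : (∀ {a b c} → a < b → b < c → A ∋ a → A ∌ b → A ∋ c → ⊥) → 𝓘 n A
    convex-𝓘 convex with any? (_∈? A)
    ... | no none = inj₁ (subset-ext λ p → trans (off (∉⇒∌ (λ h → none (p , h)))) (sym (off (∉⇒∌ {p = p} {A = Sub.⊥} ∉⊥))))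
    ... | yes (s , h) with least-∋ s (∈⇒∋ h) | greatest (_∈? A) s h
    ... | i , Ai , least | j , Aj , last = inj₂ (i , j , least j (∈⇒∋ Aj) , λ x → mk⇔
      (λ Ax → least x (∈⇒∋ Ax) , ℕ.≮⇒≥ λ j<x → last x j<x Ax)
      (λ (i≤x , x≤j) → filled x i≤x x≤j))
      where
      filled : ∀ x → i ≤ x → x ≤ j → x ∈ A
      filled x i≤x x≤j with ∋? A x
      ... | inj₁ Ax = ∋⇒∈ Ax
      ... | inj₂ Ax = ⊥-elim (convex (ℕ.≤∧≢⇒< i≤x (λ e → ∋∌-≢ Ai Ax (toℕ-injective e)))
                                     (ℕ.≤∧≢⇒< x≤j (λ e → ∋∌-≢ (∈⇒∋ Aj) Ax (sym (toℕ-injective e)))) Ai Ax (∈⇒∋ Aj))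

  ∁∋ : A ∌ p → ∁ A ∋ p
  ∁∋ {A = A} {p} (∌! e) = ∋! (trans (lookup-map p not A) (cong not e))

  ∁∌ : A ∋ p → ∁ A ∌ p
  ∁∌ {A = A} {p} (∋! e) = ∌! (trans (lookup-map p not A) (cong not e))

  ∁-involutive : (A : Subset n) → ∁ (∁ A) ≡ A
  ∁-involutive A = subset-ext λ p →
    trans (lookup-map p not (∁ A)) (trans (cong not (lookup-map p not A)) (not-involutive (lookup A p)))

  module _ {A : Subset n} where

    co-𝓘-coconvex : co-𝓘 n A → ∀ {a b c} → a < b → b < c → A ∌ a → A ∋ b → A ∌ c → ⊥
    co-𝓘-coconvex (I , h , refl) ab bc Aa Ab Ac = 𝓘-convex h ab bc (undo∋ (∁∋ Aa)) (undo∌ (∁∌ Ab)) (undo∋ (∁∋ Ac))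
      where
      undo∋ : ∀ {p} → ∁ (∁ I) ∋ p → I ∋ p
      undo∋ {p} = subst (_∋ p) (∁-involutive I)
      undo∌ : ∀ {p} → ∁ (∁ I) ∌ p → I ∌ p
      undo∌ {p} = subst (_∌ p) (∁-involutive I)

    coconvex-co-𝓘 : (∀ {a b c} → a < b → b < c → A ∌ a → A ∋ b → A ∌ c → ⊥) → co-𝓘 n A
    coconvex-co-𝓘 coconvex = ∁ A , convex-𝓘 (λ ab bc Aa Ab Ac → coconvex ab bc (undo∌ Aa) (undo∋ Ab) (undo∌ Ac)) , sym (∁-involutive A)
      where
      undo∌ : ∀ {p} → ∁ A ∋ p → A ∌ p
      undo∌ {p} h = subst (_∌ p) (∁-involutive A) (∁∌ h)
      undo∋ : ∀ {p} → ∁ A ∌ p → A ∋ p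
      undo∋ {p} h = subst (_∋ p) (∁-involutive A) (∁∋ h)

  ▷-on : (X : Subset n) (a : Fin n) → lookup (X ▷ a) a ≡ true
  ▷-on X a = trans (lookup-zipWith _ a X ⁅ a ⁆) (trans (cong (lookup X a ∨_) ([]=⇒lookup (x∈⁅x⁆ a))) (∨-zeroʳ (lookup X a)))

  ▷-off : (X : Subset n) (a : Fin n) → p ≢ a → lookup (X ▷ a) p ≡ lookup X p
  ▷-off {p = p} X a p≢a = trans (lookup-zipWith _ p X ⁅ a ⁆)
    (trans (cong (lookup X p ∨_) (off (∉⇒∌ (λ h → p≢a (x∈⁅y⁆⇒x≡y a h))))) (∨-identityʳ (lookup X p)))

-- Patterns on triples

record Triple (n : ℕ) : Set where
  constructor ⟨_,_,_⟩
  field lo mid hi : Fin n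

open Triple public

Increasing : Triple n → Set
Increasing σ = lo σ < mid σ × mid σ < hi σ

Dip Peak : Subset n → Triple n → Set
Dip  A σ = A ∋ lo σ × A ∌ mid σ × A ∋ hi σ
Peak A σ = A ∌ lo σ × A ∋ mid σ × A ∌ hi σ

HasDip HasPeak : (Subset n → Set) → Triple n → Set
HasDip  F σ = ∃ λ A → F A × Dip A σ
HasPeak F σ = ∃ λ A → F A × Peak A σ

dip-peak : ∀ {A : Subset n} {σ} → Dip A σ → Peak A σ → ⊥
dip-peak (a , _) (b , _) = ∋∌-absurd a b

dip-peak-triad : ∀ {A B : Subset n} {σ} → Increasing σ → Dip A σ → Peak B σ → Triad A B
dip-peak-triad (l , h) (a , b , c) (a′ , b′ , c′) = triad l h a a′ b b′ c c′

data _∈₃_ (p : Fin n) (σ : Triple n) : Set where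
  isLo  : p ≡ lo σ → p ∈₃ σ
  isMid : p ≡ mid σ → p ∈₃ σ
  isHi  : p ≡ hi σ → p ∈₃ σ

∈₃? : (p : Fin n) (σ : Triple n) → Dec (p ∈₃ σ)
∈₃? p σ with p ≟ lo σ | p ≟ mid σ | p ≟ hi σ
... | yes e | _ | _ = yes (isLo e)
... | no _ | yes e | _ = yes (isMid e)
... | no _ | no _ | yes e = yes (isHi e)
... | no a | no b | no c = no λ { (isLo e) → a e ; (isMid e) → b e ; (isHi e) → c e }

Agree : Triple n → Subset n → Subset n → Set
Agree σ = Agree₃ (lo σ) (mid σ) (hi σ)

agree-at : ∀ {σ : Triple n} {V X p} → Agree σ V X → ¬ p ∈₃ σ → lookup V p ≡ lookup X p
agree-at agree h = agree _ (h ∘ isLo) (h ∘ isMid) (h ∘ isHi)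

-- Sorted only if x < y.
place : (x y p : Fin n) → Triple n
place x y p with p <? x | p <? y
... | yes _ | _     = ⟨ p , x , y ⟩
... | no _  | yes _ = ⟨ x , p , y ⟩
... | no _  | no _  = ⟨ x , y , p ⟩

module _ {x y p : Fin n} where

  place-left : p < x → place x y p ≡ ⟨ p , x , y ⟩
  place-left p<x with p <? x | p <? y
  ... | yes _ | _ = refl
  ... | no h  | _ = ⊥-elim (h p<x)

  place-inside : x < p → p < y → place x y p ≡ ⟨ x , p , y ⟩
  place-inside x<p p<y with p <? x | p <? y
  ... | yes h | _     = ⊥-elim (<-asym h x<p)
  ... | no _  | yes _ = refl
  ... | no _  | no h  = ⊥-elim (h p<y)

  place-right : x < y → y < p → place x y p ≡ ⟨ x , y , p ⟩
  place-right x<y y<p with p <? x | p <? y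
  ... | yes h | _     = ⊥-elim (<-asym h (<-trans x<y y<p))
  ... | no _  | yes h = ⊥-elim (<-asym h y<p)
  ... | no _  | no _  = refl

  module _ {X : Subset n} (x<y : x < y) where

    crossed-increasing : Crossed x y X p → Increasing (place x y p)
    crossed-increasing (left p<x _) = subst Increasing (sym (place-left p<x)) (p<x , x<y)
    crossed-increasing (inside x<p p<y _) = subst Increasing (sym (place-inside x<p p<y)) (x<p , p<y)
    crossed-increasing (right y<p _) = subst Increasing (sym (place-right x<y y<p)) (x<y , y<p)

    module _ {F : Subset n → Set} (face : Face F x y X) where
      private
        V : Bool → Bool → Subset n
        V b c = set₂ x y b c X
        V∈F : ∀ b c → F (V b c)
        V∈F b c = face _ (set₂-off b c X)
        Vx : ∀ b c → lookup (V b c) x ≡ b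
        Vx b c = set₂-fst b c X (<⇒≢ x<y)
        Vy : ∀ b c → lookup (V b c) y ≡ c
        Vy b c = set₂-snd {x = x} b c X
        Vp : ∀ b c → p ≢ x → p ≢ y → lookup (V b c) p ≡ lookup X p
        Vp b c = set₂-off b c X p

      -- The reversed convention inside the interval pays off here: wherever `p` lies, having
      -- crossed it amounts to a dip on the sorted triple, shown by one corner of the face.
      crossed-dip : Crossed x y X p → HasDip F (place x y p)
      crossed-dip (left p<x h) = subst (HasDip F) (sym (place-left p<x))
        (V false true , V∈F _ _ , ∋-resp (Vp _ _ (<⇒≢ p<x) (<⇒≢ (<-trans p<x x<y))) h , ∌! (Vx _ _) , ∋! (Vy _ _))
      crossed-dip (inside x<p p<y h) = subst (HasDip F) (sym (place-inside x<p p<y))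
        (V true true , V∈F _ _ , ∋! (Vx _ _) , ∌-resp (Vp _ _ (>⇒≢ x<p) (<⇒≢ p<y)) h , ∋! (Vy _ _))
      crossed-dip (right y<p h) = subst (HasDip F) (sym (place-right x<y y<p))
        (V true false , V∈F _ _ , ∋! (Vx _ _) , ∌! (Vy _ _) , ∋-resp (Vp _ _ (>⇒≢ (<-trans x<y y<p)) (>⇒≢ y<p)) h)

      uncrossed-peak : Uncrossed x y X p → HasPeak F (place x y p)
      uncrossed-peak (left p<x h) = subst (HasPeak F) (sym (place-left p<x))
        (V true false , V∈F _ _ , ∌-resp (Vp _ _ (<⇒≢ p<x) (<⇒≢ (<-trans p<x x<y))) h , ∋! (Vx _ _) , ∌! (Vy _ _))
      uncrossed-peak (inside x<p p<y h) = subst (HasPeak F) (sym (place-inside x<p p<y))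
        (V false false , V∈F _ _ , ∌! (Vx _ _) , ∋-resp (Vp _ _ (>⇒≢ x<p) (<⇒≢ p<y)) h , ∌! (Vy _ _))
      uncrossed-peak (right y<p h) = subst (HasPeak F) (sym (place-right x<y y<p))
        (V false true , V∈F _ _ , ∌! (Vx _ _) , ∋! (Vy _ _) , ∌-resp (Vp _ _ (>⇒≢ (<-trans x<y y<p)) (>⇒≢ y<p)) h)

increasing-≡ : ∀ {σ τ : Triple n} → Increasing σ → Increasing τ →
  (∀ {z} → z ∈₃ τ → z ∈₃ σ) → τ ≡ σ
increasing-≡ {σ = σ} {τ} (l , h) (l′ , h′) sub
  with one₃-increasing l h l′ h′ (one₃ (sub (isLo refl))) (one₃ (sub (isMid refl))) (one₃ (sub (isHi refl)))
  where
  one₃ : ∀ {p} → p ∈₃ σ → One₃ (lo σ) (mid σ) (hi σ) p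
  one₃ (isLo e) = inj₁ e
  one₃ (isMid e) = inj₂ (inj₁ e)
  one₃ (isHi e) = inj₂ (inj₂ e)
... | refl , refl , refl = refl

_≟₃_ : (σ τ : Triple n) → Dec (σ ≡ τ)
⟨ a , b , c ⟩ ≟₃ ⟨ i , j , k ⟩ = map′ (λ { (refl , refl , refl) → refl }) (λ { refl → refl , refl , refl })
  ((a ≟ i) ×-dec ((b ≟ j) ×-dec (c ≟ k)))

missing : ∀ {σ τ : Triple n} → Increasing σ → Increasing τ → τ ≢ σ → ∃ λ z → z ∈₃ σ × ¬ z ∈₃ τ
missing {σ = σ} {τ} incσ incτ τ≢σ with ∈₃? (lo σ) τ | ∈₃? (mid σ) τ | ∈₃? (hi σ) τ
... | no h | _ | _ = lo σ , isLo refl , h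
... | yes _ | no h | _ = mid σ , isMid refl , h
... | yes _ | yes _ | no h = hi σ , isHi refl , h
... | yes l | yes m | yes h = ⊥-elim (τ≢σ (sym (increasing-≡ incτ incσ
      λ { (isLo refl) → l ; (isMid refl) → m ; (isHi refl) → h })))

-- The hexagon consists of the six witnesses of a flip, common to both sides of the cube. The peak
-- vertex lies on all three lower faces and on no upper one, the dip vertex on all three upper faces
-- and on no lower one.
Hexagon Lower : Triple n → Subset n → Subset n → Set
Hexagon σ B V = Agree σ V B × ¬ Dip V σ × ¬ Peak V σ
Lower σ B V = Agree σ V B × ¬ Dip V σ

hexagon-lower : ∀ {σ : Triple n} {B V} → Hexagon σ B V → Lower σ B V
hexagon-lower (agree , ¬dip , _) = agree , ¬dip

toggle : Fin n → Subset n → Subset n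
toggle z V = V [ z ]≔ not (lookup V z)

toggle-off : ∀ {z p : Fin n} V → p ≢ z → lookup (toggle z V) p ≡ lookup V p
toggle-off {z = z} V p≢z = lookup∘update′ p≢z V (not (lookup V z))

toggle-on : ∀ (z : Fin n) V → lookup (toggle z V) z ≡ not (lookup V z)
toggle-on z V = lookup∘update z V (not (lookup V z))

-- The three faces of a cube that are passed before the raising flip across it;
-- q is the direction of the cube missing from the face.
data LowerFace (σ : Triple n) (B : Subset n) : (x y q : Fin n) → Subset n → Set where
  face-lo-mid : ∀ {X} → Agree σ X B → X ∌ hi σ → LowerFace σ B (lo σ) (mid σ) (hi σ) X
  face-mid-hi : ∀ {X} → Agree σ X B → X ∌ lo σ → LowerFace σ B (mid σ) (hi σ) (lo σ) X
  face-lo-hi  : ∀ {X} → Agree σ X B → X ∋ mid σ → LowerFace σ B (lo σ) (hi σ) (mid σ) X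

module _ {σ : Triple n} where

  ext₃ : ∀ {V W X} → Agree σ V X → Agree σ W X → (∀ {z} → z ∈₃ σ → lookup V z ≡ lookup W z) → V ≡ W
  ext₃ {V} {W} {X} agV agW same = subset-ext eq
    where
    eq : ∀ p → lookup V p ≡ lookup W p
    eq p with ∈₃? p σ
    ... | yes h = same h
    ... | no h = trans (agree-at {V = V} {X} agV h) (sym (agree-at {V = W} {X} agW h))

  same-dip : ∀ {V W} → Dip V σ → Dip W σ → ∀ {z} → z ∈₃ σ → lookup V z ≡ lookup W z
  same-dip (a , b , c) (a′ , b′ , c′) (isLo refl) = trans (on a) (sym (on a′))
  same-dip (a , b , c) (a′ , b′ , c′) (isMid refl) = trans (off b) (sym (off b′))
  same-dip (a , b , c) (a′ , b′ , c′) (isHi refl) = trans (on c) (sym (on c′))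

  same-peak : ∀ {V W} → Peak V σ → Peak W σ → ∀ {z} → z ∈₃ σ → lookup V z ≡ lookup W z
  same-peak (a , b , c) (a′ , b′ , c′) (isLo refl) = trans (off a) (sym (off a′))
  same-peak (a , b , c) (a′ , b′ , c′) (isMid refl) = trans (on b) (sym (on b′))
  same-peak (a , b , c) (a′ , b′ , c′) (isHi refl) = trans (off c) (sym (off c′))

  dip-resp : ∀ {V W} → (∀ {z} → z ∈₃ σ → lookup W z ≡ lookup V z) → Dip V σ → Dip W σ
  dip-resp e (a , b , c) = ∋-resp (e (isLo refl)) a , ∌-resp (e (isMid refl)) b , ∋-resp (e (isHi refl)) c

  peak-resp : ∀ {V W} → (∀ {z} → z ∈₃ σ → lookup W z ≡ lookup V z) → Peak V σ → Peak W σ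
  peak-resp e (a , b , c) = ∌-resp (e (isLo refl)) a , ∋-resp (e (isMid refl)) b , ∌-resp (e (isHi refl)) c

  same⇒¬toggled : ∀ {V W z} → z ∈₃ σ → (∀ {p} → p ∈₃ σ → lookup W p ≡ lookup V p) →
    lookup W z ≡ not (lookup V z) → ⊥
  same⇒¬toggled {V} {z = z} z∈ same e = not-¬ refl (trans (sym (same z∈)) e)

  module _ (inc : Increasing σ) where

    lo≢mid : lo σ ≢ mid σ
    lo≢mid = <⇒≢ (proj₁ inc)
    mid≢hi : mid σ ≢ hi σ
    mid≢hi = <⇒≢ (proj₂ inc)
    lo≢hi : lo σ ≢ hi σ
    lo≢hi = <⇒≢ (<-trans (proj₁ inc) (proj₂ inc))

    vertex : Subset n → Bool → Bool → Bool → Subset n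
    vertex B a b c = set₃ (lo σ) (mid σ) (hi σ) a b c B

    module _ (B : Subset n) (a b c : Bool) where
      vertex-agree : Agree σ (vertex B a b c) B
      vertex-agree = set₃-off lo≢mid lo≢hi mid≢hi a b c B
      vertex-lo : lookup (vertex B a b c) (lo σ) ≡ a
      vertex-lo = set₃-fst lo≢mid lo≢hi mid≢hi a b c B
      vertex-mid : lookup (vertex B a b c) (mid σ) ≡ b
      vertex-mid = set₃-snd lo≢mid lo≢hi mid≢hi a b c B
      vertex-hi : lookup (vertex B a b c) (hi σ) ≡ c
      vertex-hi = set₃-trd lo≢mid lo≢hi mid≢hi a b c B

    peakOf dipOf : Subset n → Subset n
    peakOf B = vertex B false true false
    dipOf B = vertex B true false true

    peakOf-peak : ∀ B → Peak (peakOf B) σ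
    peakOf-peak B = ∌! (vertex-lo B _ _ _) , ∋! (vertex-mid B _ _ _) , ∌! (vertex-hi B _ _ _)

    dipOf-dip : ∀ B → Dip (dipOf B) σ
    dipOf-dip B = ∋! (vertex-lo B _ _ _) , ∌! (vertex-mid B _ _ _) , ∋! (vertex-hi B _ _ _)

    toggle-extreme : ∀ {B V z} → Agree σ V B → Dip V σ ⊎ Peak V σ → z ∈₃ σ → Hexagon σ B (toggle z V)
    toggle-extreme {B} {V} {z} agree extreme z∈ = agree′ , ¬dip extreme , ¬peak extreme
      where
      agree′ : Agree σ (toggle z V) B
      agree′ p p≢lo p≢mid p≢hi = trans (toggle-off V (λ { refl → impossible z∈ p≢lo p≢mid p≢hi })) (agree p p≢lo p≢mid p≢hi)
        where
        impossible : ∀ {z} → z ∈₃ σ → z ≢ lo σ → z ≢ mid σ → z ≢ hi σ → ⊥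
        impossible (isLo e) a b c = a e
        impossible (isMid e) a b c = b e
        impossible (isHi e) a b c = c e
      other : ∃ λ w → w ∈₃ σ × w ≢ z
      other with z ≟ lo σ
      ... | yes refl = mid σ , isMid refl , λ e → lo≢mid (sym e)
      ... | no z≢lo = lo σ , isLo refl , λ e → z≢lo (sym e)
      clash : ∀ {w} → w ∈₃ σ → w ≢ z → (∀ {p} → p ∈₃ σ → lookup (toggle z V) p ≡ not (lookup V p)) → ⊥
      clash w∈ w≢z opposite = not-¬ refl (trans (sym (toggle-off V w≢z)) (opposite w∈))
      ¬dip : Dip V σ ⊎ Peak V σ → ¬ Dip (toggle z V) σ
      ¬dip (inj₁ d) d′ = same⇒¬toggled {V = V} {toggle z V} z∈ (same-dip {V = toggle z V} {V} d′ d) (toggle-on z V)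
      ¬dip (inj₂ (a , b , c)) (a′ , b′ , c′) = let (w , w∈ , w≢z) = other in clash w∈ w≢z λ
        { (isLo refl) → trans (on a′) (cong not (sym (off a)))
        ; (isMid refl) → trans (off b′) (cong not (sym (on b)))
        ; (isHi refl) → trans (on c′) (cong not (sym (off c))) }
      ¬peak : Dip V σ ⊎ Peak V σ → ¬ Peak (toggle z V) σ
      ¬peak (inj₂ d) d′ = same⇒¬toggled {V = V} {toggle z V} z∈ (same-peak {V = toggle z V} {V} d′ d) (toggle-on z V)
      ¬peak (inj₁ (a , b , c)) (a′ , b′ , c′) = let (w , w∈ , w≢z) = other in clash w∈ w≢z λ
        { (isLo refl) → trans (off a′) (cong not (sym (on a)))
        ; (isMid refl) → trans (on b′) (cong not (sym (off b)))
        ; (isHi refl) → trans (off c′) (cong not (sym (on c))) }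

    -- A triple τ ≠ σ misses a direction of the cube, so what a vertex shows
    -- on τ is also shown by a vertex of the hexagon.
    hexagon-transfer : ∀ {B V τ} → Increasing τ → τ ≢ σ → Agree σ V B → Dip V σ ⊎ Peak V σ →
      ∃ λ W → Hexagon σ B W × (∀ {p} → p ∈₃ τ → lookup W p ≡ lookup V p)
    hexagon-transfer {B} {V} incτ τ≢σ agree extreme with missing inc incτ τ≢σ
    ... | z , z∈σ , z∉τ = toggle z V , toggle-extreme {B = B} {V} agree extreme z∈σ , λ p∈τ → toggle-off V (λ { refl → z∉τ p∈τ })

    module _ {F : Subset n → Set} (free : ∀ {A B} → F A → F B → ¬ Triad A B)
             {B : Subset n} (hexagon : ∀ {V} → Hexagon σ B V → F V) where
      private
        module Vertex (a b c : Bool) (¬dip : ¬ (a ≡ true × b ≡ false × c ≡ true)) (¬peak : ¬ (a ≡ false × b ≡ true × c ≡ false)) where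
          V : Subset n
          V = vertex B a b c
          V∈ : F V
          V∈ = hexagon (vertex-agree B a b c
            , (λ (x , y , z) → ¬dip ( trans (sym (vertex-lo B a b c)) (on x)
                                    , trans (sym (vertex-mid B a b c)) (off y) , trans (sym (vertex-hi B a b c)) (on z)))
            , (λ (x , y , z) → ¬peak ( trans (sym (vertex-lo B a b c)) (off x)
                                    , trans (sym (vertex-mid B a b c)) (on y) , trans (sym (vertex-hi B a b c)) (off z))))
          l = vertex-lo B a b c
          m = vertex-mid B a b c
          h = vertex-hi B a b c
          V∋ : ∀ {p} → ¬ p ∈₃ σ → B ∋ p → V ∋ p
          V∋ np = ∋-resp (agree-at {V = V} {B} (vertex-agree B a b c) np)
          V∌ : ∀ {p} → ¬ p ∈₃ σ → B ∌ p → V ∌ p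
          V∌ np = ∌-resp (agree-at {V = V} {B} (vertex-agree B a b c) np)

        module V₀₀₀ = Vertex false false false (λ ()) (λ ())
        module V₁₀₀ = Vertex true false false (λ ()) (λ ())
        module V₀₀₁ = Vertex false false true (λ ()) (λ ())
        module V₁₁₀ = Vertex true true false (λ ()) (λ ())
        module V₀₁₁ = Vertex false true true (λ ()) (λ ())
        module V₁₁₁ = Vertex true true true (λ ()) (λ ())

      -- In the presence of the witnesses, the dip vertex is the only set with a dip on `σ`. A
      -- deviation from `B` at `p` forms a triad together with two of the three elements of `σ`; the
      -- witness is chosen by the direction of the deviation and the position of `p`.
      dip-agree : ∀ {A} → F A → Dip A σ → Agree σ A B
      dip-agree {A} FA (Al , Am , Ah) p p≢lo p≢mid p≢hi = compare (∋? A p) (∋? B p) (<-total p≢lo) (<-total p≢mid) (<-total p≢hi)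
        where
        np : ¬ p ∈₃ σ
        np (isLo e) = p≢lo e
        np (isMid e) = p≢mid e
        np (isHi e) = p≢hi e
        l<m = proj₁ inc
        m<h = proj₂ inc
        compare : A ∋ p ⊎ A ∌ p → B ∋ p ⊎ B ∌ p → p < lo σ ⊎ lo σ < p → p < mid σ ⊎ mid σ < p → p < hi σ ⊎ hi σ < p →
          lookup A p ≡ lookup B p
        compare (inj₁ a) (inj₁ b) _ _ _ = trans (on a) (sym (on b))
        compare (inj₂ a) (inj₂ b) _ _ _ = trans (off a) (sym (off b))
        compare (inj₁ a) (inj₂ b) _ (inj₁ p<m) _ = ⊥-elim (free FA V∈
          (triad p<m m<h a (V∌ np b) Am (∋! m) Ah (∌! h)))
          where open V₁₁₀
        compare (inj₁ a) (inj₂ b) _ (inj₂ m<p) _ = ⊥-elim (free FA V∈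
          (triad l<m m<p Al (∌! l) Am (∋! m) a (V∌ np b)))
          where open V₀₁₁
        compare (inj₂ a) (inj₁ b) (inj₁ p<l) _ _ = ⊥-elim (free V∈ FA
          (triad p<l l<m (V∋ np b) a (∌! l) Al (∋! m) Am))
          where open V₀₁₁
        compare (inj₂ a) (inj₁ b) (inj₂ l<p) _ (inj₁ p<h) = ⊥-elim (free FA V∈
          (triad l<p p<h Al (∌! l) a (V∋ np b) Ah (∌! h)))
          where open V₀₀₀
        compare (inj₂ a) (inj₁ b) _ _ (inj₂ h<p) = ⊥-elim (free V∈ FA
          (triad m<h h<p (∋! m) Am (∌! h) Ah (V∋ np b) a))
          where open V₁₁₀

      peak-agree : ∀ {A} → F A → Peak A σ → Agree σ A B
      peak-agree {A} FA (Al , Am , Ah) p p≢lo p≢mid p≢hi = compare (∋? A p) (∋? B p) (<-total p≢lo) (<-total p≢mid) (<-total p≢hi)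
        where
        np : ¬ p ∈₃ σ
        np (isLo e) = p≢lo e
        np (isMid e) = p≢mid e
        np (isHi e) = p≢hi e
        l<m = proj₁ inc
        m<h = proj₂ inc
        compare : A ∋ p ⊎ A ∌ p → B ∋ p ⊎ B ∌ p → p < lo σ ⊎ lo σ < p → p < mid σ ⊎ mid σ < p → p < hi σ ⊎ hi σ < p →
          lookup A p ≡ lookup B p
        compare (inj₁ a) (inj₁ b) _ _ _ = trans (on a) (sym (on b))
        compare (inj₂ a) (inj₂ b) _ _ _ = trans (off a) (sym (off b))
        compare (inj₂ a) (inj₁ b) _ (inj₁ p<m) _ = ⊥-elim (free V∈ FA
          (triad p<m m<h (V∋ np b) a (∌! m) Am (∋! h) Ah))
          where open V₀₀₁
        compare (inj₂ a) (inj₁ b) _ (inj₂ m<p) _ = ⊥-elim (free V∈ FA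
          (triad l<m m<p (∋! l) Al (∌! m) Am (V∋ np b) a))
          where open V₁₀₀
        compare (inj₁ a) (inj₂ b) (inj₁ p<l) _ _ = ⊥-elim (free FA V∈
          (triad p<l l<m a (V∌ np b) Al (∋! l) Am (∌! m)))
          where open V₁₀₀
        compare (inj₁ a) (inj₂ b) (inj₂ l<p) _ (inj₁ p<h) = ⊥-elim (free V∈ FA
          (triad l<p p<h (∋! l) Al (V∌ np b) a (∋! h) Ah))
          where open V₁₁₁
        compare (inj₁ a) (inj₂ b) _ _ (inj₂ h<p) = ⊥-elim (free FA V∈
          (triad m<h h<p Am (∌! m) Ah (∋! h) a (V∌ np b)))
          where open V₀₀₁

    module _ {B : Subset n} where

      lower-< : ∀ {x y q X} → LowerFace σ B x y q X → x < y
      lower-< (face-lo-mid _ _) = proj₁ inc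
      lower-< (face-mid-hi _ _) = proj₂ inc
      lower-< (face-lo-hi _ _) = <-trans (proj₁ inc) (proj₂ inc)

      lower-place : ∀ {x y q X} → LowerFace σ B x y q X → place x y q ≡ σ
      lower-place (face-lo-mid _ _) = place-right (proj₁ inc) (proj₂ inc)
      lower-place (face-mid-hi _ _) = place-left (proj₁ inc)
      lower-place (face-lo-hi _ _) = place-inside (proj₁ inc) (proj₂ inc)

      lower-uncrossed : ∀ {x y q X} → LowerFace σ B x y q X → Uncrossed x y X q
      lower-uncrossed (face-lo-mid _ h) = right (proj₂ inc) h
      lower-uncrossed (face-mid-hi _ h) = left (proj₁ inc) h
      lower-uncrossed (face-lo-hi _ h) = inside (proj₁ inc) (proj₂ inc) h

      upper-crossed : ∀ {x y q X} → LowerFace σ B x y q X → Crossed x y (toggle q X) q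
      upper-crossed {X = X} (face-lo-mid _ h) = right (proj₂ inc) (∋! (trans (toggle-on _ X) (cong not (off h))))
      upper-crossed {X = X} (face-mid-hi _ h) = left (proj₁ inc) (∋! (trans (toggle-on _ X) (cong not (off h))))
      upper-crossed {X = X} (face-lo-hi _ h) = inside (proj₁ inc) (proj₂ inc) (∌! (trans (toggle-on _ X) (cong not (on h))))

      lower-face : ∀ {x y q X} → LowerFace σ B x y q X → Face (Lower σ B) x y X
      lower-face (face-lo-mid agree h) V ag = (λ p a b c → trans (ag p a b) (agree p a b c))
        , λ (_ , _ , Vh) → ∋∌-absurd Vh (∌-resp (ag _ (lo≢hi ∘ sym) (mid≢hi ∘ sym)) h)
      lower-face (face-mid-hi agree h) V ag = (λ p a b c → trans (ag p b c) (agree p a b c))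
        , λ (Vl , _ , _) → ∋∌-absurd Vl (∌-resp (ag _ lo≢mid lo≢hi) h)
      lower-face (face-lo-hi agree h) V ag = (λ p a b c → trans (ag p a c) (agree p a b c))
        , λ (_ , Vm , _) → ∋∌-absurd (∋-resp (ag _ (lo≢mid ∘ sym) mid≢hi) h) Vm

      upper-agree : ∀ {x y q X} → LowerFace σ B x y q X → ∀ {V} → Agree₂ x y V (toggle q X) → Agree σ V B
      upper-agree {X = X} (face-lo-mid agree _) ag p a b c = trans (ag p a b) (trans (toggle-off X c) (agree p a b c))
      upper-agree {X = X} (face-mid-hi agree _) ag p a b c = trans (ag p b c) (trans (toggle-off X a) (agree p a b c))
      upper-agree {X = X} (face-lo-hi agree _) ag p a b c = trans (ag p a c) (trans (toggle-off X b) (agree p a b c))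

      lower-covered : ∀ {V} → Lower σ B V → ∃ λ x → ∃ λ y → ∃ λ q → LowerFace σ B x y q V
      lower-covered {V} (agree , ¬dip) with ∋? V (lo σ) | ∋? V (mid σ) | ∋? V (hi σ)
      ... | _ | _ | inj₂ h = _ , _ , _ , face-lo-mid agree h
      ... | inj₂ h | _ | inj₁ _ = _ , _ , _ , face-mid-hi agree h
      ... | inj₁ _ | inj₁ h | inj₁ _ = _ , _ , _ , face-lo-hi agree h
      ... | inj₁ a | inj₂ b | inj₁ c = ⊥-elim (¬dip (a , b , c))

-- Collections of maximal size

module _ {x y p : Fin n} (x<y : x < y) where

  crossed-≢ : ∀ {X} → Crossed x y X p → p ≢ x × p ≢ y
  crossed-≢ (left p<x _) = <⇒≢ p<x , <⇒≢ (<-trans p<x x<y)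
  crossed-≢ (inside x<p p<y _) = (>⇒≢ x<p) , <⇒≢ p<y
  crossed-≢ (right y<p _) = (>⇒≢ (<-trans x<y y<p)) , (>⇒≢ y<p)

  uncrossed-≢ : ∀ {X} → Uncrossed x y X p → p ≢ x × p ≢ y
  uncrossed-≢ (left p<x _) = <⇒≢ p<x , <⇒≢ (<-trans p<x x<y)
  uncrossed-≢ (inside x<p p<y _) = (>⇒≢ x<p) , <⇒≢ p<y
  uncrossed-≢ (right y<p _) = (>⇒≢ (<-trans x<y y<p)) , (>⇒≢ y<p)

  private
    inner : Bool
    inner = ⌊ (x <? p) ×-dec (p <? y) ⌋

    inner-yes : x < p → p < y → inner ≡ true
    inner-yes x<p p<y with x <? p | p <? y
    ... | yes _ | yes _ = refl
    ... | no h  | _     = ⊥-elim (h x<p)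
    ... | yes _ | no h  = ⊥-elim (h p<y)

    inner-no : p < x ⊎ y < p → inner ≡ false
    inner-no out with x <? p | p <? y | out
    ... | no _  | _     | _ = refl
    ... | yes _ | no _  | _ = refl
    ... | yes h | yes _ | inj₁ p<x = ⊥-elim (<-asym h p<x)
    ... | yes _ | yes h | inj₂ y<p = ⊥-elim (<-asym h y<p)

    crossed-value : ∀ {X} → Crossed x y X p → lookup X p ≡ not inner
    crossed-value (left p<x h) = trans (on h) (cong not (sym (inner-no (inj₁ p<x))))
    crossed-value (inside x<p p<y h) = trans (off h) (cong not (sym (inner-yes x<p p<y)))
    crossed-value (right y<p h) = trans (on h) (cong not (sym (inner-no (inj₂ y<p))))

    uncrossed-value : ∀ {X} → Uncrossed x y X p → lookup X p ≡ inner
    uncrossed-value (left p<x h) = trans (off h) (sym (inner-no (inj₁ p<x)))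
    uncrossed-value (inside x<p p<y h) = trans (on h) (sym (inner-yes x<p p<y))
    uncrossed-value (right y<p h) = trans (off h) (sym (inner-no (inj₂ y<p)))

  crossed-same : ∀ {X Y} → Crossed x y X p → Crossed x y Y p → lookup X p ≡ lookup Y p
  crossed-same h k = trans (crossed-value h) (sym (crossed-value k))

  uncrossed-same : ∀ {X Y} → Uncrossed x y X p → Uncrossed x y Y p → lookup X p ≡ lookup Y p
  uncrossed-same h k = trans (uncrossed-value h) (sym (uncrossed-value k))

count-member : ∀ (F : Collection n) A → T (F A) → 1 ℕ.≤ count F
count-member F [] FA with F []
... | true = ℕ.≤-refl
count-member F (false ∷ A) FA = ℕ.≤-trans (count-member (F ∘ (false ∷_)) A FA) (ℕ.m≤m+n _ _)
count-member F (true ∷ A) FA = ℕ.≤-trans (count-member (F ∘ (true ∷_)) A FA) (ℕ.m≤n+m _ _)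

singleton : Subset n → Collection n
singleton A B = ⌊ B ≟ˢ A ⌋

singleton-≥ : (A : Subset n) → 1 ℕ.≤ count (singleton A)
singleton-≥ A = count-member (singleton A) A (fromWitness {a? = A ≟ˢ A} refl)

singleton-≤ : (A : Subset n) → count (singleton A) ℕ.≤ 1
singleton-≤ A = count-unique (singleton A) λ B B′ h h′ → trans (toWitness {a? = B ≟ˢ A} h) (sym (toWitness {a? = B′ ≟ˢ A} h′))

dip? : (A : Subset n) (σ : Triple n) → Dec (Dip A σ)
dip? A σ = map′ (λ (a , b , c) → ∋! a , ∌! b , ∋! c) (λ (a , b , c) → on a , off b , on c)
  ((lookup A (lo σ) ≟ᵇ true) ×-dec ((lookup A (mid σ) ≟ᵇ false) ×-dec (lookup A (hi σ) ≟ᵇ true)))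

peak? : (A : Subset n) (σ : Triple n) → Dec (Peak A σ)
peak? A σ = map′ (λ (a , b , c) → ∌! a , ∋! b , ∌! c) (λ (a , b , c) → off a , on b , off c)
  ((lookup A (lo σ) ≟ᵇ false) ×-dec ((lookup A (mid σ) ≟ᵇ true) ×-dec (lookup A (hi σ) ≟ᵇ false)))

increasing? : (σ : Triple n) → Dec (Increasing σ)
increasing? σ = (lo σ <? mid σ) ×-dec (mid σ <? hi σ)

hasDip? : (F : Collection n) (σ : Triple n) → Dec (HasDip ⟦ F ⟧ σ)
hasDip? F σ = anySubset? λ A → T? (F A) ×-dec dip? A σ

all-triples? : {P : Triple n → Set} → (∀ σ → Dec (P σ)) → Dec (∀ σ → P σ)
all-triples? P? = map′ (λ h σ → h (lo σ) (mid σ) (hi σ)) (λ h a b c → h ⟨ a , b , c ⟩)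
  (all? λ a → all? λ b → all? λ c → P? ⟨ a , b , c ⟩)

any-triple? : {P : Triple n → Set} → (∀ σ → Dec (P σ)) → Dec (∃ P)
any-triple? P? = map′ (λ (a , b , c , h) → ⟨ a , b , c ⟩ , h) (λ (σ , h) → lo σ , mid σ , hi σ , h)
  (any? λ a → any? λ b → any? λ c → P? ⟨ a , b , c ⟩)

module Families {C : Collection n} (isMaximal : IsMaximalChordSeparated C) where

  separated : ∀ {A B} → ⟦ C ⟧ A → ⟦ C ⟧ B → ¬ Alternate A B
  separated = chordSeparated-¬alternate (proj₁ isMaximal)

  C? : ∀ A → Dec (⟦ C ⟧ A)
  C? A = T? (C A)

  -- A base for the cube of every triple; the empty set is a dummy for triples that are not
  -- increasing. Only its values off the triple matter.
  bottom : Triple n → Subset n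
  bottom σ with increasing? σ
  ... | yes (l , h) = proj₁ (cubes ⟦ C ⟧ C? separated (maximal-absorbs isMaximal) l h)
  ... | no _ = Sub.⊥

  cube : ∀ {σ} → Increasing σ → Cube ⟦ C ⟧ (lo σ) (mid σ) (hi σ) (bottom σ)
  cube {σ} inc with increasing? σ
  ... | yes (l , h) = proj₂ (cubes ⟦ C ⟧ C? separated (maximal-absorbs isMaximal) l h)
  ... | no ¬inc = ⊥-elim (¬inc inc)

  height : Triple n → ℕ
  height σ = rank (word (lo σ) (mid σ) (hi σ) (bottom σ))

  height-< : ∀ {σ τ V} → Increasing σ → Increasing τ → Agree σ V (bottom σ) → Dip V τ → τ ≢ σ →
    height τ ℕ.< height σ
  height-< {σ} {τ} incσ incτ agree (a , b , c) τ≢σ = cubes-rank separated (proj₁ incσ) (proj₂ incσ)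
    {X = bottom σ} (cube incσ) (proj₁ incτ) (proj₂ incτ) {Y = bottom τ} (cube incτ) agree a b c
    λ { (refl , refl , refl) → τ≢σ refl }

  height-injective : ∀ {σ τ} → Increasing σ → Increasing τ → height σ ≡ height τ → τ ≡ σ
  height-injective {σ} {τ} incσ incτ e with rank-injective separated (proj₁ incσ) (proj₂ incσ)
    {X = bottom σ} (cube incσ) (proj₁ incτ) (proj₂ incτ) {Y = bottom τ} (cube incτ) e
  ... | refl , refl , refl = refl

  Closed : (Triple n → Set) → Set
  Closed J = ∀ {σ} → Increasing σ → J σ → ∀ {x y q X} → LowerFace σ (bottom σ) x y q X →
    ∀ {p} → Crossed x y X p → J (place x y p)

  -- The lower face consists of vertices of the cube of `σ`, so the dip that `p` causes on it is
  -- shown by such a vertex. That vertex has no dip on `σ`, hence the two triples are distinct.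
  predecessor-< : ∀ {σ x y q X p} → Increasing σ → LowerFace σ (bottom σ) x y q X → Crossed x y X p →
    height (place x y p) ℕ.< height σ
  predecessor-< incσ lf cr with crossed-dip (lower-< incσ lf) (lower-face incσ lf) cr
  ... | V , (agree , ¬dip) , dip = height-< incσ (crossed-increasing (lower-< incσ lf) cr) agree dip
    λ e → ¬dip (subst (Dip V) e dip)

  record Full (F : Collection n) : Set where
    field
      inside-C : ∀ {A} → ⟦ F ⟧ A → ⟦ C ⟧ A
      free     : TriadFree F
      large    : maxCount n ℕ.≤ count F

    dip-peak-exclusive : ∀ {σ} → Increasing σ → HasDip ⟦ F ⟧ σ → HasPeak ⟦ F ⟧ σ → ⊥
    dip-peak-exclusive inc (A , FA , dip) (B , FB , peak) = free FA FB (dip-peak-triad inc dip peak)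

    dip-or-peak : ∀ {σ} → Increasing σ → HasDip ⟦ F ⟧ σ ⊎ HasPeak ⟦ F ⟧ σ
    dip-or-peak {σ} (l , h) with face-exists F free large (<⇒≢ l)
    ... | Y , face with crossed? Y (hi σ) (>⇒≢ (<-trans l h)) (>⇒≢ h)
    ... | inj₁ c = inj₁ (subst (HasDip ⟦ F ⟧) (place-right l h) (crossed-dip l face c))
    ... | inj₂ u = inj₂ (subst (HasPeak ⟦ F ⟧) (place-right l h) (uncrossed-peak l face u))

    -- `F` has its own face at {x, y}. A dip on `σ` means that this face has crossed `q`, which the
    -- lower face of the cube has not; both lie on one line in `C`, so the face of `F` has crossed
    -- everything the lower face has.
    dips-closed : Closed (HasDip ⟦ F ⟧)
    dips-closed incσ hasDip {x} {y} {q} {X} lf {p} Xp with face-exists F free large (<⇒≢ (lower-< incσ lf))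
    ... | Y , face with crossed? Y p (proj₁ (crossed-≢ x<y Xp)) (proj₂ (crossed-≢ x<y Xp))
                      | crossed? Y q (proj₁ (uncrossed-≢ x<y Xq)) (proj₂ (uncrossed-≢ x<y Xq))
      where
      x<y = lower-< incσ lf
      Xq = lower-uncrossed incσ lf
    ... | inj₁ Yp | _ = crossed-dip (lower-< incσ lf) face Yp
    ... | inj₂ _ | inj₂ Yq = ⊥-elim (dip-peak-exclusive incσ hasDip
            (subst (HasPeak ⟦ F ⟧) (lower-place incσ lf) (uncrossed-peak (lower-< incσ lf) face Yq)))
    ... | inj₂ Yp | inj₁ Yq = ⊥-elim (faces-comparable separated (lower-< incσ lf)
            (λ V agree → cube incσ V (proj₁ (lower-face incσ lf V agree)))
            (λ V agree → inside-C (face V agree)) Xp Yp Yq (lower-uncrossed incσ lf))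

    -- The face of `F` at {x, y} must be the lower face itself. It has crossed no less because of
    -- the dips on the predecessors. It has crossed no more because otherwise, compared with the
    -- opposite face of the cube, it would have to have crossed `q` too, a dip on `σ`.
    lower-filled : ∀ {σ} → Increasing σ → ¬ HasDip ⟦ F ⟧ σ →
      (∀ {x y q X} → LowerFace σ (bottom σ) x y q X → ∀ {p} → Crossed x y X p → HasDip ⟦ F ⟧ (place x y p)) →
      ∀ {V} → Lower σ (bottom σ) V → ⟦ F ⟧ V
    lower-filled {σ} incσ ¬dip predecessors {V} low with lower-covered incσ low
    ... | x , y , q , lf with face-exists F free large (<⇒≢ (lower-< incσ lf))
    ... | Y , face = face V agree
      where
      x<y : x < y
      x<y = lower-< incσ lf
      Vq : Uncrossed x y V q
      Vq = lower-uncrossed incσ lf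
      Yq : Uncrossed x y Y q
      Yq with crossed? Y q (proj₁ (uncrossed-≢ x<y Vq)) (proj₂ (uncrossed-≢ x<y Vq))
      ... | inj₁ h = ⊥-elim (¬dip (subst (HasDip ⟦ F ⟧) (lower-place incσ lf) (crossed-dip x<y face h)))
      ... | inj₂ h = h
      agree : Agree₂ x y V Y
      agree p p≢x p≢y with crossed? V p p≢x p≢y | crossed? Y p p≢x p≢y
      ... | inj₁ h | inj₁ k = crossed-same x<y h k
      ... | inj₂ h | inj₂ k = uncrossed-same x<y h k
      ... | inj₁ h | inj₂ k = ⊥-elim (dip-peak-exclusive (crossed-increasing x<y h) (predecessors lf h)
              (uncrossed-peak x<y face k))
      ... | inj₂ h | inj₁ k with p ≟ q
      ... | yes refl = ⊥-elim (crossed-uncrossed x<y k Yq)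
      ... | no p≢q = ⊥-elim (faces-comparable separated x<y {X = toggle q V} {Y}
              (λ W ag → cube incσ W (upper-agree incσ lf {W} ag)) (λ W ag → inside-C (face W ag))
              (upper-crossed incσ lf) Yq k (Uncrossed-resp (toggle-off V p≢q) h))

    -- Adding a compatible set that is absent would exceed the bound on triad-free collections.
    triad-complete : ∀ A → (∀ {B} → ⟦ F ⟧ B → ¬ Triad A B × ¬ Triad B A) → ⟦ F ⟧ A
    triad-complete A compatible with T? (F A)
    ... | yes FA = FA
    ... | no ¬FA = ⊥-elim (ℕ.<⇒≱ larger (triadFree-count F⁺ free⁺))
      where
      F⁺ : Collection n
      F⁺ B = F B ∨ singleton A B
      free⁺ : TriadFree F⁺
      free⁺ {B} {B′} h h′ t with Equivalence.to (T-∨ {F B}) h | Equivalence.to (T-∨ {F B′}) h′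
      ... | inj₁ k | inj₁ k′ = free k k′ t
      ... | inj₁ k | inj₂ e with refl ← toWitness {a? = B′ ≟ˢ A} e = proj₂ (compatible k) t
      ... | inj₂ e | inj₁ k with refl ← toWitness {a? = B ≟ˢ A} e = proj₁ (compatible k) t
      free⁺ h h′ (triad _ _ a a′ _ _ _ _) | inj₂ e | inj₂ e′
        with refl ← toWitness {a? = _ ≟ˢ A} e | refl ← toWitness {a? = _ ≟ˢ A} e′ = ∋∌-absurd a a′
      open ℕ.≤-Reasoning
      larger : maxCount n ℕ.< count F⁺
      larger = begin-strict
        maxCount n                                              ≤⟨ large ⟩
        count F                                                 <⟨ ℕ.m<m+n (count F) (singleton-≥ A) ⟩
        count F ℕ.+ count (singleton A)                         ≡⟨ total-+ (bit ∘ F) (bit ∘ singleton A) ⟨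
        total (λ B → bit (F B) ℕ.+ bit (singleton A B))         ≤⟨ total-mono disjoint ⟩
        count F⁺                                                ∎
        where
        disjoint : ∀ B → bit (F B) ℕ.+ bit (singleton A B) ℕ.≤ bit (F⁺ B)
        disjoint B with F B in e | B ≟ˢ A
        ... | false | _        = ℕ.≤-refl
        ... | true  | no _     = ℕ.≤-refl
        ... | true  | yes refl = ⊥-elim (¬FA (subst T (sym e) _))

-- Realisation of closed sets of triples

bit-mono : ∀ {a b} → (T a → T b) → bit a ℕ.≤ bit b
bit-mono {false} h = z≤n
bit-mono {true} {true} h = ℕ.≤-refl
bit-mono {true} {false} h = ⊥-elim (h _)

count-mono : (F G : Collection n) → (∀ A → T (F A) → T (G A)) → count F ℕ.≤ count G
count-mono F G h = total-mono λ A → bit-mono (h A)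

convex-triadFree : TriadFree (Convex.convex {n})
convex-triadFree {A = A} FA _ (triad ab bc Aa _ Ab _ Ac _) = Convex.convex-sound A FA ab bc Aa Ab Ac

module Flips {C : Collection n} (isMaximal : IsMaximalChordSeparated C) where
  open Families isMaximal public

  -- Candidates for the collection with dips exactly on `J`. They are defined and triad-free for
  -- every `J`; whether there are enough of them for maximal size is the question of realisation.
  Compatible Member : (Triple n → Set) → Subset n → Set
  Compatible J A = ∀ σ → Increasing σ → (Dip A σ → J σ) × (Peak A σ → ¬ J σ)
  Member J A = ⟦ C ⟧ A × Compatible J A

  member-triadFree : ∀ {J A B} → Member J A → Member J B → ¬ Triad A B
  member-triadFree (_ , cA) (_ , cB) (triad {a} {b} {c} ab bc a₁ a₂ b₁ b₂ c₁ c₂) =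
    proj₂ (cB ⟨ a , b , c ⟩ (ab , bc)) (a₂ , b₂ , c₂) (proj₁ (cA ⟨ a , b , c ⟩ (ab , bc)) (a₁ , b₁ , c₁))

  member-resp : ∀ {J K A} → (∀ {σ} → Increasing σ → J σ → K σ) → (∀ {σ} → Increasing σ → K σ → J σ) →
    Member J A → Member K A
  member-resp to from (CA , cA) = CA , λ σ inc →
    to inc ∘ proj₁ (cA σ inc) , λ peak Kσ → proj₂ (cA σ inc) peak (from inc Kσ)

  module _ {J : Triple n → Set} (J? : ∀ σ → Dec (J σ)) where

    member? : ∀ A → Dec (Member J A)
    member? A = C? A ×-dec all-triples? λ σ → increasing? σ →-dec
      ((dip? A σ →-dec J? σ) ×-dec (peak? A σ →-dec ¬? (J? σ)))

    family : Collection n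
    family A = ⌊ member? A ⌋

    family⁺ : ∀ {A} → Member J A → ⟦ family ⟧ A
    family⁺ {A} = fromWitness {a? = member? A}

    family⁻ : ∀ {A} → ⟦ family ⟧ A → Member J A
    family⁻ {A} = toWitness {a? = member? A}

    family-full : maxCount n ℕ.≤ count family → Full family
    family-full large = record
      { inside-C = proj₁ ∘ family⁻
      ; free = λ hA hB → member-triadFree {J} (family⁻ hA) (family⁻ hB)
      ; large = large }

    family-dips⁻ : ∀ {σ} → Increasing σ → HasDip ⟦ family ⟧ σ → J σ
    family-dips⁻ inc (A , FA , dip) = proj₁ (proj₂ (family⁻ FA) _ inc) dip

    family-dips⁺ : Full family → ∀ {σ} → Increasing σ → J σ → HasDip ⟦ family ⟧ σ
    family-dips⁺ full inc Jσ with Full.dip-or-peak full inc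
    ... | inj₁ h = h
    ... | inj₂ (A , FA , peak) = ⊥-elim (proj₂ (proj₂ (family⁻ FA) _ inc) peak Jσ)

  module _ {F : Collection n} (full : Full F) where
    open Full full

    full-member⁺ : ∀ {A} → ⟦ F ⟧ A → Member (HasDip ⟦ F ⟧) A
    full-member⁺ {A} FA = inside-C FA , λ σ inc →
      (λ dip → A , FA , dip) , (λ peak hasDip → dip-peak-exclusive inc hasDip (A , FA , peak))

    full-member⁻ : ∀ {A} → Member (HasDip ⟦ F ⟧) A → ⟦ F ⟧ A
    full-member⁻ {A} m = triad-complete A λ FB →
      member-triadFree m (full-member⁺ FB) , member-triadFree (full-member⁺ FB) m

  module Flip {L M : Triple n → Set} {σ} (inc : Increasing σ) (L⊆M : ∀ {τ} → Increasing τ → L τ → M τ)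
    (M⊆ : ∀ {τ} → Increasing τ → M τ → L τ ⊎ τ ≡ σ) (Mσ : M σ) (¬Lσ : ¬ L σ)
    (lower : ∀ {V} → Lower σ (bottom σ) V → Member L V) where

    v u : Subset n
    v = peakOf inc (bottom σ)
    u = dipOf inc (bottom σ)

    hexagon : ∀ {V} → Hexagon σ (bottom σ) V → Member L V
    hexagon {V} hex = lower (hexagon-lower {B = bottom σ} {V} hex)

    keep : ∀ {A} → Member L A → ¬ Peak A σ → Member M A
    keep {A} (CA , cA) ¬peak = CA , λ τ incτ → (L⊆M incτ ∘ proj₁ (cA τ incτ)) , λ peak Mτ → excluded incτ peak (M⊆ incτ Mτ)
      where
      excluded : ∀ {τ} → Increasing τ → Peak A τ → L τ ⊎ τ ≡ σ → ⊥
      excluded incτ peak (inj₁ Lτ) = proj₂ (cA _ incτ) peak Lτ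
      excluded incτ peak (inj₂ refl) = ¬peak peak

    -- On a triple other than `σ`, the dip vertex shows only what some witness shows, and the
    -- witnesses are members for `M`. On `σ` itself its dip is allowed by `Mσ`.
    u∈M : Member M u
    u∈M = cube inc u (vertex-agree inc (bottom σ) _ _ _) , compatible
      where
      compatible : Compatible M u
      compatible τ incτ with τ ≟₃ σ
      ... | yes refl = (λ _ → Mσ) , λ peak _ → dip-peak (dipOf-dip inc (bottom σ)) peak
      ... | no τ≢σ with hexagon-transfer inc {bottom σ} {u} incτ τ≢σ (vertex-agree inc (bottom σ) _ _ _) (inj₁ (dipOf-dip inc (bottom σ)))
      ... | W , hex , same with keep (hexagon {W} hex) (proj₂ (proj₂ hex))
      ... | _ , cW = (λ dip → proj₁ (cW τ incτ) (dip-resp {V = u} {W} same dip)) , λ peak → proj₂ (cW τ incτ) (peak-resp {V = u} {W} same peak)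

    flip⁻ : ∀ {A} → Member L A → A ≢ v → Member M A
    flip⁻ {A} m A≢v = keep m λ peak → A≢v (ext₃ {V = A} {v} {bottom σ} (peak-agree inc {F = Member L} member-triadFree {B = bottom σ} (λ {V} → hexagon {V}) m peak)
      (vertex-agree inc (bottom σ) _ _ _) (same-peak {V = A} {v} peak (peakOf-peak inc (bottom σ))))

    flip⁺ : ∀ {A} → Member M A → (Member L A × A ≢ v) ⊎ A ≡ u
    flip⁺ {A} m with dip? A σ
    ... | yes dip = inj₂ (ext₃ {V = A} {u} {bottom σ} (dip-agree inc {F = Member M} member-triadFree {B = bottom σ}
            (λ {V} hex → keep (hexagon {V} hex) (proj₂ (proj₂ hex))) m dip)
            (vertex-agree inc (bottom σ) _ _ _) (same-dip {V = A} {u} dip (dipOf-dip inc (bottom σ))))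
    ... | no ¬dip = inj₁ ((proj₁ m , compatible) , λ { refl → proj₂ (proj₂ m σ inc) (peakOf-peak inc (bottom σ)) Mσ })
      where
      compatible : Compatible L A
      compatible τ incτ = old , λ peak Lτ → proj₂ (proj₂ m τ incτ) peak (L⊆M incτ Lτ)
        where
        old : Dip A τ → L τ
        old dip with M⊆ incτ (proj₁ (proj₂ m τ incτ) dip)
        ... | inj₁ Lτ = Lτ
        ... | inj₂ refl = ⊥-elim (¬dip dip)

    -- Adding the indicator of `u` on one side and that of `v` on the other turns the exchange of
    -- the two sets into a pointwise inequality.
    flip-count : (L? : ∀ σ → Dec (L σ)) (M? : ∀ σ → Dec (M σ)) → count (family L?) ℕ.≤ count (family M?)
    flip-count L? M? = ℕ.+-cancelʳ-≤ 1 _ _ (begin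
      count F ℕ.+ 1                                     ≤⟨ ℕ.+-monoʳ-≤ (count F) (singleton-≥ u) ⟩
      count F ℕ.+ count (singleton u)                   ≡⟨ total-+ (bit ∘ F) (bit ∘ singleton u) ⟨
      total (λ A → bit (F A) ℕ.+ bit (singleton u A))   ≤⟨ total-mono pointwise ⟩
      total (λ A → bit (G A) ℕ.+ bit (singleton v A))   ≡⟨ total-+ (bit ∘ G) (bit ∘ singleton v) ⟩
      count G ℕ.+ count (singleton v)                   ≤⟨ ℕ.+-monoʳ-≤ (count G) (singleton-≤ v) ⟩
      count G ℕ.+ 1                                     ∎)
      where
      open ℕ.≤-Reasoning
      F G : Collection n
      F = family L?
      G = family M?
      pointwise : ∀ A → bit (F A) ℕ.+ bit (singleton u A) ℕ.≤ bit (G A) ℕ.+ bit (singleton v A)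
      pointwise A with member? L? A | member? M? A | A ≟ˢ u | A ≟ˢ v
      ... | yes m | _     | yes refl | _    = ⊥-elim (¬Lσ (proj₁ (proj₂ m σ inc) (dipOf-dip inc (bottom σ))))
      ... | yes m | yes _ | no _  | _       = s≤s z≤n
      ... | yes m | no ¬m | no _  | yes _   = s≤s z≤n
      ... | yes m | no ¬m | no _  | no A≢v  = ⊥-elim (¬m (flip⁻ m A≢v))
      ... | no _  | yes _ | yes _ | _       = s≤s z≤n
      ... | no _  | no ¬m | yes refl | _    = ⊥-elim (¬m u∈M)
      ... | no _  | _     | no _  | _       = z≤n

  module Realisation {J : Triple n → Set} (J? : ∀ σ → Dec (J σ)) (closed : Closed J) where

    Below : ℕ → Triple n → Set
    Below r σ = J σ × height σ ℕ.< r

    below? : ∀ r σ → Dec (Below r σ)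
    below? r σ = J? σ ×-dec (height σ ℕ.<? r)

    convex-below-0 : ∀ {A} → T (Convex.convex A) → Member (Below 0) A
    convex-below-0 {A} h = convex∈C ⟦ C ⟧ C? separated (maximal-absorbs isMaximal) A
        (λ ab bc Aa Ab Ac → Convex.convex-sound A h ab bc Aa Ab Ac)
      , λ σ (l , m) → (λ (a , b , c) → ⊥-elim (Convex.convex-sound A h l m a b c)) , λ { _ (_ , ()) }

    -- The flips across the cubes of J are performed in order of height.
    below-large : ∀ r → maxCount n ℕ.≤ count (family (below? r))
    below-large zero = subst (ℕ._≤ count (family (below? 0))) (Convex.count-convex n)
      (count-mono Convex.convex (family (below? 0)) λ A h → family⁺ (below? 0) (convex-below-0 h))
    below-large (suc r) with any-triple? (λ σ → increasing? σ ×-dec (J? σ ×-dec (height σ ℕ.≟ r)))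
    ... | no none = ℕ.≤-trans (below-large r) (count-mono (family (below? r)) (family (below? (suc r))) λ A h → family⁺ (below? (suc r))
            (member-resp {J = Below r} {Below (suc r)} (λ _ (Jσ , h<r) → Jσ , ℕ.m<n⇒m<1+n h<r) shrink (family⁻ (below? r) h)))
      where
      shrink : ∀ {σ} → Increasing σ → Below (suc r) σ → Below r σ
      shrink {σ} inc (Jσ , s≤s h≤r) with ℕ.m≤n⇒m<n∨m≡n h≤r
      ... | inj₁ h<r = Jσ , h<r
      ... | inj₂ h≡r = ⊥-elim (none (σ , inc , Jσ , h≡r))
    -- `σ` is the only triple of height `r` in `J`. Its predecessors are in `J` by closedness and
    -- have height below `r`, so they are dips of the collection reached so far, and `lower-filled`
    -- provides the lower side of the cube.
    ... | yes (σ , inc , Jσ , h≡r) = ℕ.≤-trans (below-large r) (Flip.flip-count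
            {L = Below r} {Below (suc r)} inc (λ _ (Jτ , h<r) → Jτ , ℕ.m<n⇒m<1+n h<r) only-σ (Jσ , s≤s (ℕ.≤-reflexive h≡r)) ¬below
            (λ {V} low → family⁻ (below? r) (Full.lower-filled full inc (¬below ∘ family-dips⁻ (below? r) inc)
              (λ lf cr → family-dips⁺ (below? r) full (crossed-increasing (lower-< inc lf) cr)
                (closed inc Jσ lf cr , subst (_ ℕ.<_) h≡r (predecessor-< inc lf cr))) low))
            (below? r) (below? (suc r)))
      where
      full : Full (family (below? r))
      full = family-full (below? r) (below-large r)
      ¬below : ¬ Below r σ
      ¬below (_ , h<r) = ℕ.<⇒≢ h<r h≡r
      only-σ : ∀ {τ} → Increasing τ → Below (suc r) τ → Below r τ ⊎ τ ≡ σ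
      only-σ incτ (Jτ , s≤s h≤r) with ℕ.m≤n⇒m<n∨m≡n h≤r
      ... | inj₁ h<r = inj₁ (Jτ , h<r)
      ... | inj₂ e = inj₂ (height-injective inc incτ (trans h≡r (sym e)))

    full : Full (family J?)
    -- Heights are numbers of `n` digits in base 3, so the bound `3 ^ n` excludes no triple.
    full = family-full J? (ℕ.≤-trans (below-large (3 ℕ.^ n)) (count-mono (family (below? (3 ℕ.^ n))) (family J?) λ A h → family⁺ J?
      (member-resp {J = Below (3 ℕ.^ n)} {J} (λ _ → proj₁) (λ {σ} _ Jσ → Jσ , rank-bound (word (lo σ) (mid σ) (hi σ) (bottom σ))) (family⁻ (below? (3 ℕ.^ n)) h))))

    dips⁺ : ∀ {σ} → Increasing σ → J σ → HasDip ⟦ family J? ⟧ σ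
    dips⁺ = family-dips⁺ J? full

    dips⁻ : ∀ {σ} → Increasing σ → HasDip ⟦ family J? ⟧ σ → J σ
    dips⁻ = family-dips⁻ J?

-- The lattice

module _ {σ : Triple n} (inc : Increasing σ) (B : Subset n) where

  vertex-unique : ∀ {V a b c} → Agree σ V B → lookup V (lo σ) ≡ a → lookup V (mid σ) ≡ b → lookup V (hi σ) ≡ c →
    V ≡ vertex inc B a b c
  vertex-unique {V} {a} {b} {c} agree l m h = ext₃ {V = V} {vertex inc B a b c} {B} agree (vertex-agree inc B a b c) λ
    { (isLo refl) → trans l (sym (vertex-lo inc B a b c))
    ; (isMid refl) → trans m (sym (vertex-mid inc B a b c))
    ; (isHi refl) → trans h (sym (vertex-hi inc B a b c)) }

  private
    agree-▷ : ∀ {V z} → z ∈₃ σ → Agree σ V B → Agree σ (V ▷ z) B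
    agree-▷ {V} {z} z∈ agree p p≢l p≢m p≢h = trans (▷-off V z (avoid z∈)) (agree p p≢l p≢m p≢h)
      where
      avoid : z ∈₃ σ → p ≢ z
      avoid (isLo refl) = p≢l
      avoid (isMid refl) = p≢m
      avoid (isHi refl) = p≢h

  module _ {a b c : Bool} where
    private
      V : Subset n
      V = vertex inc B a b c
      agree : Agree σ V B
      agree = vertex-agree inc B a b c

    vertex-▷-lo : V ▷ lo σ ≡ vertex inc B true b c
    vertex-▷-lo = vertex-unique (agree-▷ {V} (isLo refl) agree) (▷-on V _)
      (trans (▷-off V _ (lo≢mid inc ∘ sym)) (vertex-mid inc B a b c))
      (trans (▷-off V _ (lo≢hi inc ∘ sym)) (vertex-hi inc B a b c))

    vertex-▷-mid : V ▷ mid σ ≡ vertex inc B a true c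
    vertex-▷-mid = vertex-unique (agree-▷ {V} (isMid refl) agree)
      (trans (▷-off V _ (lo≢mid inc)) (vertex-lo inc B a b c)) (▷-on V _)
      (trans (▷-off V _ (mid≢hi inc ∘ sym)) (vertex-hi inc B a b c))

    vertex-▷-hi : V ▷ hi σ ≡ vertex inc B a b true
    vertex-▷-hi = vertex-unique (agree-▷ {V} (isHi refl) agree)
      (trans (▷-off V _ (lo≢hi inc)) (vertex-lo inc B a b c))
      (trans (▷-off V _ (mid≢hi inc)) (vertex-mid inc B a b c)) (▷-on V _)

    vertex-lower : ¬ (a ≡ true × b ≡ false × c ≡ true) → Lower σ B V
    vertex-lower h = agree , λ (x , y , z) → h
      ( trans (sym (vertex-lo inc B a b c)) (on x) , trans (sym (vertex-mid inc B a b c)) (off y)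
      , trans (sym (vertex-hi inc B a b c)) (on z))

module Order {C : Collection n} (isMaximal : IsMaximalChordSeparated C) where
  open Flips isMaximal

  -- The size of `S` is known only by comparison with other collections; comparing with the convex
  -- sets yields the explicit lower bound.
  full : (S : 𝐒* C) → Full (𝐒*.collection S)
  full S = record
    { inside-C = contained
    ; free = stronglySeparated⇒triadFree stronglySeparated
    ; large = subst₂ ℕ._≤_ (trans (size≡count (Convex.convex {n})) (Convex.count-convex n)) (size≡count collection)
        (maximalSize (Convex.convex {n}) (triadFree⇒stronglySeparated convex-triadFree)) }
    where open 𝐒* S

  Dips : 𝐒* C → Triple n → Set
  Dips S = HasDip (members S)

  dips? : ∀ S σ → Dec (Dips S σ)
  dips? S = hasDip? (𝐒*.collection S)

  infix 4 _≼_
  _≼_ : Rel (𝐒* C) 0ℓ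
  S ≼ S′ = ∀ {σ} → Increasing σ → Dips S σ → Dips S′ σ

  ⊆⇒≼ : ∀ {S S′} → (∀ {A} → members S A → members S′ A) → S ≼ S′
  ⊆⇒≼ S⊆S′ _ (A , SA , dip) = A , S⊆S′ SA , dip

  -- Dips determine the collection: by completeness its members are exactly the sets of `C`
  -- compatible with them.
  ≼-antisym : ∀ {S S′} → S ≼ S′ → S′ ≼ S → S ≈ S′
  ≼-antisym {S} {S′} h k =
      (λ SA → full-member⁻ (full S′) (member-resp {J = Dips S} {Dips S′} h k (full-member⁺ (full S) SA)))
    , (λ SA → full-member⁻ (full S) (member-resp {J = Dips S′} {Dips S} k h (full-member⁺ (full S′) SA)))

  module _ {J : Triple n → Set} (J? : ∀ σ → Dec (J σ)) (closed : Closed J) where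
    private
      module R = Realisation J? closed

    realise : 𝐒* C
    realise = record
      { collection = family J?
      ; contained = Full.inside-C R.full
      ; stronglySeparated = triadFree⇒stronglySeparated (Full.free R.full)
      ; maximalSize = λ F sep → subst₂ ℕ._≤_ (sym (size≡count F)) (sym (size≡count (family J?)))
          (ℕ.≤-trans (triadFree-count F (stronglySeparated⇒triadFree sep)) (Full.large R.full)) }

    realise⁺ : ∀ {σ} → Increasing σ → J σ → Dips realise σ
    realise⁺ = R.dips⁺

    realise⁻ : ∀ {σ} → Increasing σ → Dips realise σ → J σ
    realise⁻ = R.dips⁻

  closed-∪ : ∀ {J K} → Closed J → Closed K → Closed (λ σ → J σ ⊎ K σ)
  closed-∪ cJ cK inc (inj₁ h) lf cr = inj₁ (cJ inc h lf cr)
  closed-∪ cJ cK inc (inj₂ h) lf cr = inj₂ (cK inc h lf cr)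

  closed-∩ : ∀ {J K} → Closed J → Closed K → Closed (λ σ → J σ × K σ)
  closed-∩ cJ cK inc (h , k) lf cr = cJ inc h lf cr , cK inc k lf cr

  dips-closed : ∀ S → Closed (Dips S)
  dips-closed S = Full.dips-closed (full S)

  infixr 7 _⊓_
  infixr 6 _⊔_
  _⊔_ _⊓_ : 𝐒* C → 𝐒* C → 𝐒* C
  S ⊔ S′ = realise (λ σ → dips? S σ ⊎-dec dips? S′ σ) (closed-∪ (dips-closed S) (dips-closed S′))
  S ⊓ S′ = realise (λ σ → dips? S σ ×-dec dips? S′ σ) (closed-∩ (dips-closed S) (dips-closed S′))

  module _ (S S′ : 𝐒* C) where
    ⊔⁺ : ∀ {σ} → Increasing σ → Dips S σ ⊎ Dips S′ σ → Dips (S ⊔ S′) σ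
    ⊔⁺ = realise⁺ (λ σ → dips? S σ ⊎-dec dips? S′ σ) (closed-∪ (dips-closed S) (dips-closed S′))
    ⊔⁻ : ∀ {σ} → Increasing σ → Dips (S ⊔ S′) σ → Dips S σ ⊎ Dips S′ σ
    ⊔⁻ = realise⁻ (λ σ → dips? S σ ⊎-dec dips? S′ σ) (closed-∪ (dips-closed S) (dips-closed S′))
    ⊓⁺ : ∀ {σ} → Increasing σ → Dips S σ × Dips S′ σ → Dips (S ⊓ S′) σ
    ⊓⁺ = realise⁺ (λ σ → dips? S σ ×-dec dips? S′ σ) (closed-∩ (dips-closed S) (dips-closed S′))
    ⊓⁻ : ∀ {σ} → Increasing σ → Dips (S ⊓ S′) σ → Dips S σ × Dips S′ σ
    ⊓⁻ = realise⁻ (λ σ → dips? S σ ×-dec dips? S′ σ) (closed-∩ (dips-closed S) (dips-closed S′))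

  isDistributiveLattice : IsDistributiveLattice _≈_ _≼_ _⊔_ _⊓_
  isDistributiveLattice = record
    { isLattice = record
      { isPartialOrder = record
        { isPreorder = record
          { isEquivalence = record
            { refl = id , id
            ; sym = Product.swap
            ; trans = λ (a , b) (c , d) → (λ x → c (a x)) , (λ x → b (d x)) }
          ; reflexive = λ {S} {S′} (S⊆S′ , _) → ⊆⇒≼ {S} {S′} S⊆S′
          ; trans = λ h k inc d → k inc (h inc d) }
        ; antisym = λ {S} {S′} → ≼-antisym {S} {S′} }
      ; supremum = λ S S′ → (λ inc → ⊔⁺ S S′ inc ∘ inj₁) , (λ inc → ⊔⁺ S S′ inc ∘ inj₂)
          , λ _ h k inc → Sum.[ h inc , k inc ] ∘ ⊔⁻ S S′ inc
      ; infimum = λ S S′ → (λ inc → proj₁ ∘ ⊓⁻ S S′ inc) , (λ inc → proj₂ ∘ ⊓⁻ S S′ inc)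
          , λ _ h k inc d → ⊓⁺ S S′ inc (h inc d , k inc d) }
    ; ∧-distribˡ-∨ = λ S S′ S″ → ≼-antisym {S ⊓ (S′ ⊔ S″)} {(S ⊓ S′) ⊔ (S ⊓ S″)}
        (λ inc d → let (s , t) = ⊓⁻ S (S′ ⊔ S″) inc d in ⊔⁺ (S ⊓ S′) (S ⊓ S″) inc
          (Sum.map (λ t → ⊓⁺ S S′ inc (s , t)) (λ t → ⊓⁺ S S″ inc (s , t)) (⊔⁻ S′ S″ inc t)))
        (λ inc d → ⊓⁺ S (S′ ⊔ S″) inc (Sum.[ (λ d → let (s , t) = ⊓⁻ S S′ inc d in s , ⊔⁺ S′ S″ inc (inj₁ t))
                                          , (λ d → let (s , t) = ⊓⁻ S S″ inc d in s , ⊔⁺ S′ S″ inc (inj₂ t)) ]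
          (⊔⁻ (S ⊓ S′) (S ⊓ S″) inc d))) }

  -- Realises the empty set of triples. Its members are the sets of `C` without dips, that is, the
  -- convex ones, and `C` contains all convex sets. The maximum is dual, with all triples and
  -- coconvex sets.
  minimum : ∃[ S ] (members S ≐ 𝓘 n × Minimum _≼_ S)
  minimum = realise {J = λ _ → ⊥} (λ _ → no id) (λ _ ()) , (to , from)
    , λ _ inc d → ⊥-elim (realise⁻ (λ _ → no id) (λ _ ()) inc d)
    where
    to : ∀ {A} → ⟦ family {J = λ _ → ⊥} (λ _ → no id) ⟧ A → 𝓘 n A
    to {A} h = convex-𝓘 λ ab bc a b c → proj₁ (proj₂ (family⁻ {J = λ _ → ⊥} (λ _ → no id) {A} h) _ (ab , bc)) (a , b , c)
    from : ∀ {A} → 𝓘 n A → ⟦ family {J = λ _ → ⊥} (λ _ → no id) ⟧ A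
    from {A} h = family⁺ {J = λ _ → ⊥} (λ _ → no id) {A}
      (convex∈C ⟦ C ⟧ C? separated (maximal-absorbs isMaximal) A (𝓘-convex h)
      , λ σ (l , m) → (λ (a , b , c) → 𝓘-convex h l m a b c) , λ _ ())

  maximum : ∃[ S ] (members S ≐ co-𝓘 n × Maximum _≼_ S)
  maximum = realise {J = λ _ → ⊤} (λ _ → yes tt) (λ _ _ _ _ → tt) , (to , from)
    , λ _ inc _ → realise⁺ (λ _ → yes tt) (λ _ _ _ _ → tt) inc tt
    where
    to : ∀ {A} → ⟦ family {J = λ _ → ⊤} (λ _ → yes tt) ⟧ A → co-𝓘 n A
    to {A} h = coconvex-co-𝓘 λ ab bc a b c →
      proj₂ (proj₂ (family⁻ {J = λ _ → ⊤} (λ _ → yes tt) {A} h) _ (ab , bc)) (a , b , c) tt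
    from : ∀ {A} → co-𝓘 n A → ⟦ family {J = λ _ → ⊤} (λ _ → yes tt) ⟧ A
    from {A} h = family⁺ {J = λ _ → ⊤} (λ _ → yes tt) {A}
      (coconvex∈C ⟦ C ⟧ C? separated (maximal-absorbs isMaximal) A (co-𝓘-coconvex h)
      , λ σ (l , m) → (λ _ → tt) , λ (a , b , c) _ → co-𝓘-coconvex h l m a b c)

  module _ {S S′ : 𝐒* C} where

    -- A new triple of least height has no new predecessors, so adding it alone to the dips of `S`
    -- gives a closed set. Its realisation lies strictly above `S` and not above `S′`, hence equals
    -- `S′` when nothing lies between.
    cover⇒flip : ImmediatelyPrecedes _≈_ _≼_ S S′ → RaisingFlip S S′
    cover⇒flip ((S≼S′ , S≉S′) , nothing-between) = flip-at (least (suc (height (proj₁ new))) (proj₁ new) (proj₂ new) ℕ.≤-refl)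
      where
      New : Triple n → Set
      New σ = Increasing σ × Dips S′ σ × ¬ Dips S σ
      new? : ∀ σ → Dec (New σ)
      new? σ = increasing? σ ×-dec (dips? S′ σ ×-dec ¬? (dips? S σ))

      dips-of : ∀ {σ} → Dec (Dips S σ) → ¬ ¬ Dips S σ → Dips S σ
      dips-of (yes d) _ = d
      dips-of (no ¬d) ¬¬d = ⊥-elim (¬¬d ¬d)

      new : ∃ New
      new with any-triple? new?
      ... | yes h = h
      ... | no none = ⊥-elim (S≉S′ (≼-antisym {S} {S′} S≼S′ λ {σ} inc d → dips-of (dips? S σ) λ ¬d → none (σ , inc , d , ¬d)))

      least : ∀ k σ → New σ → height σ ℕ.< k → ∃ λ σ → New σ × (∀ τ → New τ → ¬ height τ ℕ.< height σ)
      least (suc k) σ h (s≤s bound) with any-triple? (λ τ → new? τ ×-dec (height τ ℕ.<? height σ))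
      ... | yes (τ , h′ , τ<σ) = least k τ h′ (ℕ.≤-trans τ<σ bound)
      ... | no none = σ , h , λ τ h′ τ<σ → none (τ , h′ , τ<σ)

      flip-at : (∃ λ σ → New σ × (∀ τ → New τ → ¬ height τ ℕ.< height σ)) → RaisingFlip S S′
      flip-at (σ , (inc , σ∈S′ , σ∉S) , lowest) = lo σ , mid σ , hi σ , X , proj₁ inc , proj₂ inc
        , ∌⇒∉ (∌! (vertex-lo inc B _ _ _)) , ∌⇒∉ (∌! (vertex-mid inc B _ _ _)) , ∌⇒∉ (∌! (vertex-hi inc B _ _ _))
        , at refl (λ ()) , at vertex-lo≡ (λ ()) , at vertex-mid≡ (λ ()) , at (vertex-▷-hi inc B) (λ ())
        , at (trans (cong (_▷ mid σ) vertex-lo≡) (vertex-▷-mid inc B)) (λ ())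
        , at (trans (cong (_▷ hi σ) vertex-mid≡) (vertex-▷-hi inc B)) (λ ())
        , at (trans (cong (_▷ hi σ) (trans (cong (_▷ mid σ) vertex-lo≡) (vertex-▷-mid inc B))) (vertex-▷-hi inc B)) (λ ())
        , (λ {A} h → Sum.map (λ (SA , A≢v) → full-member⁻ (full S) SA , λ e → A≢v (trans (sym e) vertex-mid≡))
                         (λ e → trans dip≡ (sym e)) (Φ.flip⁺ (full-member⁺ (full S′) h)))
        , (λ { (inj₁ (SA , A≢)) → full-member⁻ (full S′) (Φ.flip⁻ (full-member⁺ (full S) SA) λ e → A≢ (trans vertex-mid≡ (sym e)))
             ; (inj₂ refl) → subst (members S′) (sym dip≡) (full-member⁻ (full S′) Φ.u∈M) })
        where
        B X : Subset n
        B = bottom σ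
        X = vertex inc B false false false
        vertex-lo≡ : X ▷ lo σ ≡ vertex inc B true false false
        vertex-lo≡ = vertex-▷-lo inc B
        vertex-mid≡ : X ▷ mid σ ≡ peakOf inc B
        vertex-mid≡ = vertex-▷-mid inc B
        dip≡ : X ▷ lo σ ▷ hi σ ≡ dipOf inc B
        dip≡ = trans (cong (_▷ hi σ) vertex-lo≡) (vertex-▷-hi inc B)

        predecessors : ∀ {x y q Y} → LowerFace σ B x y q Y → ∀ {p} → Crossed x y Y p → Dips S (place x y p)
        predecessors {x} {y} lf {p} cr = dips-of (dips? S (place x y p)) λ ¬d → lowest (place x y p)
          (crossed-increasing (lower-< inc lf) cr , dips-closed S′ inc σ∈S′ lf cr , ¬d) (predecessor-< inc lf cr)

        J : Triple n → Set
        J τ = Dips S τ ⊎ τ ≡ σ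
        J? : ∀ τ → Dec (J τ)
        J? τ = dips? S τ ⊎-dec (τ ≟₃ σ)
        closed : Closed J
        closed incτ (inj₁ h) lf cr = inj₁ (dips-closed S incτ h lf cr)
        closed incτ (inj₂ refl) lf cr = inj₁ (predecessors lf cr)
        Z : 𝐒* C
        Z = realise J? closed

        S′⊆J : ∀ {τ} → Increasing τ → Dips S′ τ → J τ
        S′⊆J {τ} incτ d with J? τ
        ... | yes h = h
        ... | no ¬Jτ = ⊥-elim (nothing-between Z
                ( ((λ incρ → realise⁺ J? closed incρ ∘ inj₁) , λ S≈Z → σ∉S (⊆⇒≼ {Z} {S} (proj₂ S≈Z) inc (realise⁺ J? closed inc (inj₂ refl))))
                , (λ incρ e → into incρ (realise⁻ J? closed incρ e))
                , λ Z≈S′ → ¬Jτ (realise⁻ J? closed incτ (⊆⇒≼ {S′} {Z} (proj₂ Z≈S′) incτ d))))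
          where
          into : ∀ {ρ} → Increasing ρ → J ρ → Dips S′ ρ
          into incρ (inj₁ h) = S≼S′ incρ h
          into incρ (inj₂ refl) = σ∈S′

        lower : ∀ {V} → Lower σ B V → members S V
        lower {V} = Full.lower-filled (full S) inc σ∉S predecessors {V}
        module Φ = Flip {L = Dips S} {Dips S′} inc S≼S′ S′⊆J σ∈S′ σ∉S (λ {V} low → full-member⁺ (full S) (lower {V} low))

        at : ∀ {V a b c} → V ≡ vertex inc B a b c → ¬ (a ≡ true × b ≡ false × c ≡ true) → members S V
        at {a = a} {b} {c} e h = subst (members S) (sym e) (lower {vertex inc B a b c} (vertex-lower inc B h))

    -- Works at the base `X` of the given flip, with no need to relate it to `bottom σ`. The dips of
    -- `S′` are those of `S` and `σ`, so a collection in between has the dips of one of the two,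
    -- according to whether it has `σ`.
    flip⇒cover : RaisingFlip S S′ → ImmediatelyPrecedes _≈_ _≼_ S S′
    flip⇒cover (i , j , k , X , i<j , j<k , i∉X , j∉X , k∉X , S-X , S-i , S-j , S-k , S-ij , S-jk , S-ijk , S′⊆ , S′⊇) =
        (S≼S′ , λ S≈S′ → σ∉S (⊆⇒≼ {S′} {S} (proj₂ S≈S′) inc σ∈S′))
      , λ Z ((S≼Z , S≉Z) , (Z≼S′ , Z≉S′)) → strictly-between {Z} S≼Z S≉Z Z≼S′ Z≉S′ (dips? Z σ)
      where
      σ : Triple n
      σ = ⟨ i , j , k ⟩
      inc : Increasing σ
      inc = i<j , j<k
      v u : Subset n
      v = peakOf inc X
      u = dipOf inc X
      X≡ : X ≡ vertex inc X false false false
      X≡ = vertex-unique inc X (λ _ _ _ _ → refl) (off (∉⇒∌ i∉X)) (off (∉⇒∌ j∉X)) (off (∉⇒∌ k∉X))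
      i≡ : X ▷ i ≡ vertex inc X true false false
      i≡ = trans (cong (_▷ i) X≡) (vertex-▷-lo inc X)
      v≡ : X ▷ j ≡ v
      v≡ = trans (cong (_▷ j) X≡) (vertex-▷-mid inc X)
      k≡ : X ▷ k ≡ vertex inc X false false true
      k≡ = trans (cong (_▷ k) X≡) (vertex-▷-hi inc X)
      ij≡ : X ▷ i ▷ j ≡ vertex inc X true true false
      ij≡ = trans (cong (_▷ j) i≡) (vertex-▷-mid inc X)
      jk≡ : X ▷ j ▷ k ≡ vertex inc X false true true
      jk≡ = trans (cong (_▷ k) v≡) (vertex-▷-hi inc X)
      ijk≡ : X ▷ i ▷ j ▷ k ≡ vertex inc X true true true
      ijk≡ = trans (cong (_▷ k) ij≡) (vertex-▷-hi inc X)
      u≡ : X ▷ i ▷ k ≡ u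
      u≡ = trans (cong (_▷ k) i≡) (vertex-▷-hi inc X)

      hexagon : ∀ {V} → Hexagon σ X V → members S V
      hexagon {V} (agree , ¬dip , ¬peak) with lookup V i in Vi | lookup V j in Vj | lookup V k in Vk
      ... | false | false | false = subst (members S) (trans X≡ (sym (vertex-unique inc X agree Vi Vj Vk))) S-X
      ... | true  | false | false = subst (members S) (trans i≡ (sym (vertex-unique inc X agree Vi Vj Vk))) S-i
      ... | false | true  | false = ⊥-elim (¬peak (∌! Vi , ∋! Vj , ∌! Vk))
      ... | false | false | true  = subst (members S) (trans k≡ (sym (vertex-unique inc X agree Vi Vj Vk))) S-k
      ... | true  | true  | false = subst (members S) (trans ij≡ (sym (vertex-unique inc X agree Vi Vj Vk))) S-ij
      ... | false | true  | true  = subst (members S) (trans jk≡ (sym (vertex-unique inc X agree Vi Vj Vk))) S-jk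
      ... | true  | false | true  = ⊥-elim (¬dip (∋! Vi , ∌! Vj , ∋! Vk))
      ... | true  | true  | true  = subst (members S) (trans ijk≡ (sym (vertex-unique inc X agree Vi Vj Vk))) S-ijk

      kept : ∀ {A} → members S A → A ≢ v → members S′ A
      kept SA A≢v = S′⊇ (inj₁ (SA , λ e → A≢v (trans (sym e) v≡)))
      σ∈S′ : Dips S′ σ
      σ∈S′ = u , S′⊇ (inj₂ u≡) , dipOf-dip inc X
      σ∉S : ¬ Dips S σ
      σ∉S d = Full.dip-peak-exclusive (full S) inc d (v , subst (members S) v≡ S-j , peakOf-peak inc X)

      S≼S′ : S ≼ S′
      S≼S′ {τ} incτ (A , SA , dip) with A ≟ˢ v | τ ≟₃ σ
      ... | no A≢v | _ = A , kept SA A≢v , dip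
      ... | yes refl | yes refl = ⊥-elim (dip-peak dip (peakOf-peak inc X))
      -- The removed set `v` may be the one showing the dip on `τ`; a witness, which survives the
      -- flip, shows the same dip.
      ... | yes refl | no τ≢σ with hexagon-transfer inc {X} {v} incτ τ≢σ (vertex-agree inc X _ _ _) (inj₂ (peakOf-peak inc X))
      ... | W , hex , same = W , kept (hexagon {W} hex) (λ { refl → proj₂ (proj₂ hex) (peakOf-peak inc X) }) , dip-resp {V = v} {W} same dip

      S′≼S∪σ : ∀ {τ} → Increasing τ → Dips S′ τ → Dips S τ ⊎ τ ≡ σ
      S′≼S∪σ {τ} incτ (A , S′A , dip) with S′⊆ S′A | τ ≟₃ σ
      ... | inj₁ (SA , _) | _ = inj₁ (A , SA , dip)
      ... | inj₂ _ | yes e = inj₂ e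
      ... | inj₂ e | no τ≢σ with hexagon-transfer inc {X} {u} incτ τ≢σ (vertex-agree inc X _ _ _) (inj₁ (dipOf-dip inc X))
      ... | W , hex , same = inj₁ (W , hexagon {W} hex , dip-resp {V = u} {W} same (subst (λ A → Dip A τ) (trans (sym e) u≡) dip))

      strictly-between : ∀ {Z} → S ≼ Z → ¬ S ≈ Z → Z ≼ S′ → ¬ Z ≈ S′ → Dec (Dips Z σ) → ⊥
      strictly-between {Z} S≼Z S≉Z Z≼S′ Z≉S′ (yes σ∈Z) = Z≉S′ (≼-antisym {Z} {S′} Z≼S′ λ incτ d →
        Sum.[ S≼Z incτ , (λ { refl → σ∈Z }) ] (S′≼S∪σ incτ d))
      strictly-between {Z} S≼Z S≉Z Z≼S′ Z≉S′ (no σ∉Z) = S≉Z (≼-antisym {S} {Z} S≼Z λ incτ d →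
        Sum.[ id , (λ { refl → ⊥-elim (σ∉Z d) }) ] (S′≼S∪σ incτ (Z≼S′ incτ d)))

corollary4p4 : ∀ (n : ℕ) (C : Collection n) → IsMaximalChordSeparated C →
    Σ[ _≼_ ∈ Rel (𝐒* C) 0ℓ ] ∃[ _∨_ ] ∃[ _∧_ ]
    (IsDistributiveLattice _≈_ _≼_ _∨_ _∧_ ×
    (∃[ S ] (members S ≐ 𝓘 n × Minimum _≼_ S)) ×
    (∃[ S ] (members S ≐ co-𝓘 n × Maximum _≼_ S)) ×
    (∀ (S S′ : 𝐒* C) → ImmediatelyPrecedes _≈_ _≼_ S S′ ⇔ RaisingFlip S S′))
corollary4p4 n C isMaximal = _≼_ , _⊔_ , _⊓_ , isDistributiveLattice , minimum , maximum
  , λ S S′ → mk⇔ (cover⇒flip {S} {S′}) (flip⇒cover {S} {S′})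
  where open Order isMaximal
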